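{- Let $p$ be a prime. There is a deterministic algorithm which, given nonzero residues $d_1,\ldots,d_{p-1}\in\mathbb Z_p\setminus\{0\}$ and a target residue $\tau\in\mathbb Z_p$, outputs a subset $J\subseteq\{1,\ldots,p-1\}$ such that $\sum_{j\in J}d_j=\tau$ in $\mathbb Z_p$, and runs in $O(p)$ time and $O(p)$ space.
   Context: Computational model: the word RAM, in which arithmetic, division with remainder, and modular inverses on $O(\log p)$-bit words are constant-time operations. -}

module Defs where

-- A word-RAM cost model: unit-cost instructions on natural-number words,
-- including division with remainder and modular inverse.

open import Data.Nat using (ℕ; zero; suc; _+_; _*_; _∸_; _^_; _≤_; _<_; _/_; _%_; _≡ᵇ_; _<ᵇ_)
open import Data.Bool using (Bool; true; false; if_then_else_)
open import Data.List using (List; []; _∷_)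
open import Data.List.Relation.Unary.All using (All)
open import Data.Product using (_×_; _,_)
open import Data.Unit using (⊤)

Mem : Set
Mem = ℕ → ℕ

-- Instructions.  Operands are register (memory-cell) addresses, except the
-- literal constant of 'const' and the jump targets.
data Instr : Set where
  const : (a k : ℕ) → Instr
  add   : (a b c : ℕ) → Instr
  sub   : (a b c : ℕ) → Instr
  mul   : (a b c : ℕ) → Instr
  div   : (a b c : ℕ) → Instr            -- M[a] := M[b] / M[c]   (0 if M[c] = 0)
  mod   : (a b c : ℕ) → Instr            -- M[a] := M[b] % M[c]   (0 if M[c] = 0)
  inv   : (a b c : ℕ) → Instr            -- M[a] := inverse of M[b] modulo M[c] (0 if none)
  lt    : (a b c : ℕ) → Instr
  load  : (a b : ℕ) → Instr
  store : (a b : ℕ) → Instr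
  jz    : (a l : ℕ) → Instr
  jmp   : (l : ℕ) → Instr
  halt  : Instr

Program : Set
Program = List Instr

divℕ : ℕ → ℕ → ℕ
divℕ m zero = 0
divℕ m (suc n) = m / suc n

modℕ : ℕ → ℕ → ℕ
modℕ m zero = 0
modℕ m (suc n) = m % suc n

-- least x < m with b * x ≡ 1 (mod m), or 0 if there is none
private
  findInv : ℕ → (n : ℕ) → ℕ → ℕ
  findInv b n zero = 0
  findInv b n (suc k) =
    if ((b * (suc n ∸ suc k)) % suc n) ≡ᵇ (1 % suc n) then suc n ∸ suc k else findInv b n k

invℕ : ℕ → ℕ → ℕ
invℕ b zero = 0
invℕ b (suc n) = findInv b n (suc n)

ltℕ : ℕ → ℕ → ℕ
ltℕ m n = if m <ᵇ n then 1 else 0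

record Config : Set where
  constructor ⟨_,_⟩
  field
    pc  : ℕ
    mem : Mem
open Config public

instrAt : Program → ℕ → Instr
instrAt [] _ = halt
instrAt (i ∷ is) zero = i
instrAt (i ∷ is) (suc n) = instrAt is n

update : Mem → ℕ → ℕ → Mem
update M a v x = if x ≡ᵇ a then v else M x

exec : Instr → Config → Config
exec (const a k) ⟨ c , M ⟩ = ⟨ suc c , update M a k ⟩
exec (add a b d) ⟨ c , M ⟩ = ⟨ suc c , update M a (M b + M d) ⟩
exec (sub a b d) ⟨ c , M ⟩ = ⟨ suc c , update M a (M b ∸ M d) ⟩
exec (mul a b d) ⟨ c , M ⟩ = ⟨ suc c , update M a (M b * M d) ⟩
exec (div a b d) ⟨ c , M ⟩ = ⟨ suc c , update M a (divℕ (M b) (M d)) ⟩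
exec (mod a b d) ⟨ c , M ⟩ = ⟨ suc c , update M a (modℕ (M b) (M d)) ⟩
exec (inv a b d) ⟨ c , M ⟩ = ⟨ suc c , update M a (invℕ (M b) (M d)) ⟩
exec (lt a b d)  ⟨ c , M ⟩ = ⟨ suc c , update M a (ltℕ (M b) (M d)) ⟩
exec (load a b)  ⟨ c , M ⟩ = ⟨ suc c , update M a (M (M b)) ⟩
exec (store a b) ⟨ c , M ⟩ = ⟨ suc c , update M (M a) (M b) ⟩
exec (jz a l)    ⟨ c , M ⟩ = if M a ≡ᵇ 0 then ⟨ l , M ⟩ else ⟨ suc c , M ⟩
exec (jmp l)     ⟨ c , M ⟩ = ⟨ l , M ⟩
exec halt        cfg       = cfg

step : Program → Config → Config
step P cfg = exec (instrAt P (pc cfg)) cfg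

run : Program → ℕ → Config → Config
run P zero cfg = cfg
run P (suc t) cfg = run P t (step P cfg)

isHalt : Instr → Bool
isHalt halt = true
isHalt _ = false

Halted : Program → Config → Set
Halted P cfg = isHalt (instrAt P (pc cfg)) ≡ true
  where open import Relation.Binary.PropositionalEquality using (_≡_)

addrs : Instr → Mem → List ℕ
addrs (const a k) M = a ∷ []
addrs (add a b c) M = a ∷ b ∷ c ∷ []
addrs (sub a b c) M = a ∷ b ∷ c ∷ []
addrs (mul a b c) M = a ∷ b ∷ c ∷ []
addrs (div a b c) M = a ∷ b ∷ c ∷ []
addrs (mod a b c) M = a ∷ b ∷ c ∷ []
addrs (inv a b c) M = a ∷ b ∷ c ∷ []
addrs (lt a b c)  M = a ∷ b ∷ c ∷ []
addrs (load a b)  M = a ∷ b ∷ M b ∷ []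
addrs (store a b) M = a ∷ M a ∷ b ∷ []
addrs (jz a l)    M = a ∷ []
addrs (jmp l)     M = []
addrs halt        M = []

written : Instr → Mem → List ℕ
written (const a k) M = k ∷ []
written (add a b c) M = (M b + M c) ∷ []
written (sub a b c) M = (M b ∸ M c) ∷ []
written (mul a b c) M = (M b * M c) ∷ []
written (div a b c) M = divℕ (M b) (M c) ∷ []
written (mod a b c) M = modℕ (M b) (M c) ∷ []
written (inv a b c) M = invℕ (M b) (M c) ∷ []
written (lt a b c)  M = ltℕ (M b) (M c) ∷ []
written (load a b)  M = M (M b) ∷ []
written (store a b) M = M b ∷ []
written (jz a l)    M = []
written (jmp l)     M = []
written halt        M = []

StepWithin : Program → (S W : ℕ) → Config → Set
StepWithin P S W cfg =
  All (λ a → a ≤ S) (addrs (instrAt P (pc cfg)) (mem cfg)) ×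
  All (λ v → v < W) (written (instrAt P (pc cfg)) (mem cfg))

initMem : ℕ → (ℕ → ℕ) → ℕ → Mem
initMem p d τ a =
  if a ≡ᵇ 0 then p else if a <ᵇ p then d a else if a ≡ᵇ p then τ else 0

initConfig : ℕ → (ℕ → ℕ) → ℕ → Config
initConfig p d τ = ⟨ 0 , initMem p d τ ⟩

-- Output encoding: J = { j ∈ {1,…,p-1} | M[p + j] ≠ 0 }.
-- subsetSum p d M = Σ_{j ∈ J} d j  (as a natural number), summing j = 1 … p-1
subsetSumUpTo : ℕ → (ℕ → ℕ) → Mem → ℕ → ℕ
subsetSumUpTo p d M zero = 0
subsetSumUpTo p d M (suc k) =
  (if M (p + suc k) ≡ᵇ 0 then 0 else d (suc k)) + subsetSumUpTo p d M k

subsetSum : ℕ → (ℕ → ℕ) → Mem → ℕ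
subsetSum p d M = subsetSumUpTo p d M (p ∸ 1)

{-# OPTIONS --safe #-}
module Submission where

open import Defs
open import Data.Bool using (true; false; if_then_else_; T)
open import Data.Empty using (⊥)
open import Data.List using (List; []; _∷_; _++_; length)
open import Data.List.Properties using (length-++; ++-assoc; ++-identityʳ)
open import Data.List.Relation.Unary.All using (All; []; _∷_)
open import Data.Nat
open import Data.Nat.Coprimality using (prime⇒coprime; coprime-Bézout)
open import Data.Nat.Divisibility using (_∣_; divides; ∣⇒≤; ∣m+n∣m⇒∣n; n∣m*n)
open import Data.Nat.DivMod using (m≡m%n+[m/n]*n; m%n<n; m/n≤m; m%n≤m; m*n/n≡m)
open import Data.Nat.GCD using (module Bézout)
open import Data.Nat.Primality using (Prime; euclidsLemma; prime⇒nonTrivial)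
open import Data.Nat.Properties
open import Data.Nat.Tactic.RingSolver using (solve-∀)
open import Data.Product using (Σ; _×_; _,_; proj₁; proj₂)
open import Data.Sum using (_⊎_; inj₁; inj₂; map₂)
open import Data.Unit using (⊤; tt)
open import Relation.Binary.Definitions using (tri<; tri≈; tri>)
open import Relation.Binary.PropositionalEquality using (_≡_; _≢_; refl; sym; trans; cong; cong₂; subst; subst₂)
open import Relation.Nullary using (¬_; yes; no; contradiction)

-- Scale the residues so that the most frequent one up to sign becomes 1, and replace r by −r where
-- needed (shifting the target), so that all r_j lie in [1, p/2].  Grow an interval [0, m] of
-- reachable sums: an element r ≤ m + 1 extends it by r; two larger elements whose values differ by
-- 1 ≤ δ ≤ m + 1 extend it by δ, by using exactly one of them.  To find such pairs in constant time,
-- throw the large elements into buckets of width at most m + 1 and keep in each bucket a stack of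
-- pending elements of one value: a newcomer of a different value is paired with the top, otherwise
-- it is pushed.  What remains pending has one value per bucket, hence at most (multiplicity of 1)
-- elements, so one pairing round reaches m ≥ (p−1)/4, and then a round with a single bucket reaches
-- m ≥ (p−1)/2, after which every element extends the interval.  A pair may waste an element, but
-- pairs are formed only while the unused elements (each ≥ 2, later each ≥ p/4) still suffice to
-- reach m ≥ p−1.  Finally the choices are read off greedily in reverse order.

-- Linear time is possible because every search is a table lookup indexed by residues:
-- multiplicities up to sign are counted under the key d² (modulo a prime, x² = y² only for x = ±y),
-- division by the scale e is read from a table of its multiples, and buckets are array cells. The
-- accounting rests on one inequality: a pair consumes two elements and lengthens the interval by at
-- least 1, so every used element contributes at least 1/2 on average. The other obstacle is the
-- machine: the input fills the low cells, and for small p the prescribed output cells are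
-- themselves registers. Hence a small structured language, whose unnested loops of p - 1 rounds
-- make linear cost a matter of syntax, framed by code that moves the low cells away and brings the
-- output back.

≡ᵇ-refl : ∀ n → (n ≡ᵇ n) ≡ true
≡ᵇ-refl zero = refl
≡ᵇ-refl (suc n) = ≡ᵇ-refl n

≢⇒≡ᵇ-false : ∀ m n → m ≢ n → (m ≡ᵇ n) ≡ false
≢⇒≡ᵇ-false zero zero m≢n = contradiction refl m≢n
≢⇒≡ᵇ-false zero (suc n) _ = refl
≢⇒≡ᵇ-false (suc m) zero _ = refl
≢⇒≡ᵇ-false (suc m) (suc n) m≢n = ≢⇒≡ᵇ-false m n (λ e → m≢n (cong suc e))

update-same : ∀ (f : ℕ → ℕ) a v → update f a v a ≡ v
update-same f a v rewrite ≡ᵇ-refl a = refl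

update-other : ∀ (f : ℕ → ℕ) a v {x} → x ≢ a → update f a v x ≡ f x
update-other f a v {x} x≢a rewrite ≢⇒≡ᵇ-false x a x≢a = refl

ltℕ-case : ∀ m n → (m < n × ltℕ m n ≡ 1) ⊎ (n ≤ m × ltℕ m n ≡ 0)
ltℕ-case m zero = inj₂ (z≤n , refl)
ltℕ-case zero (suc n) = inj₁ (z<s , refl)
ltℕ-case (suc m) (suc n) with ltℕ-case m n
... | inj₁ (m<n , e) = inj₁ (s≤s m<n , e)
... | inj₂ (n≤m , e) = inj₂ (s≤s n≤m , e)

divℕ≤ : ∀ m n → divℕ m n ≤ m
divℕ≤ m zero = z≤n
divℕ≤ m (suc n) = m/n≤m m (suc n)

modℕ≤ : ∀ m n → modℕ m n ≤ m
modℕ≤ m zero = z≤n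
modℕ≤ m (suc n) = m%n≤m m (suc n)

-- Runs of the machine

-- The number is an upper bound on the steps, not their count (`stop` accepts any), so that branches
-- of different lengths share one bound. The space and word conditions are recorded for every step
-- made.
data Reach (P : Program) (S W : ℕ) : Config → ℕ → Config → Set where
  stop : ∀ {c n} → Reach P S W c n c
  go   : ∀ {c n c′} → StepWithin P S W c → Reach P S W (step P c) n c′ →
         Reach P S W c (suc n) c′

module _ {P : Program} {S W : ℕ} where

  Reach-mono : ∀ {c n n′ c′} → n ≤ n′ → Reach P S W c n c′ → Reach P S W c n′ c′
  Reach-mono _ stop = stop
  Reach-mono (s≤s n≤n′) (go w r) = go w (Reach-mono n≤n′ r)

  Reach-trans : ∀ {c n c′ n′ c″} →
    Reach P S W c n c′ → Reach P S W c′ n′ c″ → Reach P S W c (n + n′) c″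
  Reach-trans {n = n} {n′ = n′} stop r = Reach-mono (m≤n+m n′ n) r
  Reach-trans (go w r) r′ = go w (Reach-trans r r′)

  step-halted : ∀ c → Halted P c → step P c ≡ c
  step-halted c h with instrAt P (pc c)
  step-halted c h | halt = refl

  within-halted : ∀ c → Halted P c → StepWithin P S W c
  within-halted c h with instrAt P (pc c)
  within-halted c h | halt = [] , []

  run-halted : ∀ t c → Halted P c → run P t c ≡ c
  run-halted zero c h = refl
  run-halted (suc t) c h rewrite step-halted c h = run-halted t c h

  Reach⇒run : ∀ {c n c′} → Reach P S W c n c′ → Halted P c′ → ∀ {t} → n ≤ t → run P t c ≡ c′
  Reach⇒run stop h {t} _ = run-halted t _ h
  Reach⇒run (go w r) h (s≤s n≤t) = Reach⇒run r h n≤t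

  Reach⇒within : ∀ {c n c′} → Reach P S W c n c′ → Halted P c′ → ∀ t → StepWithin P S W (run P t c)
  Reach⇒within {c} stop h t rewrite run-halted t c h = within-halted c h
  Reach⇒within (go w r) h zero = w
  Reach⇒within (go w r) h (suc t) = Reach⇒within r h t

-- The end address enters only through an equation at the end of the list, so matching on `refl`
-- there identifies it without any computation of lengths.
CodeAt : Program → ℕ → ℕ → List Instr → Set
CodeAt P c c′ [] = c ≡ c′
CodeAt P c c′ (i ∷ is) = instrAt P c ≡ i × CodeAt P (suc c) c′ is

CodeAt-++ : ∀ P c c′ xs {ys} → CodeAt P c c′ (xs ++ ys) →
  CodeAt P c (c + length xs) xs × CodeAt P (c + length xs) c′ ys
CodeAt-++ P c c′ [] {ys} k = sym (+-identityʳ c) , subst (λ z → CodeAt P z c′ ys) (sym (+-identityʳ c)) k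
CodeAt-++ P c c′ (x ∷ xs) {ys} (e , k) with CodeAt-++ P (suc c) c′ xs k
... | k₁ , k₂ rewrite +-suc c (length xs) = (e , k₁) , k₂

CodeAt-end : ∀ P c c′ xs → CodeAt P c c′ xs → c′ ≡ c + length xs
CodeAt-end P c c′ [] refl = sym (+-identityʳ c)
CodeAt-end P c c′ (x ∷ xs) (_ , k) = trans (CodeAt-end P (suc c) c′ xs k) (sym (+-suc c (length xs)))

instrAt-++ : ∀ xs ys n → instrAt (xs ++ ys) (length xs + n) ≡ instrAt ys n
instrAt-++ [] ys n = refl
instrAt-++ (x ∷ xs) ys n = instrAt-++ xs ys n

CodeAt-prefix : ∀ xs ys zs → CodeAt (xs ++ ys ++ zs) (length xs) (length xs + length ys) ys
CodeAt-prefix xs [] zs = sym (+-identityʳ _)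
CodeAt-prefix xs (y ∷ ys) zs =
  trans (cong (instrAt (xs ++ y ∷ ys ++ zs)) (sym (+-identityʳ _))) (instrAt-++ xs (y ∷ ys ++ zs) 0) ,
  subst₂ (λ l P → CodeAt P l (length xs + suc (length ys)) ys) len≡ assoc≡
    (subst (λ l → CodeAt ((xs ++ y ∷ []) ++ ys ++ zs) (length (xs ++ y ∷ [])) l ys) end≡
      (CodeAt-prefix (xs ++ y ∷ []) ys zs))
  where
  len≡ : length (xs ++ y ∷ []) ≡ suc (length xs)
  len≡ = trans (length-++ xs) (+-comm (length xs) 1)
  end≡ : length (xs ++ y ∷ []) + length ys ≡ length xs + suc (length ys)
  end≡ = trans (cong (_+ length ys) len≡) (sym (+-suc (length xs) (length ys)))
  assoc≡ : (xs ++ y ∷ []) ++ ys ++ zs ≡ xs ++ y ∷ ys ++ zs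
  assoc≡ = ++-assoc xs (y ∷ []) (ys ++ zs)

-- A structured language over the machine

-- Registers 0, 1, 2 hold N = 32p, p and the loop counter; registers 3 … 14 the
-- variables; registers 15 … K are temporaries.  Cell x of array i has address i·N + x.
-- Array 0 overlaps the registers, so only its cells above K may be used.
K U I T₀ : ℕ
K = 24
U = 12
I = 15
T₀ = 15

data Op : Set where
  plus minus times over rem : Op

opF : Op → ℕ → ℕ → ℕ
opF plus = _+_
opF minus = _∸_
opF times = _*_
opF over = divℕ
opF rem = modℕ

opI : Op → ℕ → ℕ → ℕ → Instr
opI plus = add
opI minus = sub
opI times = mul
opI over = div
opI rem = mod

data Expr : Set where
  pp jj : Expr
  lit : ℕ → Expr
  var : ℕ → Expr
  op  : Op → Expr → Expr → Expr
  rd  : ℕ → Expr → Expr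

infixl 6 _⊕_ _⊖_
infixl 7 _⊗_ _⊘_ _⊛_
pattern _⊕_ a b = op plus a b
pattern _⊖_ a b = op minus a b
pattern _⊗_ a b = op times a b
pattern _⊘_ a b = op over a b
pattern _⊛_ a b = op rem a b

infix 5 _≔_ _[_]≔_ when_≺_then_else_
infixr 4 _⨾_
data Body : Set where
  skip : Body
  _≔_ : ℕ → Expr → Body
  _[_]≔_ : ℕ → Expr → Expr → Body
  _⨾_ : Body → Body → Body
  when_≺_then_else_ : Expr → Expr → Body → Body → Body

infixr 3 _▸_
-- A loop contains a `Body`, which is itself free of loops, and always makes p - 1 rounds. The
-- running time is therefore at most a syntactic constant times p.
data Cmd : Set where
  blk  : Body → Cmd
  loop : Body → Cmd
  _▸_  : Cmd → Cmd → Cmd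

Vars Arrs : Set
Vars = ℕ → ℕ
Arrs = ℕ → ℕ → ℕ

setArr : Arrs → ℕ → ℕ → ℕ → Arrs
setArr ar i x v i′ = if i′ ≡ᵇ i then update (ar i′) x v else ar i′

Asrt : Set₁
Asrt = Vars → Arrs → Set

-- Governs the word length: leaves and array reads are at most V, so an expression of size s and all
-- its intermediate values are at most V ^ s. The limit 16 in `Ok` gives the bound V ^ 16 on all
-- words.
size : Expr → ℕ
size pp = 1
size jj = 1
size (lit _) = 1
size (var _) = 1
size (op _ a b) = size a + size b
size (rd _ e) = size e

-- Phrased with Boolean tests, so that for a concrete program all these conditions evaluate to the
-- unit type and need no proof.
OkE : ℕ → Expr → Set
OkE n pp = T (n ≤ᵇ K)
OkE n jj = T (n ≤ᵇ K)
OkE n (lit k) = T (n ≤ᵇ K) × T (k ≤ᵇ 32)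
OkE n (var x) = T (n ≤ᵇ K) × T (x <ᵇ U)
OkE n (op o a b) = OkE n a × OkE (suc n) b
OkE n (rd i e) = OkE n e × T (suc n ≤ᵇ K) × T (i <ᵇ I)

Ok : ℕ → Expr → Set
Ok n e = OkE n e × T (size e ≤ᵇ 16)

OkB : Body → Set
OkB skip = ⊤
OkB (x ≔ e) = Ok T₀ e × T (x <ᵇ U)
OkB (i [ a ]≔ e) = Ok T₀ a × Ok (suc T₀) e × T (i <ᵇ I)
OkB (b₁ ⨾ b₂) = OkB b₁ × OkB b₂
OkB (when e₁ ≺ e₂ then b₁ else b₂) = Ok T₀ e₁ × Ok (suc T₀) e₂ × OkB b₁ × OkB b₂

-- The value is left in register n, and only registers from n upwards are touched. The machine has
-- no move instruction; a register is copied by clearing the destination and adding.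
compE : ℕ → Expr → List Instr
compE n pp = const n 0 ∷ add n n 1 ∷ []
compE n jj = const n 0 ∷ add n n 2 ∷ []
compE n (lit k) = const n k ∷ []
compE n (var x) = const n 0 ∷ add n n (3 + x) ∷ []
compE n (op o a b) = compE n a ++ compE (suc n) b ++ opI o n n (suc n) ∷ []
compE n (rd i e) = compE n e ++ const (suc n) i ∷ mul (suc n) (suc n) 0 ∷ add n n (suc n) ∷ load n n ∷ []

compB : ℕ → Body → List Instr
compB c skip = []
compB c (x ≔ e) = compE T₀ e ++ const (3 + x) 0 ∷ add (3 + x) (3 + x) T₀ ∷ []
compB c (i [ a ]≔ e) =
  (compE T₀ a ++ compE (suc T₀) e) ++
  const (2 + T₀) i ∷ mul (2 + T₀) (2 + T₀) 0 ∷ add T₀ T₀ (2 + T₀) ∷ store T₀ (suc T₀) ∷ []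
compB c (b₁ ⨾ b₂) = compB c b₁ ++ compB (c + length (compB c b₁)) b₂
compB c (when e₁ ≺ e₂ then b₁ else b₂) =
  let test = compE T₀ e₁ ++ compE (suc T₀) e₂
      c₁   = 2 + (c + length test)
      yes₁ = compB c₁ b₁
      c₂   = suc (c₁ + length yes₁)
      no₁  = compB c₂ b₂
  in test ++ lt T₀ T₀ (suc T₀) ∷ jz T₀ c₂ ∷ yes₁ ++ jmp (c₂ + length no₁) ∷ no₁

compC : ℕ → Cmd → List Instr
compC c (blk b) = compB c b
compC c (loop b) =
  let body = compB (3 + c) b
  in const 2 1 ∷ lt T₀ 2 1 ∷ jz T₀ (6 + (c + length body)) ∷
     body ++ const T₀ 1 ∷ add 2 2 T₀ ∷ jmp (suc c) ∷ []
compC c (k₁ ▸ k₂) = compC c k₁ ++ compC (c + length (compC c k₁)) k₂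

-- Bound on the running time of a command, divided by p.
cost : ℕ → Cmd → ℕ
cost c (blk b) = length (compB c b)
cost c (loop b) = 6 + length (compB (3 + c) b)
cost c (k₁ ▸ k₂) = cost c k₁ + cost (c + length (compC c k₁)) k₂

OkC : Cmd → Set
OkC (blk b) = OkB b
OkC (loop b) = OkB b
OkC (k₁ ▸ k₂) = OkC k₁ × OkC k₂

-- Semantics and weakest preconditions

module Semantics (p N : ℕ) where

  -- Quadratic because the a priori bound on the interval length m is p · p; all other stored values
  -- are at most linear in p.
  V : ℕ
  V = N * N

  ⟦_⟧ : Expr → ℕ → Vars → Arrs → ℕ
  ⟦ pp ⟧ j vr ar = p
  ⟦ jj ⟧ j vr ar = j
  ⟦ lit k ⟧ j vr ar = k
  ⟦ var x ⟧ j vr ar = vr x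
  ⟦ op o a b ⟧ j vr ar = opF o (⟦ a ⟧ j vr ar) (⟦ b ⟧ j vr ar)
  ⟦ rd i e ⟧ j vr ar = ar i (⟦ e ⟧ j vr ar)

  Low : ℕ → ℕ → Set
  Low zero x = K < x
  Low (suc _) x = ⊤

  Safe : Expr → ℕ → Vars → Arrs → Set
  Safe pp j vr ar = ⊤
  Safe jj j vr ar = ⊤
  Safe (lit k) j vr ar = ⊤
  Safe (var x) j vr ar = ⊤
  Safe (op o a b) j vr ar = Safe a j vr ar × Safe b j vr ar
  Safe (rd i e) j vr ar = Safe e j vr ar × ⟦ e ⟧ j vr ar < N × Low i (⟦ e ⟧ j vr ar)

  -- The side conditions keep stored words at most V and array indices below N.
  wp : Body → Asrt → ℕ → Vars → Arrs → Set
  wp skip Φ j vr ar = Φ vr ar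
  wp (x ≔ e) Φ j vr ar =
    Safe e j vr ar × ⟦ e ⟧ j vr ar ≤ V × Φ (update vr x (⟦ e ⟧ j vr ar)) ar
  wp (i [ a ]≔ e) Φ j vr ar =
    (Safe a j vr ar × ⟦ a ⟧ j vr ar < N × Low i (⟦ a ⟧ j vr ar)) ×
    Safe e j vr ar × ⟦ e ⟧ j vr ar ≤ V ×
    Φ vr (setArr ar i (⟦ a ⟧ j vr ar) (⟦ e ⟧ j vr ar))
  wp (b₁ ⨾ b₂) Φ j vr ar = wp b₁ (λ vr′ ar′ → wp b₂ Φ j vr′ ar′) j vr ar
  wp (when e₁ ≺ e₂ then b₁ else b₂) Φ j vr ar =
    (Safe e₁ j vr ar × Safe e₂ j vr ar) ×
    (⟦ e₁ ⟧ j vr ar < ⟦ e₂ ⟧ j vr ar → wp b₁ Φ j vr ar) ×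
    (⟦ e₂ ⟧ j vr ar ≤ ⟦ e₁ ⟧ j vr ar → wp b₂ Φ j vr ar)

-- Correctness of compiled expressions

T⇒≤ : ∀ m n → T (m ≤ᵇ n) → m ≤ n
T⇒≤ m n = ≤ᵇ⇒≤ m n

T⇒< : ∀ m n → T (m <ᵇ n) → m < n
T⇒< m n = <ᵇ⇒< m n

address-injective : ∀ {N} i i′ {x x′} → x < N → x′ < N → i * N + x ≡ i′ * N + x′ → i ≡ i′ × x ≡ x′
address-injective zero zero _ _ e = refl , e
address-injective {N} zero (suc i′) {x} {x′} x<N _ e =
  contradiction (subst (N ≤_) (trans (sym (+-assoc N (i′ * N) x′)) (sym e)) (m≤m+n N _)) (<⇒≱ x<N)
address-injective {N} (suc i) zero {x} {x′} _ x′<N e =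
  contradiction (subst (N ≤_) (trans (sym (+-assoc N (i * N) x)) e) (m≤m+n N _)) (<⇒≱ x′<N)
address-injective {N} (suc i) (suc i′) {x} {x′} x<N x′<N e
  with address-injective i i′ x<N x′<N
         (+-cancelˡ-≡ N _ _ (trans (sym (+-assoc N (i * N) x)) (trans e (+-assoc N (i′ * N) x′))))
... | i≡i′ , x≡x′ = cong suc i≡i′ , x≡x′

-- Lets a sum be bounded like a product: the bounds V ^ a and V ^ b of the summands are at least 2,
-- so their sum is at most V ^ (a + b).
sum≤product : ∀ {x y} → 2 ≤ x → 2 ≤ y → x + y ≤ x * y
sum≤product {x} {y} 2≤x 2≤y with ≤-total x y
... | inj₁ x≤y = ≤-trans (+-monoˡ-≤ y x≤y) (≤-trans (≤-reflexive (cong (y +_) (sym (+-identityʳ y)))) (*-monoˡ-≤ y 2≤x))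
... | inj₂ y≤x = ≤-trans (+-monoʳ-≤ x y≤x) (≤-trans (≤-reflexive (trans (cong (x +_) (sym (+-identityʳ x))) (*-comm 2 x))) (*-monoʳ-≤ x 2≤y))

size≥1 : ∀ e → 1 ≤ size e
size≥1 pp = ≤-refl
size≥1 jj = ≤-refl
size≥1 (lit _) = ≤-refl
size≥1 (var _) = ≤-refl
size≥1 (op _ a b) = ≤-trans (size≥1 a) (m≤m+n _ _)
size≥1 (rd _ e) = size≥1 e

OkE⇒≤K : ∀ n e → OkE n e → n ≤ K
OkE⇒≤K n pp k = T⇒≤ n K k
OkE⇒≤K n jj k = T⇒≤ n K k
OkE⇒≤K n (lit _) (k , _) = T⇒≤ n K k
OkE⇒≤K n (var _) (k , _) = T⇒≤ n K k
OkE⇒≤K n (op _ a b) (k , _) = OkE⇒≤K n a k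
OkE⇒≤K n (rd _ e) (k , _) = OkE⇒≤K n e k

module Soundness
  (p N : ℕ) (2≤p : 2 ≤ p) (N≡32p : N ≡ 32 * p) (P : Program) (S W : ℕ)
  (S-bound : I * N ≤ S) (W-bound : ∀ {n} → n ≤ (N * N) ^ 16 → n < W) where

  open Semantics p N

  64≤N : 64 ≤ N
  64≤N = ≤-trans (*-monoʳ-≤ 32 2≤p) (≤-reflexive (sym N≡32p))

  1≤N : 1 ≤ N
  1≤N = ≤-trans (s≤s z≤n) 64≤N

  K<N : K < N
  K<N = ≤-trans (m≤m+n 25 39) 64≤N

  N≤V : N ≤ V
  N≤V = ≤-trans (≤-reflexive (sym (*-identityʳ N))) (*-monoʳ-≤ N 1≤N)

  p≤N : p ≤ N
  p≤N = ≤-trans (m≤m+n p (31 * p)) (≤-reflexive (sym N≡32p))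

  2≤V : 2 ≤ V
  2≤V = ≤-trans (≤-trans (s≤s (s≤s z≤n)) 64≤N) N≤V

  instance
    V-nonZero : NonZero V
    V-nonZero = >-nonZero (≤-trans (s≤s z≤n) 2≤V)

  V^-mono : ∀ {a b} → a ≤ b → V ^ a ≤ V ^ b
  V^-mono a≤b = ^-monoʳ-≤ V a≤b

  V≤V^ : ∀ {a} → 1 ≤ a → V ≤ V ^ a
  V≤V^ 1≤a = ≤-trans (≤-reflexive (sym (^-identityʳ V))) (V^-mono 1≤a)

  ≤V⇒<W : ∀ {n} → n ≤ V → n < W
  ≤V⇒<W n≤V = W-bound (≤-trans n≤V (V≤V^ {16} (s≤s z≤n)))

  K≤S : K ≤ S
  K≤S = ≤-trans (<⇒≤ K<N) (≤-trans (m≤m+n N (14 * N)) S-bound)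

  reg≤S : ∀ {n} → n ≤ K → n ≤ S
  reg≤S n≤K = ≤-trans n≤K K≤S

  address-bound : ∀ {i x} → i < I → x < N → i * N + x ≤ I * N
  address-bound {i} {x} i<I x<N =
    ≤-trans (+-monoʳ-≤ (i * N) (<⇒≤ x<N)) (≤-trans (≤-reflexive (+-comm (i * N) N)) (*-monoˡ-≤ N i<I))

  I*N≤V : I * N ≤ V
  I*N≤V = *-monoˡ-≤ N (≤-trans (m≤m+n I 49) 64≤N)

  Low⇒K< : ∀ i {x} → Low i x → K < i * N + x
  Low⇒K< zero l = l
  Low⇒K< (suc i) _ = ≤-trans K<N (≤-trans (m≤m+n N (i * N)) (m≤m+n _ _))

  record Sim (j : ℕ) (vr : Vars) (ar : Arrs) (M : Mem) : Set where
    field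
      rN : M 0 ≡ N
      rp : M 1 ≡ p
      rj : M 2 ≡ j
      rv : ∀ x → x < U → M (3 + x) ≡ vr x
      ra : ∀ i x → i < I → x < N → Low i x → M (i * N + x) ≡ ar i x
      bj : j ≤ V
      bv : ∀ x → x < U → vr x ≤ V
      ba : ∀ i x → i < I → x < N → Low i x → ar i x ≤ V
  open Sim public

  -- The simulation does not look at the temporaries `T₀` to `K`, which is what allows compiled
  -- expressions to overwrite them.
  Sim-frame : ∀ {j vr ar M M′} → (∀ a → a < T₀ ⊎ K < a → M′ a ≡ M a) → Sim j vr ar M → Sim j vr ar M′
  Sim-frame f s = record
    { rN = trans (f 0 (inj₁ (s≤s z≤n))) (rN s)
    ; rp = trans (f 1 (inj₁ (s≤s (s≤s z≤n)))) (rp s)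
    ; rj = trans (f 2 (inj₁ (s≤s (s≤s (s≤s z≤n))))) (rj s)
    ; rv = λ x x<U → trans (f (3 + x) (inj₁ (s≤s (s≤s (s≤s x<U))))) (rv s x x<U)
    ; ra = λ i x i<I x<N l → trans (f (i * N + x) (inj₂ (Low⇒K< i l))) (ra s i x i<I x<N l)
    ; bj = bj s ; bv = bv s ; ba = ba s }

  ⟦⟧-bound : ∀ e {n j vr ar M} → OkE n e → Safe e j vr ar → Sim j vr ar M → ⟦ e ⟧ j vr ar ≤ V ^ size e
  ⟦⟧-bound pp _ _ s = ≤-trans (≤-trans p≤N N≤V) (V≤V^ {1} ≤-refl)
  ⟦⟧-bound jj _ _ s = ≤-trans (bj s) (V≤V^ {1} ≤-refl)
  ⟦⟧-bound (lit k) (_ , k≤) _ s =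
    ≤-trans (T⇒≤ k 32 k≤) (≤-trans (≤-trans (m≤m+n 32 32) 64≤N) (≤-trans N≤V (V≤V^ {1} ≤-refl)))
  ⟦⟧-bound (var x) (_ , x<) _ s = ≤-trans (bv s x (T⇒< x U x<)) (V≤V^ {1} ≤-refl)
  ⟦⟧-bound (op o a b) {j = j} {vr} {ar} (oa , ob) (sa , sb) s = bound o
    where
    x = ⟦ a ⟧ j vr ar
    y = ⟦ b ⟧ j vr ar
    x≤ : x ≤ V ^ size a
    x≤ = ⟦⟧-bound a oa sa s
    y≤ : y ≤ V ^ size b
    y≤ = ⟦⟧-bound b ob sb s
    x≤′ : x ≤ V ^ (size a + size b)
    x≤′ = ≤-trans x≤ (V^-mono (m≤m+n (size a) (size b)))
    bound : ∀ o → opF o x y ≤ V ^ (size a + size b)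
    bound plus = ≤-trans (+-mono-≤ x≤ y≤)
      (≤-trans (sum≤product (≤-trans 2≤V (V≤V^ (size≥1 a))) (≤-trans 2≤V (V≤V^ (size≥1 b))))
        (≤-reflexive (sym (^-distribˡ-+-* V (size a) (size b)))))
    bound minus = ≤-trans (m∸n≤m x y) x≤′
    bound times = ≤-trans (*-mono-≤ x≤ y≤) (≤-reflexive (sym (^-distribˡ-+-* V (size a) (size b))))
    bound over = ≤-trans (divℕ≤ x y) x≤′
    bound rem = ≤-trans (modℕ≤ x y) x≤′
  ⟦⟧-bound (rd i e) (_ , _ , i<) (_ , x< , l) s =
    ≤-trans (ba s i _ (T⇒< i I i<) x< l) (V≤V^ (size≥1 e))

  step₁ : ∀ {c M i n cf} → instrAt P c ≡ i →
    All (_≤ S) (addrs i M) → All (_< W) (written i M) →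
    Reach P S W (exec i ⟨ c , M ⟩) n cf → Reach P S W ⟨ c , M ⟩ (suc n) cf
  step₁ {c} {M} {n = n} {cf} eq a w r =
    go (subst (λ z → All (_≤ S) (addrs z M) × All (_< W) (written z M)) (sym eq) (a , w))
       (subst (λ z → Reach P S W (exec z ⟨ c , M ⟩) n cf) (sym eq) r)

  -- `frame` protects the registers below n, where left operands of enclosing expressions are
  -- waiting, and everything above `K`, where the arrays are.
  record Eval (c : ℕ) (M : Mem) (k c′ n v : ℕ) : Set where
    constructor eval
    field
      final : Mem
      path  : Reach P S W ⟨ c , M ⟩ k ⟨ c′ , final ⟩
      value : final n ≡ v
      frame : ∀ a → a < n ⊎ K < a → final a ≡ M a

  move : ∀ {c c′ M} n a → n ≢ a → n ≤ S → a ≤ S → M a < W → CodeAt P c c′ (const n 0 ∷ add n n a ∷ []) →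
    Σ Mem λ M′ → Reach P S W ⟨ c , M ⟩ 2 ⟨ c′ , M′ ⟩ × M′ n ≡ M a × (∀ x → x ≢ n → M′ x ≡ M x)
  move {c} {c′} {M} n a n≢a n≤S a≤S v<W (e₁ , e₂ , refl) =
    M₂ ,
    step₁ e₁ (n≤S ∷ []) (≤V⇒<W z≤n ∷ [])
      (step₁ e₂ (n≤S ∷ n≤S ∷ a≤S ∷ []) (subst (_< W) (sym val) v<W ∷ []) stop) ,
    trans (update-same M₁ n _) val ,
    λ x x≢n → trans (update-other M₁ n _ x≢n) (update-other M n 0 x≢n)
    where
    M₁ = update M n 0
    M₂ = update M₁ n (M₁ n + M₁ a)
    val : M₁ n + M₁ a ≡ M a
    val = cong₂ _+_ (update-same M n 0) (update-other M n 0 (λ e → n≢a (sym e)))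

  outside : ∀ {n a} → n ≤ K → a < n ⊎ K < a → a ≢ n
  outside n≤K (inj₁ a<n) refl = <-irrefl refl a<n
  outside n≤K (inj₂ K<a) refl = <⇒≱ K<a n≤K

  outside-suc : ∀ {n a} → a < n ⊎ K < a → a < suc n ⊎ K < a
  outside-suc (inj₁ a<n) = inj₁ (m<n⇒m<1+n a<n)
  outside-suc (inj₂ K<a) = inj₂ K<a

  evalReg : ∀ {c c′ M} n a → a < n → n ≤ K → M a ≤ V → CodeAt P c c′ (const n 0 ∷ add n n a ∷ []) →
    Eval c M 2 c′ n (M a)
  evalReg n a a<n n≤K v≤V code
    with move n a (λ e → <-irrefl (sym e) a<n) (reg≤S n≤K) (reg≤S (≤-trans (<⇒≤ a<n) n≤K)) (≤V⇒<W v≤V) code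
  ... | M′ , r , v , f = eval M′ r v (λ x o → f x (outside n≤K o))

  stepOp : ∀ o {c M n cf} a b d → a ≤ S → b ≤ S → d ≤ S → instrAt P c ≡ opI o a b d →
    opF o (M b) (M d) < W → Reach P S W ⟨ suc c , update M a (opF o (M b) (M d)) ⟩ n cf →
    Reach P S W ⟨ c , M ⟩ (suc n) cf
  stepOp plus a b d ha hb hd e w r = step₁ e (ha ∷ hb ∷ hd ∷ []) (w ∷ []) r
  stepOp minus a b d ha hb hd e w r = step₁ e (ha ∷ hb ∷ hd ∷ []) (w ∷ []) r
  stepOp times a b d ha hb hd e w r = step₁ e (ha ∷ hb ∷ hd ∷ []) (w ∷ []) r
  stepOp over a b d ha hb hd e w r = step₁ e (ha ∷ hb ∷ hd ∷ []) (w ∷ []) r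
  stepOp rem a b d ha hb hd e w r = step₁ e (ha ∷ hb ∷ hd ∷ []) (w ∷ []) r

  toAddress : ∀ {c c′ M i x} n t → n ≢ t → 1 ≤ n → 1 ≤ t → n ≤ K → t ≤ K → i < I → M 0 ≡ N → M n ≡ x → x < N →
    CodeAt P c c′ (const t i ∷ mul t t 0 ∷ add n n t ∷ []) →
    Σ Mem λ M′ → Reach P S W ⟨ c , M ⟩ 3 ⟨ c′ , M′ ⟩ × M′ n ≡ i * N + x ×
      (∀ y → y ≢ n → y ≢ t → M′ y ≡ M y)
  toAddress {c} {c′} {M} {i} {x} n t n≢t 1≤n 1≤t n≤K t≤K i<I M0 Mn x<N (e₁ , e₂ , e₃ , refl) =
    M₃ ,
    step₁ e₁ (reg≤S t≤K ∷ []) (≤V⇒<W (≤-trans (<⇒≤ i<I) (≤-trans (≤-trans (m≤m+n I 49) 64≤N) N≤V)) ∷ [])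
      (step₁ e₂ (reg≤S t≤K ∷ reg≤S t≤K ∷ z≤n ∷ []) (subst (_< W) (sym v₂) (≤V⇒<W iN≤V) ∷ [])
        (step₁ e₃ (reg≤S n≤K ∷ reg≤S n≤K ∷ reg≤S t≤K ∷ [])
          (subst (_< W) (sym v₃) (≤V⇒<W (≤-trans (address-bound i<I x<N) I*N≤V)) ∷ []) stop)) ,
    trans (update-same M₂ n _) v₃ ,
    λ y y≢n y≢t → trans (update-other M₂ n _ y≢n) (trans (update-other M₁ t _ y≢t) (update-other M t i y≢t))
    where
    M₁ = update M t i
    M₂ = update M₁ t (M₁ t * M₁ 0)
    M₃ = update M₂ n (M₂ n + M₂ t)
    0≢t : 0 ≢ t
    0≢t refl = contradiction 1≤t λ ()
    iN≤V : i * N ≤ V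
    iN≤V = ≤-trans (*-monoˡ-≤ N (<⇒≤ i<I)) I*N≤V
    v₂ : M₁ t * M₁ 0 ≡ i * N
    v₂ = cong₂ _*_ (update-same M t i) (trans (update-other M t i 0≢t) M0)
    v₃ : M₂ n + M₂ t ≡ i * N + x
    v₃ = trans (cong₂ _+_ (trans (update-other M₁ t _ n≢t) (trans (update-other M t i n≢t) Mn))
                          (trans (update-same M₁ t _) v₂))
               (+-comm x (i * N))

  compE-sound : ∀ e n {c c′ j vr ar M} → OkE n e → size e ≤ 16 → T₀ ≤ n → Safe e j vr ar → Sim j vr ar M →
    CodeAt P c c′ (compE n e) → Eval c M (length (compE n e)) c′ n (⟦ e ⟧ j vr ar)
  compE-sound pp n {M = M} ok _ T≤n _ s code with evalReg n 1 (≤-trans (s≤s (s≤s z≤n)) T≤n) (T⇒≤ n K ok)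
       (subst (_≤ V) (sym (rp s)) (≤-trans p≤N N≤V)) code
  ... | eval M′ r v f = eval M′ r (trans v (rp s)) f
  compE-sound jj n ok _ T≤n _ s code with evalReg n 2 (≤-trans (s≤s (s≤s (s≤s z≤n))) T≤n) (T⇒≤ n K ok)
       (subst (_≤ V) (sym (rj s)) (bj s)) code
  ... | eval M′ r v f = eval M′ r (trans v (rj s)) f
  compE-sound (lit k) n {M = M} (ok , k≤) _ T≤n _ s (e , refl) =
    eval (update M n k)
      (step₁ e (reg≤S (T⇒≤ n K ok) ∷ [])
        (≤V⇒<W (≤-trans (T⇒≤ k 32 k≤) (≤-trans (≤-trans (m≤m+n 32 32) 64≤N) N≤V)) ∷ []) stop)
      (update-same M n k) (λ a o → update-other M n k (outside (T⇒≤ n K ok) o))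
  compE-sound (var x) n (ok , x<) _ T≤n _ s code
    with evalReg n (3 + x) (≤-trans (s≤s (s≤s (s≤s (T⇒< x U x<)))) T≤n) (T⇒≤ n K ok)
       (subst (_≤ V) (sym (rv s x (T⇒< x U x<))) (bv s x (T⇒< x U x<))) code
  ... | eval M′ r v f = eval M′ r (trans v (rv s x (T⇒< x U x<))) f
  compE-sound (op o a b) n {c} {c′} {j} {vr} {ar} {M} (oa , ob) sz T≤n (sa , sb) s code
    with CodeAt-++ P c c′ (compE n a) code
  ... | k₁ , k₂₃ with CodeAt-++ P _ c′ (compE (suc n) b) k₂₃
  ... | k₂ , e₃ , refl
    with compE-sound a n oa (≤-trans (m≤m+n _ _) sz) T≤n sa s k₁
  ... | eval M₁ r₁ v₁ f₁
    with compE-sound b (suc n) ob (≤-trans (m≤n+m _ (size a)) sz) (m≤n⇒m≤1+n T≤n) sb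
           (Sim-frame (λ { x (inj₁ x<) → f₁ x (inj₁ (≤-trans x< T≤n)) ; x (inj₂ x>) → f₁ x (inj₂ x>) }) s) k₂
  ... | eval M₂ r₂ v₂ f₂ =
    eval (update M₂ n (opF o (M₂ n) (M₂ (suc n))))
      (Reach-mono (≤-reflexive len)
        (Reach-trans r₁ (Reach-trans r₂
          (stepOp o n n (suc n) (reg≤S n≤K) (reg≤S n≤K) (reg≤S (OkE⇒≤K (suc n) b ob)) e₃
            (subst (_< W) (sym val) (W-bound (≤-trans (⟦⟧-bound (op o a b) {n} (oa , ob) (sa , sb) s) (V^-mono sz)))) stop))))
      (trans (update-same M₂ n _) val)
      (λ x ou → trans (update-other M₂ n _ (outside n≤K ou)) (trans (f₂ x (outside-suc ou)) (f₁ x ou)))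
    where
    n≤K = OkE⇒≤K n a oa
    val : opF o (M₂ n) (M₂ (suc n)) ≡ opF o (⟦ a ⟧ j vr ar) (⟦ b ⟧ j vr ar)
    val = cong₂ (opF o) (trans (f₂ n (inj₁ ≤-refl)) v₁) v₂
    len : length (compE n a) + (length (compE (suc n) b) + 1) ≡ length (compE n (op o a b))
    len = sym (trans (length-++ (compE n a)) (cong (length (compE n a) +_) (length-++ (compE (suc n) b))))
  compE-sound (rd i e) n {c} {c′} {j} {vr} {ar} {M} (oe , n<K , i<) sz T≤n (se , x<N , l) s code
    with CodeAt-++ P c c′ (compE n e) code
  ... | k₁ , e₁ , e₂ , e₃ , e₄ , refl with compE-sound e n oe sz T≤n se s k₁
  ... | eval M₁ r₁ v₁ f₁
    with toAddress n (suc n) (λ ()) (≤-trans (s≤s z≤n) T≤n) (s≤s z≤n) (OkE⇒≤K n e oe) (T⇒≤ (suc n) K n<K)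
           (T⇒< i I i<) (trans (f₁ 0 (inj₁ (≤-trans (s≤s z≤n) T≤n))) (rN s)) v₁ x<N (e₁ , e₂ , e₃ , refl)
  ... | M₂ , r₂ , v₂ , f₂ =
    eval (update M₂ n (M₂ (M₂ n)))
      (Reach-mono (≤-reflexive (sym (length-++ (compE n e))))
        (Reach-trans r₁ (Reach-trans r₂
          (step₁ e₄ (reg≤S n≤K ∷ reg≤S n≤K ∷ subst (_≤ S) (sym v₂) (≤-trans (address-bound (T⇒< i I i<) x<N) S-bound) ∷ [])
             (subst (_< W) (sym val) (≤V⇒<W (ba s i _ (T⇒< i I i<) x<N l)) ∷ []) stop))))
      (trans (update-same M₂ n _) val)
      (λ x ou → trans (update-other M₂ n _ (outside n≤K ou))
         (trans (f₂ x (outside n≤K ou) (outside (T⇒≤ (suc n) K n<K) (outside-suc ou))) (f₁ x ou)))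
    where
    n≤K = OkE⇒≤K n e oe
    big : K < i * N + ⟦ e ⟧ j vr ar
    big = Low⇒K< i l
    val : M₂ (M₂ n) ≡ ar i (⟦ e ⟧ j vr ar)
    val = trans (cong M₂ v₂)
      (trans (f₂ _ (outside n≤K (inj₂ big)) (outside (T⇒≤ (suc n) K n<K) (inj₂ big)))
        (trans (f₁ _ (inj₂ big)) (ra s i _ (T⇒< i I i<) x<N l)))

-- Correctness of compiled bodies, and Hoare rules for commands

module Blocks
  (p N : ℕ) (2≤p : 2 ≤ p) (N≡32p : N ≡ 32 * p) (P : Program) (S W : ℕ)
  (S-bound : I * N ≤ S) (W-bound : ∀ {n} → n ≤ (N * N) ^ 16 → n < W) where

  open Semantics p N
  open Soundness p N 2≤p N≡32p P S W S-bound W-bound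

  setVar-Sim : ∀ {j vr ar M M′} x v → x < U → v ≤ V → M′ (3 + x) ≡ v →
    (∀ a → a ≢ 3 + x → M′ a ≡ M a) → Sim j vr ar M → Sim j (update vr x v) ar M′
  setVar-Sim {j} {vr} {ar} {M} {M′} x v x<U v≤V Mx f s = record
    { rN = trans (f 0 λ ()) (rN s)
    ; rp = trans (f 1 λ ()) (rp s)
    ; rj = trans (f 2 λ ()) (rj s)
    ; rv = values
    ; ra = λ i y i<I y<N l → trans (f (i * N + y) (λ e → <⇒≱ (Low⇒K< i l) (≤-trans (≤-reflexive e) 3+x≤K))) (ra s i y i<I y<N l)
    ; bj = bj s
    ; bv = bounds
    ; ba = ba s }
    where
    3+x≤K : 3 + x ≤ K
    3+x≤K = ≤-trans (s≤s (s≤s (s≤s (<⇒≤ x<U)))) (m≤m+n 15 9)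
    values : ∀ y → y < U → M′ (3 + y) ≡ update vr x v y
    values y y<U with y ≟ x
    ... | yes refl = trans Mx (sym (update-same vr x v))
    ... | no y≢x = trans (f (3 + y) (λ e → y≢x (+-cancelˡ-≡ 3 y x e))) (trans (rv s y y<U) (sym (update-other vr x v y≢x)))
    bounds : ∀ y → y < U → update vr x v y ≤ V
    bounds y y<U with y ≟ x
    ... | yes refl = subst (_≤ V) (sym (update-same vr x v)) v≤V
    ... | no y≢x = subst (_≤ V) (sym (update-other vr x v y≢x)) (bv s y y<U)

  setArr-same : ∀ (ar : Arrs) i x v → setArr ar i x v i x ≡ v
  setArr-same ar i x v rewrite ≡ᵇ-refl i = update-same (ar i) x v

  setArr-other : ∀ (ar : Arrs) i x v {i′ x′} → i′ ≢ i ⊎ x′ ≢ x → setArr ar i x v i′ x′ ≡ ar i′ x′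
  setArr-other ar i x v {i′} {x′} o with i′ ≟ i
  setArr-other ar i x v {i′} o | no i′≢i rewrite ≢⇒≡ᵇ-false i′ i i′≢i = refl
  setArr-other ar i x v (inj₁ i≢i) | yes refl = contradiction refl i≢i
  setArr-other ar i x v (inj₂ x′≢x) | yes refl rewrite ≡ᵇ-refl i = update-other (ar i) x v x′≢x

  setArr-Sim : ∀ {j vr ar M} i x v → i < I → x < N → Low i x → v ≤ V → Sim j vr ar M →
    Sim j vr (setArr ar i x v) (update M (i * N + x) v)
  setArr-Sim {j} {vr} {ar} {M} i x v i<I x<N l v≤V s = record
    { rN = trans (low 0 z≤n) (rN s)
    ; rp = trans (low 1 (s≤s z≤n)) (rp s)
    ; rj = trans (low 2 (s≤s (s≤s z≤n))) (rj s)
    ; rv = λ y y<U → trans (low (3 + y) (≤-trans (s≤s (s≤s (s≤s (<⇒≤ y<U)))) (m≤m+n 15 9))) (rv s y y<U)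
    ; ra = cells
    ; bj = bj s
    ; bv = bv s
    ; ba = bounds }
    where
    low : ∀ a → a ≤ K → update M (i * N + x) v a ≡ M a
    low a a≤K = update-other M _ v (λ e → <⇒≱ (Low⇒K< i l) (subst (_≤ K) e a≤K))
    different : ∀ i′ x′ → (i′ ≡ i × x′ ≡ x) ⊎ (i′ ≢ i ⊎ x′ ≢ x)
    different i′ x′ with i′ ≟ i | x′ ≟ x
    ... | yes a | yes b = inj₁ (a , b)
    ... | no a | _ = inj₂ (inj₁ a)
    ... | yes _ | no b = inj₂ (inj₂ b)
    cells : ∀ i′ x′ → i′ < I → x′ < N → Low i′ x′ → update M (i * N + x) v (i′ * N + x′) ≡ setArr ar i x v i′ x′
    cells i′ x′ i′<I x′<N l′ with different i′ x′
    ... | inj₁ (refl , refl) = trans (update-same M _ v) (sym (setArr-same ar i x v))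
    ... | inj₂ d = trans (update-other M _ v (apart d)) (trans (ra s i′ x′ i′<I x′<N l′) (sym (setArr-other ar i x v d)))
      where
      apart : i′ ≢ i ⊎ x′ ≢ x → i′ * N + x′ ≢ i * N + x
      apart (inj₁ n) e = n (proj₁ (address-injective i′ i x′<N x<N e))
      apart (inj₂ n) e = n (proj₂ (address-injective i′ i x′<N x<N e))
    bounds : ∀ i′ x′ → i′ < I → x′ < N → Low i′ x′ → setArr ar i x v i′ x′ ≤ V
    bounds i′ x′ i′<I x′<N l′ with different i′ x′
    ... | inj₁ (refl , refl) = subst (_≤ V) (sym (setArr-same ar i x v)) v≤V
    ... | inj₂ d = subst (_≤ V) (sym (setArr-other ar i x v d)) (ba s i′ x′ i′<I x′<N l′)

  record Outcome (Φ : Asrt) (j c : ℕ) (M : Mem) (k c′ : ℕ) : Set where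
    constructor outcome
    field
      {vr′} : Vars
      {ar′} : Arrs
      {final} : Mem
      path : Reach P S W ⟨ c , M ⟩ k ⟨ c′ , final ⟩
      sim  : Sim j vr′ ar′ final
      post : Φ vr′ ar′

  weaken : ∀ {Φ j c M k k′ c′} → k ≤ k′ → Outcome Φ j c M k c′ → Outcome Φ j c M k′ c′
  weaken k≤k′ (outcome r s φ) = outcome (Reach-mono k≤k′ r) s φ

  before : ∀ {Φ j c M k k′ c₁ M₁ c′} → Reach P S W ⟨ c , M ⟩ k ⟨ c₁ , M₁ ⟩ →
    Outcome Φ j c₁ M₁ k′ c′ → Outcome Φ j c M (k + k′) c′
  before r (outcome r′ s φ) = outcome (Reach-trans r r′) s φ

  compE₂-sound : ∀ a e {c c′ j vr ar M} → Ok T₀ a → Ok (suc T₀) e → Safe a j vr ar → Safe e j vr ar →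
    Sim j vr ar M → CodeAt P c c′ (compE T₀ a ++ compE (suc T₀) e) →
    Σ Mem λ M′ → Reach P S W ⟨ c , M ⟩ (length (compE T₀ a ++ compE (suc T₀) e)) ⟨ c′ , M′ ⟩ ×
      M′ T₀ ≡ ⟦ a ⟧ j vr ar × M′ (suc T₀) ≡ ⟦ e ⟧ j vr ar × Sim j vr ar M′
  compE₂-sound a e {c} {c′} (oa , za) (oe , ze) sa se s code with CodeAt-++ P c c′ (compE T₀ a) code
  ... | k₁ , k₂ with compE-sound a T₀ oa (T⇒≤ _ _ za) ≤-refl sa s k₁
  ... | eval M₁ r₁ v₁ f₁ with compE-sound e (suc T₀) oe (T⇒≤ _ _ ze) (n≤1+n T₀) se (Sim-frame f₁ s) k₂
  ... | eval M₂ r₂ v₂ f₂ =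
    M₂ , Reach-mono (≤-reflexive (sym (length-++ (compE T₀ a)))) (Reach-trans r₁ r₂) ,
    trans (f₂ T₀ (inj₁ ≤-refl)) v₁ , v₂ , Sim-frame (λ x o → f₂ x (outside-suc o)) (Sim-frame f₁ s)

  ¬reg : ∀ {a} k → T₀ ≤ k → k ≤ K → a < T₀ ⊎ K < a → a ≢ k
  ¬reg k T≤k k≤K (inj₁ a<) refl = <⇒≱ a< T≤k
  ¬reg k T≤k k≤K (inj₂ a>) refl = <⇒≱ a> k≤K

  compB-sound : ∀ b {Φ c c′ j vr ar M} → OkB b → wp b Φ j vr ar → Sim j vr ar M →
    CodeAt P c c′ (compB c b) → Outcome Φ j c M (length (compB c b)) c′
  compB-sound skip ok φ s refl = outcome stop s φ
  compB-sound (x ≔ e) {c = c} {c′} ((ok , sz) , x<) (se , v≤V , φ) s code with CodeAt-++ P c c′ (compE T₀ e) code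
  ... | k₁ , k₂ with compE-sound e T₀ ok (T⇒≤ _ _ sz) ≤-refl se s k₁
  ... | eval M₁ r₁ v₁ f₁
    with move (3 + x) T₀ (λ e → <-irrefl e x<T) (reg≤S (≤-trans (<⇒≤ x<T) (m≤m+n 15 9))) (reg≤S (m≤m+n 15 9))
           (subst (_< W) (sym v₁) (≤V⇒<W v≤V)) k₂
    where
    x<T : 3 + x < T₀
    x<T = s≤s (s≤s (s≤s (T⇒< x U x<)))
  ... | M₂ , r₂ , v₂ , f₂ =
    outcome (Reach-mono (≤-reflexive (sym (length-++ (compE T₀ e)))) (Reach-trans r₁ r₂))
      (setVar-Sim x _ (T⇒< x U x<) v≤V (trans v₂ v₁) f₂ (Sim-frame f₁ s)) φ
  compB-sound (i [ a ]≔ e) {c = c} {c′} (oa , oe , i<) ((sa , x<N , l) , se , v≤V , φ) s code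
    with CodeAt-++ P c c′ (compE T₀ a ++ compE (suc T₀) e) code
  ... | k₁ , e₁ , e₂ , e₃ , e₄ , refl with compE₂-sound a e oa oe sa se s k₁
  ... | M₁ , r₁ , v₁ , w₁ , s₁
    with toAddress T₀ (2 + T₀) (λ ()) (s≤s z≤n) (s≤s z≤n) (m≤m+n 15 9) (m≤m+n 17 7) (T⇒< i I i<) (rN s₁) v₁ x<N
           (e₁ , e₂ , e₃ , refl)
  ... | M₂ , r₂ , v₂ , f₂ =
    outcome {final = update M₂ (M₂ T₀) (M₂ (suc T₀))}
      (Reach-mono (≤-reflexive (sym (length-++ (compE T₀ a ++ compE (suc T₀) e))))
        (Reach-trans r₁ (Reach-trans r₂
          (step₁ e₄ (reg≤S (m≤m+n 15 9) ∷ subst (_≤ S) (sym v₂) (≤-trans (address-bound (T⇒< i I i<) x<N) S-bound) ∷ reg≤S (m≤m+n 16 8) ∷ [])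
            (subst (_< W) (sym w₂) (≤V⇒<W v≤V) ∷ []) stop))))
      (subst₂ (λ y v → Sim _ _ _ (update M₂ y v)) (sym v₂) (sym w₂)
        (setArr-Sim i _ _ (T⇒< i I i<) x<N l v≤V
          (Sim-frame (λ y o → f₂ y (¬reg T₀ ≤-refl (m≤m+n 15 9) o) (¬reg (2 + T₀) (m≤n+m 15 2) (m≤m+n 17 7) o)) s₁))) φ
    where
    w₂ = trans (f₂ (suc T₀) (λ ()) (λ ())) w₁
  compB-sound (b₁ ⨾ b₂) {c = c} {c′} (o₁ , o₂) φ s code with CodeAt-++ P c c′ (compB c b₁) code
  ... | k₁ , k₂ with compB-sound b₁ o₁ φ s k₁
  ... | outcome r₁ s₁ φ₁ =
    weaken (≤-reflexive (sym (length-++ (compB c b₁)))) (before r₁ (compB-sound b₂ o₂ φ₁ s₁ k₂))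
  compB-sound (when e₁ ≺ e₂ then b₁ else b₂) {Φ} {c = c} {c′} {j} {vr} {ar} (oe₁ , oe₂ , o₁ , o₂) ((s₁ , s₂) , φ₁ , φ₂) s code
    with CodeAt-++ P c c′ (compE T₀ e₁ ++ compE (suc T₀) e₂) code
  ... | k₁ , q₁ , q₂ , k₂ with CodeAt-++ P _ c′ (compB (2 + (c + length (compE T₀ e₁ ++ compE (suc T₀) e₂))) b₁) k₂
  ... | k₃ , q₃ , k₄ with compE₂-sound e₁ e₂ oe₁ oe₂ s₁ s₂ s k₁
  ... | M₁ , r₁ , v₁ , w₁ , sim₁ = branch (ltℕ-case (⟦ e₁ ⟧ j vr ar) (⟦ e₂ ⟧ j vr ar))
    where
    test = compE T₀ e₁ ++ compE (suc T₀) e₂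
    c₁   = 2 + (c + length test)
    yes₁ = compB c₁ b₁
    c₂   = suc (c₁ + length yes₁)
    no₁  = compB c₂ b₂
    flag = ltℕ (M₁ T₀) (M₁ (suc T₀))
    M₂ = update M₁ T₀ flag
    flag≡ : flag ≡ ltℕ (⟦ e₁ ⟧ j vr ar) (⟦ e₂ ⟧ j vr ar)
    flag≡ = cong₂ ltℕ v₁ w₁
    sim₂ : Sim j vr ar M₂
    sim₂ = Sim-frame (λ y o → update-other M₁ T₀ flag (¬reg T₀ ≤-refl (m≤m+n 15 9) o)) sim₁
    total : length (compB c (when e₁ ≺ e₂ then b₁ else b₂)) ≡ length test + (2 + (length yes₁ + (1 + length no₁)))
    total = trans (length-++ test) (cong (λ z → length test + (2 + z)) (length-++ yes₁))
    flag<W : ∀ {f} → flag ≡ f → f ≤ 1 → flag < W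
    flag<W refl f≤1 = ≤V⇒<W (≤-trans f≤1 (≤-trans (n≤1+n 1) 2≤V))
    jump : ∀ f → flag ≡ f → exec (jz T₀ c₂) ⟨ suc (c + length test) , M₂ ⟩ ≡ (if f ≡ᵇ 0 then ⟨ c₂ , M₂ ⟩ else ⟨ c₁ , M₂ ⟩)
    jump f eq = cong (λ z → if z ≡ᵇ 0 then ⟨ c₂ , M₂ ⟩ else ⟨ c₁ , M₂ ⟩) eq
    test-path : ∀ f {k cf} → flag ≡ f → f ≤ 1 → Reach P S W (if f ≡ᵇ 0 then ⟨ c₂ , M₂ ⟩ else ⟨ c₁ , M₂ ⟩) k cf →
      Reach P S W ⟨ c + length test , M₁ ⟩ (2 + k) cf
    test-path f eq f≤1 r =
      step₁ q₁ (reg≤S (m≤m+n 15 9) ∷ reg≤S (m≤m+n 15 9) ∷ reg≤S (m≤m+n 16 8) ∷ []) (flag<W eq f≤1 ∷ [])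
        (step₁ q₂ (reg≤S (m≤m+n 15 9) ∷ []) [] (subst (λ z → Reach P S W z _ _) (sym (jump f eq)) r))
    branch : (⟦ e₁ ⟧ j vr ar < ⟦ e₂ ⟧ j vr ar × ltℕ (⟦ e₁ ⟧ j vr ar) (⟦ e₂ ⟧ j vr ar) ≡ 1) ⊎
             (⟦ e₂ ⟧ j vr ar ≤ ⟦ e₁ ⟧ j vr ar × ltℕ (⟦ e₁ ⟧ j vr ar) (⟦ e₂ ⟧ j vr ar) ≡ 0) →
      Outcome Φ j c _ (length (compB c (when e₁ ≺ e₂ then b₁ else b₂))) c′
    branch (inj₁ (x<y , eq)) with compB-sound b₁ o₁ (φ₁ x<y) sim₂ k₃
    ... | outcome r₂ s₂′ φ = outcome
      (Reach-mono (≤-trans (+-monoʳ-≤ (length test) (s≤s (s≤s (+-monoʳ-≤ (length yes₁) (s≤s z≤n))))) (≤-reflexive (sym total)))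
        (Reach-trans r₁ (test-path 1 (trans flag≡ eq) ≤-refl
          (Reach-trans r₂ (step₁ {n = 0} q₃ [] [] (subst (λ z → Reach P S W ⟨ c₂ + length no₁ , _ ⟩ 0 ⟨ z , _ ⟩) (sym (CodeAt-end P c₂ c′ no₁ k₄)) stop))))))
      s₂′ φ
    branch (inj₂ (y≤x , eq)) with compB-sound b₂ o₂ (φ₂ y≤x) sim₂ k₄
    ... | outcome r₂ s₂′ φ = outcome
      (Reach-mono (≤-trans (+-monoʳ-≤ (length test) (s≤s (s≤s (≤-trans (n≤1+n _) (m≤n+m _ (length yes₁)))))) (≤-reflexive (sym total)))
        (Reach-trans r₁ (test-path 0 (trans flag≡ eq) z≤n r₂)))
      s₂′ φ

  -- The counter register is unconstrained between loops.
  record Triple (Φ : Asrt) (k : Cmd) (Ψ : Asrt) : Set where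
    constructor triple
    field
      valid : OkC k → ∀ {c c′ j vr ar M} → Φ vr ar → Sim j vr ar M → CodeAt P c c′ (compC c k) →
        Σ ℕ λ j′ → Σ Vars λ vr′ → Σ Arrs λ ar′ → Σ Mem λ M′ →
          Reach P S W ⟨ c , M ⟩ (cost c k * p) ⟨ c′ , M′ ⟩ × Sim j′ vr′ ar′ M′ × Ψ vr′ ar′
  open Triple public

  conseq-rule : ∀ {Φ Φ′ Ψ Ψ′} {k} → (∀ {vr ar} → Φ′ vr ar → Φ vr ar) → (∀ {vr ar} → Ψ vr ar → Ψ′ vr ar) →
    Triple Φ k Ψ → Triple Φ′ k Ψ′
  valid (conseq-rule pre post t) ok φ s code with valid t ok (pre φ) s code
  ... | j , vr , ar , M , r , s′ , ψ = j , vr , ar , M , r , s′ , post ψ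

  -- Ghost values: a quantity fixed only when one command ends, such as the interval length after a
  -- pass, can parametrise the invariants of the commands that follow.
  exists-rule : ∀ {G : Set} {Φ : G → Asrt} {Ψ k} → (∀ g → Triple (Φ g) k Ψ) →
    Triple (λ vr ar → Σ G λ g → Φ g vr ar) k Ψ
  valid (exists-rule t) ok (g , φ) s code = valid (t g) ok φ s code

  blk-rule : ∀ {Φ Ψ} b → (∀ j vr ar → Φ vr ar → wp b Ψ j vr ar) → Triple Φ (blk b) Ψ
  valid (blk-rule b h) ok {c} {j = j} φ s code with compB-sound b ok (h j _ _ φ) s code
  ... | outcome r s′ ψ =
    j , _ , _ , _ , Reach-mono (≤-trans (≤-reflexive (sym (*-identityʳ _))) (*-monoʳ-≤ (length (compB c b)) (≤-trans (n≤1+n 1) 2≤p))) r , s′ , ψ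

  seq-rule : ∀ {Φ Ψ Χ} k₁ k₂ → Triple Φ k₁ Ψ → Triple Ψ k₂ Χ → Triple Φ (k₁ ▸ k₂) Χ
  valid (seq-rule k₁ k₂ t₁ t₂) (o₁ , o₂) {c} {c′} φ s code with CodeAt-++ P c c′ (compC c k₁) code
  ... | q₁ , q₂ with valid t₁ o₁ φ s q₁
  ... | j₁ , vr₁ , ar₁ , M₁ , r₁ , s₁ , ψ with valid t₂ o₂ ψ s₁ q₂
  ... | j₂ , vr₂ , ar₂ , M₂ , r₂ , s₂ , χ =
    j₂ , vr₂ , ar₂ , M₂ ,
    Reach-mono (≤-reflexive (sym (*-distribʳ-+ p (cost c k₁) _))) (Reach-trans r₁ r₂) , s₂ , χ

  setCounter-Sim : ∀ {j vr ar M M′} j′ → j′ ≤ V → M′ 2 ≡ j′ → (∀ a → a < T₀ ⊎ K < a → a ≢ 2 → M′ a ≡ M a) →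
    Sim j vr ar M → Sim j′ vr ar M′
  setCounter-Sim j′ j′≤V eq f s = record
    { rN = trans (f 0 (inj₁ (s≤s z≤n)) λ ()) (rN s)
    ; rp = trans (f 1 (inj₁ (s≤s (s≤s z≤n))) λ ()) (rp s)
    ; rj = eq
    ; rv = λ x x<U → trans (f (3 + x) (inj₁ (s≤s (s≤s (s≤s x<U)))) λ ()) (rv s x x<U)
    ; ra = λ i x i<I x<N l → trans (f (i * N + x) (inj₂ (Low⇒K< i l)) (λ e → <⇒≱ (Low⇒K< i l) (≤-trans (≤-reflexive e) (m≤m+n 2 22)))) (ra s i x i<I x<N l)
    ; bj = j′≤V ; bv = bv s ; ba = ba s }

  loop-rule : ∀ (Inv : ℕ → Asrt) b →
    (∀ k vr ar → 1 ≤ k → k < p → Inv k vr ar → wp b (Inv (suc k)) k vr ar) →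
    Triple (Inv 1) (loop b) (Inv p)
  valid (loop-rule Inv b h) ok {c} {c′} {M = M} φ s (q₁ , q₂ , q₃ , code) with CodeAt-++ P (3 + c) c′ (compB (3 + c) b) code
  ... | k , q₄ , q₅ , q₆ , refl =
    finish (iterate (p ∸ 1) 1 ≤-refl (trans (+-comm (p ∸ 1) 1) (m+[n∸m]≡n {1} (≤-trans (n≤1+n 1) 2≤p)))
      (setCounter-Sim {M′ = update M 2 1} 1 (≤-trans (n≤1+n 1) 2≤V) refl (λ a _ a≢2 → update-other M 2 1 a≢2) s) φ)
    where
    body = compB (3 + c) b
    L = length body
    E = 6 + (c + L)
    Exits : ℕ → Mem → Set
    Exits n M = Σ ℕ λ j′ → Σ Vars λ vr′ → Σ Arrs λ ar′ → Σ Mem λ M′ →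
      Reach P S W ⟨ suc c , M ⟩ n ⟨ E , M′ ⟩ × Sim j′ vr′ ar′ M′ × Inv p vr′ ar′
    test-path : ∀ {j vr ar M k cf} f → Sim j vr ar M → ltℕ j p ≡ f → f ≤ 1 →
      (Sim j vr ar (update M T₀ f) →
       Reach P S W (if f ≡ᵇ 0 then ⟨ E , update M T₀ f ⟩ else ⟨ 3 + c , update M T₀ f ⟩) k cf) →
      Reach P S W ⟨ suc c , M ⟩ (2 + k) cf
    test-path {M = M} f s refl f≤1 r =
      step₁ q₂ (reg≤S (m≤m+n 15 9) ∷ reg≤S (m≤m+n 2 22) ∷ reg≤S (m≤m+n 1 23) ∷ [])
        (subst (_< W) (sym v) (≤V⇒<W (≤-trans f≤1 (≤-trans (n≤1+n 1) 2≤V))) ∷ [])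
        (subst (λ z → Reach P S W ⟨ 2 + c , update M T₀ z ⟩ _ _) (sym v)
          (step₁ q₃ (reg≤S (m≤m+n 15 9) ∷ []) []
            (r (Sim-frame (λ y o → update-other M T₀ _ (¬reg T₀ ≤-refl (m≤m+n 15 9) o)) s))))
      where
      v : ltℕ (M 2) (M 1) ≡ _
      v = cong₂ ltℕ (rj s) (rp s)
    iterate : ∀ n k₀ {vr ar M} → 1 ≤ k₀ → n + k₀ ≡ p → Sim k₀ vr ar M → Inv k₀ vr ar → Exits (n * (5 + L) + 2) M
    iterate zero k₀ {vr} {ar} {M} 1≤k₀ refl s φ with ltℕ-case k₀ k₀
    ... | inj₁ (k<k , _) = contradiction k<k (<-irrefl refl)
    ... | inj₂ (_ , eq) = k₀ , vr , ar , update M T₀ 0 , test-path 0 s eq z≤n (λ _ → stop) ,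
      Sim-frame (λ y o → update-other M T₀ 0 (¬reg T₀ ≤-refl (m≤m+n 15 9) o)) s , φ
    iterate (suc n) k₀ {vr} {ar} {M} 1≤k₀ eqp s φ with ltℕ-case k₀ p
    ... | inj₂ (p≤k , _) = contradiction (subst (k₀ <_) eqp (s≤s (m≤n+m k₀ n))) (≤⇒≯ p≤k)
    ... | inj₁ (k<p , eq)
      with compB-sound b ok (h k₀ vr ar 1≤k₀ k<p φ)
             (Sim-frame {M′ = update M T₀ 1} (λ y o → update-other M T₀ 1 (¬reg T₀ ≤-refl (m≤m+n 15 9) o)) s) k
    ... | outcome {vr′} {ar′} {M₁} r₁ s₁ φ₁
      with iterate n (suc k₀) (s≤s z≤n) (trans (+-suc n k₀) eqp)
             (setCounter-Sim {M′ = M₃} (suc k₀) (≤-trans k<p (≤-trans p≤N N≤V)) inc other s₁) φ₁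
      where
      M₂ = update M₁ T₀ 1
      M₃ = update M₂ 2 (M₂ 2 + M₂ T₀)
      inc : M₁ 2 + 1 ≡ suc k₀
      inc = trans (+-comm (M₁ 2) 1) (cong suc (rj s₁))
      other : ∀ a → a < T₀ ⊎ K < a → a ≢ 2 → M₃ a ≡ M₁ a
      other a o a≢2 = trans (update-other M₂ 2 _ a≢2) (update-other M₁ T₀ 1 (¬reg T₀ ≤-refl (m≤m+n 15 9) o))
    ... | j′ , vr″ , ar″ , M′ , r′ , s′ , ψ =
      j′ , vr″ , ar″ , M′ ,
      Reach-mono (≤-reflexive arith)
        (test-path 1 s eq ≤-refl (λ _ → Reach-trans r₁
          (step₁ q₄ (reg≤S (m≤m+n 15 9) ∷ []) (≤V⇒<W (≤-trans (n≤1+n 1) 2≤V) ∷ [])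
            (step₁ q₅ (reg≤S (m≤m+n 2 22) ∷ reg≤S (m≤m+n 2 22) ∷ reg≤S (m≤m+n 15 9) ∷ [])
               (subst (_< W) (sym inc) (≤V⇒<W (≤-trans k<p (≤-trans p≤N N≤V))) ∷ [])
               (step₁ q₆ [] [] r′))))) , s′ , ψ
      where
      inc : M₁ 2 + 1 ≡ suc k₀
      inc = trans (+-comm (M₁ 2) 1) (cong suc (rj s₁))
      X = n * (5 + L) + 2
      arith : 2 + (L + (3 + X)) ≡ suc n * (5 + L) + 2
      arith = trans (cong (2 +_) (trans (sym (+-assoc L 3 X)) (cong (_+ X) (+-comm L 3))))
                (sym (+-assoc (5 + L) (n * (5 + L)) 2))
    finish : Exits ((p ∸ 1) * (5 + L) + 2) (update M 2 1) → Σ ℕ λ j′ → Σ Vars λ vr′ → Σ Arrs λ ar′ → Σ Mem λ M′ →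
      Reach P S W ⟨ c , M ⟩ ((6 + L) * p) ⟨ _ , M′ ⟩ × Sim j′ vr′ ar′ M′ × Inv p vr′ ar′
    finish (j′ , vr′ , ar′ , M′ , r , s′ , ψ) =
      j′ , vr′ , ar′ , M′ ,
      Reach-mono time (step₁ q₁ (reg≤S (m≤m+n 2 22) ∷ []) (≤V⇒<W (≤-trans (n≤1+n 1) 2≤V) ∷ []) r) , s′ , ψ
      where
      -- A round costs 2 for the test, L for the body and 3 for the increment and the jump back.
      -- Initialisation and the last, failing test add three steps, which the surplus p + (5 + L) on
      -- the right absorbs.
      time : suc ((p ∸ 1) * (5 + L) + 2) ≤ (6 + L) * p
      time = ≤-trans (≤-reflexive (cong suc (+-comm ((p ∸ 1) * (5 + L)) 2)))
        (≤-trans (+-mono-≤ {3} {p + (5 + L)} (≤-trans (m≤m+n 3 (2 + L)) (m≤n+m (5 + L) p)) (≤-reflexive (*-comm (p ∸ 1) (5 + L))))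
          (≤-reflexive (trans (+-assoc p (5 + L) _)
            (cong (p +_) (trans (sym (*-suc (5 + L) (p ∸ 1))) (cong ((5 + L) *_) (m+[n∸m]≡n {1} (≤-trans (n≤1+n 1) 2≤p))))))))

-- Moving the input away from the registers and the output into place

sumTo : (ℕ → ℕ) → ℕ → ℕ
sumTo f zero = 0
sumTo f (suc k) = f (suc k) + sumTo f k

chosen : (ℕ → ℕ) → (ℕ → ℕ) → ℕ → ℕ
chosen d out j = if out j ≡ᵇ 0 then 0 else d j

save : ℕ → ℕ → List Instr
save k zero = []
save k (suc n) = add 0 0 1 ∷ store 0 (2 + k) ∷ save (suc k) n

restore : ℕ → List Instr
restore zero = []
restore (suc n) = load (2 + n) 0 ∷ sub 0 0 1 ∷ restore n

-- With no second free cell, cell 0 can only be combined with itself, so N has to be p times a power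
-- of two. The factor 32 makes N exceed `K` already for p = 2.
doubling : ℕ → List Instr
doubling zero = []
doubling (suc n) = add 0 0 0 ∷ doubling n

-- All low cells initially hold input, so the only free pointer is cell 0 itself: it is
-- doubled to N = 32p and the cells 1 … K are moved to N … N + K − 1.
relocate : ℕ → ℕ → List Instr
relocate m n =
  doubling m ++ store 0 1 ∷ const 1 1 ∷ save 0 n ++ const 2 n ∷ sub 0 0 2 ∷ const 2 32 ∷ div 1 0 2 ∷ []

-- For small p some output cells p + j lie among the registers, so their contents are kept in array
-- 14 and copied down only now. Cells 0 and 1 can serve as pointer and decrement, because outputs
-- start at p + 1, which is at least 3.
deliver : ℕ → List Instr
deliver n = const 1 14 ∷ mul 0 0 1 ∷ const 1 (suc n) ∷ add 0 0 1 ∷ const 1 1 ∷ restore n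

prologue epilogue : List Instr
prologue = relocate 5 (K ∸ 1)
epilogue = deliver (K ∸ 1)

program : Cmd → Program
program k = prologue ++ compC (length prologue) k ++ epilogue

module Frame
  (p N : ℕ) (2≤p : 2 ≤ p) (N≡32p : N ≡ 32 * p) (P : Program) (S W : ℕ)
  (S-bound : I * N ≤ S) (W-bound : ∀ {n} → n ≤ (N * N) ^ 16 → n < W) where

  open Semantics p N
  open Soundness p N 2≤p N≡32p P S W S-bound W-bound

  2^*-suc : ∀ n q → 2 ^ n * (q + q) ≡ 2 ^ suc n * q
  2^*-suc n q = trans (cong (2 ^ n *_) (cong (q +_) (sym (+-identityʳ q))))
    (trans (sym (*-assoc (2 ^ n) 2 q)) (cong (_* q) (*-comm (2 ^ n) 2)))

  doubling-sound : ∀ n {c c′ M q} → M 0 ≡ q → 2 ^ n * q ≤ V → CodeAt P c c′ (doubling n) →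
    Σ Mem λ M′ → Reach P S W ⟨ c , M ⟩ (length (doubling n)) ⟨ c′ , M′ ⟩ × M′ 0 ≡ 2 ^ n * q × (∀ a → a ≢ 0 → M′ a ≡ M a)
  doubling-sound zero {M = M} {q} M0 _ refl = M , stop , trans M0 (sym (+-identityʳ q)) , λ a _ → refl
  doubling-sound (suc n) {M = M} {q} M0 b (e , code)
    with doubling-sound n {M = update M 0 (M 0 + M 0)} {q = q + q} (cong₂ _+_ M0 M0)
           (subst (_≤ V) (sym (2^*-suc n q)) b) code
  ... | M′ , r , v , f =
    M′ , step₁ e (z≤n ∷ z≤n ∷ z≤n ∷ []) (≤V⇒<W (≤-trans two b) ∷ []) r , trans v (2^*-suc n q) ,
    λ a a≢0 → trans (f a a≢0) (update-other M 0 _ a≢0)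
    where
    two : M 0 + M 0 ≤ 2 ^ suc n * q
    two = subst₂ _≤_ (trans (*-identityˡ _) (cong₂ _+_ (sym M0) (sym M0))) (2^*-suc n q)
      (*-monoˡ-≤ (q + q) (m^n>0 2 n))

  scaling-sound : ∀ n t {c c′ M q} → 2 ^ n ≡ t → M 0 ≡ q → t * q ≤ V → CodeAt P c c′ (doubling n) →
    Σ Mem λ M′ → Reach P S W ⟨ c , M ⟩ (length (doubling n)) ⟨ c′ , M′ ⟩ × M′ 0 ≡ t * q × (∀ a → a ≢ 0 → M′ a ≡ M a)
  scaling-sound n _ refl = doubling-sound n

  record Saved (M₀ : Mem) (k : ℕ) (M : Mem) : Set where
    field
      ptr  : M 0 ≡ N + k
      one  : M 1 ≡ 1
      moved : ∀ i → i ≤ k → M (N + i) ≡ M₀ (suc i)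
      rest : ∀ a → 2 ≤ a → a < N ⊎ N + k < a → M a ≡ M₀ a
  open Saved

  save-sound : ∀ n k {c c′ M₀ M} → n + k < K → (∀ a → M₀ a ≤ V) → Saved M₀ k M → CodeAt P c c′ (save k n) →
    Σ Mem λ M′ → Reach P S W ⟨ c , M ⟩ (length (save k n)) ⟨ c′ , M′ ⟩ × Saved M₀ (n + k) M′
  save-sound zero k {M = M} _ _ s refl = M , stop , s
  save-sound (suc n) k {c} {c′} {M₀} {M} bound bd s (e₁ , e₂ , code)
    with save-sound n (suc k) {M = M₂} (subst (_< K) (sym (+-suc n k)) bound) bd s′ code
    where
    M₁ = update M 0 (M 0 + M 1)
    M₂ = update M₁ (M₁ 0) (M₁ (2 + k))
    ptr₁ : M₁ 0 ≡ N + suc k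
    ptr₁ = trans (cong₂ _+_ (ptr s) (one s)) (trans (+-assoc N k 1) (cong (N +_) (+-comm k 1)))
    2+k<N : 2 + k < N
    2+k<N = ≤-trans (≤-trans (s≤s (s≤s (m≤n+m (suc k) n))) (≤-trans (≤-reflexive (cong (2 +_) (+-suc n k))) (s≤s bound))) K<N
    away : ∀ {a} → a ≢ 0 → a ≢ N + suc k → M₂ a ≡ M a
    away a≢0 a≢ = trans (update-other M₁ (M₁ 0) _ (λ e → a≢ (trans e ptr₁))) (update-other M 0 _ a≢0)
    N+≢ : ∀ i → N + i ≢ 0
    N+≢ i e = contradiction (≤-trans 1≤N (≤-trans (m≤m+n N i) (≤-reflexive e))) λ ()
    small≢ : ∀ {a} → a < N → a ≢ N + suc k
    small≢ a<N refl = <⇒≱ a<N (m≤m+n N (suc k))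
    s′ : Saved M₀ (suc k) M₂
    s′ = record
      { ptr = trans (update-other M₁ (M₁ 0) _ (λ e → N+≢ (suc k) (trans (sym ptr₁) (sym e)))) ptr₁
      ; one = trans (away (λ ()) (small≢ (≤-trans (m≤m+n 2 62) 64≤N))) (one s)
      ; moved = mv
      ; rest = λ { a 2≤a (inj₁ a<N) → trans (away (λ e → contradiction (subst (2 ≤_) e 2≤a) λ ()) (small≢ a<N)) (rest s a 2≤a (inj₁ a<N))
                 ; a 2≤a (inj₂ a>) → trans (away (λ e → contradiction (subst (2 ≤_) e 2≤a) λ ()) (λ e → <-irrefl (sym e) a>))
                       (rest s a 2≤a (inj₂ (≤-trans (s≤s (+-monoʳ-≤ N (n≤1+n k))) a>))) } }
      where
      mv : ∀ i → i ≤ suc k → M₂ (N + i) ≡ M₀ (suc i)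
      mv i i≤ with i ≟ suc k
      ... | yes refl = trans (cong M₂ (sym ptr₁)) (trans (update-same M₁ (M₁ 0) _) (rest s (2 + k) (s≤s (s≤s z≤n)) (inj₁ 2+k<N)))
      ... | no i≢ = trans (away (N+≢ i) (λ e → i≢ (+-cancelˡ-≡ N i (suc k) e))) (moved s i (≤-pred (≤∧≢⇒< i≤ i≢)))
  ... | M′ , r , s″ =
    M′ , step₁ e₁ (z≤n ∷ z≤n ∷ reg≤S (s≤s z≤n) ∷ []) (≤V⇒<W addr≤V ∷ [])
           (step₁ e₂ (z≤n ∷ ≤-trans addr≤ S-bound ∷ reg≤S (≤-trans (s≤s (s≤s (m≤n+m k n))) bound) ∷ [])
             (≤V⇒<W (subst (_≤ V) (sym (rest s (2 + k) (s≤s (s≤s z≤n)) (inj₁ 2+k<N))) (bd (2 + k))) ∷ []) r) ,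
    subst (λ z → Saved M₀ z M′) (+-suc n k) s″
    where
    2+k≤K : 2 + k ≤ K
    2+k≤K = ≤-trans (s≤s (s≤s (m≤n+m k n))) bound
    2+k<N : 2 + k < N
    2+k<N = ≤-trans (s≤s 2+k≤K) K<N
    addr≤ : M 0 + M 1 ≤ I * N
    addr≤ = subst (_≤ I * N) (sym (trans (cong₂ _+_ (ptr s) (one s)) (+-assoc N k 1)))
      (≤-trans (+-monoʳ-≤ N (≤-trans (≤-reflexive (+-comm k 1)) (≤-trans (n≤1+n _) (<⇒≤ 2+k<N))))
        (+-monoʳ-≤ N (m≤m+n N (13 * N))))
    addr≤V : M 0 + M 1 ≤ V
    addr≤V = ≤-trans addr≤ I*N≤V

  record Loaded (n : ℕ) (M₀ : Mem) (M : Mem) : Set where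
    field
      N-reg : M 0 ≡ N
      p-reg : M 1 ≡ p
      2-reg : M 2 ≤ V
      moved : ∀ i → i ≤ n → M (N + i) ≡ M₀ (suc i)
      rest  : ∀ a → 3 ≤ a → a < N ⊎ N + n < a → M a ≡ M₀ a

  relocate-sound : ∀ m n {c c′ M₀} → 2 ^ m ≡ 32 → n < K → M₀ 0 ≡ p → (∀ a → M₀ a ≤ V) → CodeAt P c c′ (relocate m n) →
    Σ Mem λ M′ → Reach P S W ⟨ c , M₀ ⟩ (length (relocate m n)) ⟨ c′ , M′ ⟩ × Loaded n M₀ M′
  relocate-sound m n {c} {c′} {M₀} 2^m n<K M0≡p bd code with CodeAt-++ P c c′ (doubling m) code
  ... | k₁ , e₁ , e₂ , code₂ with CodeAt-++ P _ c′ (save 0 n) code₂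
  ... | k₂ , q₁ , q₂ , q₃ , q₄ , refl with scaling-sound m 32 2^m M0≡p (≤-trans (≤-reflexive (sym N≡32p)) N≤V) k₁
  ... | M₁ , r₁ , v₁′ , f₁ = finish (save-sound n 0 (subst (_< K) (sym (+-identityʳ n)) n<K) bd saved k₂)
    where
    v₁ : M₁ 0 ≡ N
    v₁ = trans v₁′ (sym N≡32p)
    M₂ = update M₁ (M₁ 0) (M₁ 1)
    M₃ = update M₂ 1 1
    N≢ : ∀ {a} → a < N → a ≢ M₁ 0
    N≢ a<N e = <-irrefl (trans e v₁) a<N
    saved : Saved M₀ 0 M₃
    saved = record
      { ptr = trans (update-other M₁ (M₁ 0) _ (N≢ 1≤N)) (trans v₁ (sym (+-identityʳ N)))
      ; one = refl
      ; moved = λ { zero _ → trans (update-other M₂ 1 1 (λ e → <⇒≱ (≤-trans (m≤m+n 2 62) 64≤N) (≤-trans (m≤m+n N 0) (≤-reflexive e))))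
                               (trans (cong M₂ (trans (+-identityʳ N) (sym v₁))) (trans (update-same M₁ (M₁ 0) _) (f₁ 1 λ ()))) }
      ; rest = λ a 2≤a o → trans (update-other M₂ 1 1 (λ e → <⇒≱ 2≤a (≤-reflexive e)))
          (trans (update-other M₁ (M₁ 0) _ (neq o)) (f₁ a (λ e → <⇒≱ 2≤a (≤-trans (≤-reflexive e) z≤n)))) }
      where
      neq : ∀ {a} → a < N ⊎ N + 0 < a → a ≢ M₁ 0
      neq (inj₁ a<N) = N≢ a<N
      neq (inj₂ a>) e = <-irrefl (trans (+-identityʳ N) (sym (trans e v₁))) a>
    finish : Σ Mem (λ M′ → Reach P S W ⟨ _ , M₃ ⟩ (length (save 0 n)) ⟨ _ , M′ ⟩ × Saved M₀ (n + 0) M′) →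
      Σ Mem λ M′ → Reach P S W ⟨ c , M₀ ⟩ (length (relocate m n)) ⟨ _ , M′ ⟩ × Loaded n M₀ M′
    finish (M₄ , r₄ , s₀) =
      M₈ ,
      Reach-mono (≤-reflexive len) (Reach-trans r₁
        (step₁ e₁ (z≤n ∷ subst (_≤ S) (sym v₁) (≤-trans (m≤m+n N (14 * N)) S-bound) ∷ reg≤S (s≤s z≤n) ∷ [])
             (≤V⇒<W (subst (_≤ V) (sym (f₁ 1 λ ())) (bd 1)) ∷ [])
          (step₁ e₂ (reg≤S (s≤s z≤n) ∷ []) (≤V⇒<W (≤-trans (s≤s z≤n) 2≤V) ∷ [])
            (Reach-trans r₄
              (step₁ q₁ (reg≤S (s≤s (s≤s z≤n)) ∷ []) (≤V⇒<W (≤-trans (≤-trans (<⇒≤ n<K) (<⇒≤ K<N)) N≤V) ∷ [])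
                (step₁ q₂ (z≤n ∷ z≤n ∷ reg≤S (s≤s (s≤s z≤n)) ∷ []) (≤V⇒<W (subst (_≤ V) (sym vN) N≤V) ∷ [])
                  (step₁ q₃ (reg≤S (s≤s (s≤s z≤n)) ∷ []) (≤V⇒<W (≤-trans (≤-trans (m≤m+n 32 32) 64≤N) N≤V) ∷ [])
                    (step₁ q₄ (reg≤S (s≤s z≤n) ∷ z≤n ∷ reg≤S (s≤s (s≤s z≤n)) ∷ [])
                       (≤V⇒<W (subst (_≤ V) (sym vp) (≤-trans p≤N N≤V)) ∷ []) stop)))))))) ,
      record { N-reg = vN ; p-reg = vp ; 2-reg = ≤-trans (≤-trans (m≤m+n 32 32) 64≤N) N≤V
             ; moved = λ i i<K → trans (high (N + i) (≤-trans (m≤m+n 3 61) (≤-trans 64≤N (m≤m+n N i)))) (moved s i i<K)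
             ; rest = λ { a 3≤a (inj₁ a<N) → trans (high a 3≤a) (rest s a (≤-trans (n≤1+n 2) 3≤a) (inj₁ a<N))
                        ; a 3≤a (inj₂ a≥) → trans (high a 3≤a) (rest s a (≤-trans (n≤1+n 2) 3≤a)
                             (inj₂ a≥)) } }
      where
      s : Saved M₀ n M₄
      s = subst (λ z → Saved M₀ z M₄) (+-identityʳ n) s₀
      len : length (doubling m) + (2 + (length (save 0 n) + 4)) ≡ length (relocate m n)
      len = sym (trans (length-++ (doubling m)) (cong (λ z → length (doubling m) + (2 + z)) (length-++ (save 0 n))))
      M₅ = update M₄ 2 n
      M₆ = update M₅ 0 (M₅ 0 ∸ M₅ 2)
      M₇ = update M₆ 2 32
      M₈ = update M₇ 1 (divℕ (M₇ 0) (M₇ 2))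
      vN : M₄ 0 ∸ n ≡ N
      vN = trans (cong (_∸ n) (ptr s)) (m+n∸n≡m N n)
      vp : divℕ (M₄ 0 ∸ n) 32 ≡ p
      vp = trans (cong (λ z → divℕ z 32) (trans vN (trans N≡32p (*-comm 32 p)))) (m*n/n≡m p 32)
      high : ∀ a → 3 ≤ a → M₈ a ≡ M₄ a
      high a 3≤a = trans (update-other M₇ 1 _ (neq 1 (s≤s (s≤s z≤n)))) (trans (update-other M₆ 2 _ (neq 2 (s≤s (s≤s (s≤s z≤n)))))
        (trans (update-other M₅ 0 _ (neq 0 (s≤s z≤n))) (update-other M₄ 2 _ (neq 2 (s≤s (s≤s (s≤s z≤n)))))))
        where
        neq : ∀ b → b < 3 → a ≢ b
        neq b b<3 refl = <⇒≱ b<3 3≤a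

  restore-sound : ∀ n {c c′ M} → n < K → (∀ i → i ≤ K → M (14 * N + i) ≤ V) → M 0 ≡ 14 * N + suc n → M 1 ≡ 1 →
    CodeAt P c c′ (restore n) →
    Σ Mem λ M′ → Reach P S W ⟨ c , M ⟩ (length (restore n)) ⟨ c′ , M′ ⟩ ×
      (∀ i → i < n → M′ (2 + i) ≡ M (14 * N + (2 + i))) × (∀ a → 2 + n ≤ a → M′ a ≡ M a)
  restore-sound zero {M = M} _ _ _ _ refl = M , stop , (λ i ()) , λ a _ → refl
  restore-sound (suc n) {c} {c′} {M} n<K bd M0 M1 (e₁ , e₂ , code) =
    finish (restore-sound n {M = M₂} (<⇒≤ n<K) (λ i i≤K → subst (_≤ V) (sym (far i)) (bd i i≤K)) ptr₂ M1 code)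
    where
    M₁ = update M (2 + n) (M (M 0))
    M₂ = update M₁ 0 (M₁ 0 ∸ M₁ 1)
    ptr₂ : M 0 ∸ M 1 ≡ 14 * N + suc n
    ptr₂ = trans (cong₂ _∸_ M0 M1) (trans (cong (_∸ 1) (+-suc (14 * N) (suc n))) refl)
    N≤addr : ∀ i → N ≤ 14 * N + i
    N≤addr i = ≤-trans (m≤m+n N (13 * N)) (m≤m+n (14 * N) i)
    far : ∀ i → M₂ (14 * N + i) ≡ M (14 * N + i)
    far i = trans (update-other M₁ 0 _ (λ e → <⇒≱ 1≤N (≤-trans (N≤addr i) (≤-reflexive e))))
      (update-other M (2 + n) _ (λ e → <⇒≱ K<N (≤-trans (N≤addr i) (≤-trans (≤-reflexive e) n<K))))
    val : M (M 0) ≡ M (14 * N + (2 + n))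
    val = cong M M0
    finish : Σ Mem (λ M′ → Reach P S W ⟨ _ , M₂ ⟩ (length (restore n)) ⟨ c′ , M′ ⟩ ×
        (∀ i → i < n → M′ (2 + i) ≡ M₂ (14 * N + (2 + i))) × (∀ a → 2 + n ≤ a → M′ a ≡ M₂ a)) →
      Σ Mem λ M′ → Reach P S W ⟨ c , M ⟩ (2 + length (restore n)) ⟨ c′ , M′ ⟩ ×
        (∀ i → i < suc n → M′ (2 + i) ≡ M (14 * N + (2 + i))) × (∀ a → 3 + n ≤ a → M′ a ≡ M a)
    finish (M′ , r , g , h) =
      M′ ,
      step₁ e₁ (reg≤S n<K ∷ z≤n ∷ subst (_≤ S) (sym M0) (≤-trans (address-bound {14} (n<1+n 14) (≤-trans (s≤s n<K) K<N)) S-bound) ∷ [])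
        (≤V⇒<W (subst (_≤ V) (sym val) (bd (2 + n) n<K)) ∷ [])
        (step₁ e₂ (z≤n ∷ z≤n ∷ reg≤S (s≤s z≤n) ∷ [])
          (≤V⇒<W (≤-trans (m∸n≤m (M 0) (M 1)) (subst (_≤ V) (sym M0) (≤-trans (address-bound {14} (n<1+n 14) (≤-trans (s≤s n<K) K<N)) I*N≤V))) ∷ []) r) ,
      out , λ a a≥ → trans (h a (≤-trans (n≤1+n _) a≥)) (trans (update-other M₁ 0 _ (λ { refl → contradiction a≥ λ () })) (update-other M (2 + n) _ (λ e → <-irrefl (sym e) a≥)))
      where
      out : ∀ i → i < suc n → M′ (2 + i) ≡ M (14 * N + (2 + i))
      out i i< with i ≟ n
      ... | yes refl = trans (h (2 + n) ≤-refl) (trans (update-same M (2 + n) _) val)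
      ... | no i≢n = trans (g i (≤∧≢⇒< (≤-pred i<) i≢n)) (far (2 + i))

  deliver-sound : ∀ n {c c′ M} → n < K → (∀ i → i ≤ K → M (14 * N + i) ≤ V) → M 0 ≡ N → CodeAt P c c′ (deliver n) →
    Σ Mem λ M′ → Reach P S W ⟨ c , M ⟩ (length (deliver n)) ⟨ c′ , M′ ⟩ ×
      (∀ a → 2 ≤ a → a ≤ suc n → M′ a ≡ M (14 * N + a)) × (∀ a → suc n < a → M′ a ≡ M a)
  deliver-sound n {c} {c′} {M} n<K bd M0 (e₁ , e₂ , e₃ , e₄ , e₅ , code) =
    finish (restore-sound n {M = M₅} n<K (λ i i≤K → subst (_≤ V) (sym (high (14 * N + i) (big i))) (bd i i≤K))
      addr≡ refl code)
    where
    M₁ = update M 1 14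
    M₂ = update M₁ 0 (M₁ 0 * M₁ 1)
    M₃ = update M₂ 1 (suc n)
    M₄ = update M₃ 0 (M₃ 0 + M₃ 1)
    M₅ = update M₄ 1 1
    addr≡ : M 0 * 14 + suc n ≡ 14 * N + suc n
    addr≡ = cong (_+ suc n) (trans (cong (_* 14) M0) (*-comm N 14))
    addr≤ : M 0 * 14 + suc n ≤ V
    addr≤ = subst (_≤ V) (sym addr≡) (≤-trans (address-bound {14} (n<1+n 14) (≤-trans (s≤s n<K) K<N)) I*N≤V)
    big : ∀ i → 2 ≤ 14 * N + i
    big i = ≤-trans (≤-trans (m≤m+n 2 62) 64≤N) (≤-trans (m≤m+n N (13 * N)) (m≤m+n (14 * N) i))
    high : ∀ a → 2 ≤ a → M₅ a ≡ M a
    high a 2≤a = trans (update-other M₄ 1 1 n1) (trans (update-other M₃ 0 _ n0) (trans (update-other M₂ 1 (suc n) n1)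
      (trans (update-other M₁ 0 _ n0) (update-other M 1 14 n1))))
      where
      n1 : a ≢ 1
      n1 refl = contradiction (≤-pred 2≤a) λ ()
      n0 : a ≢ 0
      n0 refl = contradiction 2≤a λ ()
    finish : Σ Mem (λ M′ → Reach P S W ⟨ _ , M₅ ⟩ (length (restore n)) ⟨ c′ , M′ ⟩ ×
        (∀ i → i < n → M′ (2 + i) ≡ M₅ (14 * N + (2 + i))) × (∀ a → 2 + n ≤ a → M′ a ≡ M₅ a)) →
      Σ Mem λ M′ → Reach P S W ⟨ c , M ⟩ (length (deliver n)) ⟨ c′ , M′ ⟩ ×
        (∀ a → 2 ≤ a → a ≤ suc n → M′ a ≡ M (14 * N + a)) × (∀ a → suc n < a → M′ a ≡ M a)
    finish (M′ , r , g , h) =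
      M′ ,
      step₁ e₁ (reg≤S (s≤s z≤n) ∷ []) (≤V⇒<W (≤-trans (≤-trans (m≤m+n 14 50) 64≤N) N≤V) ∷ [])
        (step₁ e₂ (z≤n ∷ z≤n ∷ reg≤S (s≤s z≤n) ∷ []) (≤V⇒<W (≤-trans (m≤m+n _ (suc n)) addr≤) ∷ [])
          (step₁ e₃ (reg≤S (s≤s z≤n) ∷ []) (≤V⇒<W (≤-trans n<K (≤-trans (<⇒≤ K<N) N≤V)) ∷ [])
            (step₁ e₄ (z≤n ∷ z≤n ∷ reg≤S (s≤s z≤n) ∷ []) (≤V⇒<W addr≤ ∷ [])
              (step₁ e₅ (reg≤S (s≤s z≤n) ∷ []) (≤V⇒<W (≤-trans (s≤s z≤n) 2≤V) ∷ []) r)))) ,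
      outs , λ a n<a → trans (h a n<a) (high a (≤-trans (s≤s (s≤s z≤n)) n<a))
      where
      outs : ∀ a → 2 ≤ a → a ≤ suc n → M′ a ≡ M (14 * N + a)
      outs (suc (suc i)) (s≤s (s≤s z≤n)) a≤K = trans (g i (≤-pred a≤K)) (high (14 * N + (2 + i)) (big (2 + i)))

sumTo-cong : ∀ {f g} k → (∀ j → 1 ≤ j → j ≤ k → f j ≡ g j) → sumTo f k ≡ sumTo g k
sumTo-cong zero h = refl
sumTo-cong (suc k) h = cong₂ _+_ (h (suc k) (s≤s z≤n) ≤-refl) (sumTo-cong k (λ j 1≤j j≤k → h j 1≤j (m≤n⇒m≤1+n j≤k)))

subsetSumUpTo≡sumTo : ∀ p d M k → subsetSumUpTo p d M k ≡ sumTo (chosen d (λ j → M (p + j))) k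
subsetSumUpTo≡sumTo p d M zero = refl
subsetSumUpTo≡sumTo p d M (suc k) = cong (chosen d (λ j → M (p + j)) (suc k) +_) (subsetSumUpTo≡sumTo p d M k)

initMem-0 : ∀ p d τ → initMem p d τ 0 ≡ p
initMem-0 p d τ = refl

<⇒<ᵇ-true : ∀ {m n} → m < n → (m <ᵇ n) ≡ true
<⇒<ᵇ-true {zero} (s≤s _) = refl
<⇒<ᵇ-true {suc m} (s≤s m<n) = <⇒<ᵇ-true m<n

≥⇒<ᵇ-false : ∀ {m n} → n ≤ m → (m <ᵇ n) ≡ false
≥⇒<ᵇ-false {m} {zero} _ = refl
≥⇒<ᵇ-false {suc m} {suc n} (s≤s n≤m) = ≥⇒<ᵇ-false n≤m

initMem-d : ∀ p d τ j → 1 ≤ j → j < p → initMem p d τ j ≡ d j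
initMem-d p d τ (suc j) _ j<p rewrite <⇒<ᵇ-true j<p = refl

initMem-τ : ∀ p d τ → 1 ≤ p → initMem p d τ p ≡ τ
initMem-τ (suc p) d τ _ rewrite ≥⇒<ᵇ-false (≤-refl {p}) | ≡ᵇ-refl p = refl

initMem-far : ∀ p d τ a → p < a → initMem p d τ a ≡ 0
initMem-far p d τ (suc a) p<a rewrite ≥⇒<ᵇ-false (<⇒≤ p<a) | ≢⇒≡ᵇ-false (suc a) p (λ e → <-irrefl (sym e) p<a) = refl

initMem-bound : ∀ p d τ → 1 ≤ p → (∀ j → 1 ≤ j → j < p → d j < p) → τ < p → ∀ a → initMem p d τ a ≤ p
initMem-bound p d τ 1≤p hd τ<p zero = ≤-refl
initMem-bound p d τ 1≤p hd τ<p (suc a) with <-cmp (suc a) p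
... | tri< a<p _ _ = subst (_≤ p) (sym (initMem-d p d τ (suc a) (s≤s z≤n) a<p)) (<⇒≤ (hd (suc a) (s≤s z≤n) a<p))
... | tri≈ _ e _ = subst (_≤ p) (sym (trans (cong (initMem p d τ) e) (initMem-τ p d τ 1≤p))) (<⇒≤ τ<p)
... | tri> _ _ p<a = subst (_≤ p) (sym (initMem-far p d τ (suc a) p<a)) z≤n

instrAt-end : ∀ xs → instrAt xs (length xs) ≡ halt
instrAt-end [] = refl
instrAt-end (x ∷ xs) = instrAt-end xs

-- Array 1 holds the displaced cells 1 to `K`, hence the shift by one; input beyond `K` is still in
-- array 0. Arrays from 2 on lie beyond the input, so they are zero without being cleared.
Init : (p N : ℕ) (d : ℕ → ℕ) (τ : ℕ) → Asrt
Init p N d τ vr ar =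
  (∀ i → i < K → ar 1 i ≡ initMem p d τ (suc i)) ×
  (∀ x → K < x → x < N → ar 0 x ≡ initMem p d τ x) ×
  (∀ i x → 2 ≤ i → i < I → x < N → ar i x ≡ 0)

-- Array 14 holds the output under its final addresses; array 0 already holds those above K.
Delivered : (p : ℕ) (d : ℕ → ℕ) (τ : ℕ) → Asrt
Delivered p d τ vr ar = Σ (ℕ → ℕ) λ out →
  (∀ j → 1 ≤ j → j < p → ar 14 (p + j) ≡ out j × (K < p + j → ar 0 (p + j) ≡ out j)) ×
  modℕ (sumTo (chosen d out) (p ∸ 1)) p ≡ τ

module Execution
  (p N : ℕ) (2≤p : 2 ≤ p) (N≡32p : N ≡ 32 * p) (P : Program) (S W : ℕ)
  (S-bound : I * N ≤ S) (W-bound : ∀ {n} → n ≤ (N * N) ^ 16 → n < W) where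

  open Semantics p N
  open Soundness p N 2≤p N≡32p P S W S-bound W-bound
  open Frame p N 2≤p N≡32p P S W S-bound W-bound
  open Blocks p N 2≤p N≡32p P S W S-bound W-bound

  1≤p : 1 ≤ p
  1≤p = ≤-trans (n≤1+n 1) 2≤p

  p<N : p < N
  p<N = ≤-trans (≤-reflexive (+-comm 1 p)) (≤-trans (+-monoʳ-≤ p (≤-trans 1≤p (m≤m+n p (30 * p)))) (≤-reflexive (sym N≡32p)))

  2p≤N : p + p ≤ N
  2p≤N = ≤-trans (+-monoʳ-≤ p (m≤m+n p (30 * p))) (≤-reflexive (sym N≡32p))

  initial : ∀ n {d τ M} → suc n ≡ K → (∀ j → 1 ≤ j → j < p → d j < p) → τ < p →
    Loaded n (initMem p d τ) M → Init p N d τ (λ x → M (3 + x)) (λ i x → M (i * N + x)) × 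
    Sim (M 2) (λ x → M (3 + x)) (λ i x → M (i * N + x)) M
  initial n {d} {τ} {M} 1+n≡K hd τ<p l =
    (saved , low , zeros) ,
    record { rN = N-reg ; rp = p-reg ; rj = refl ; rv = λ _ _ → refl ; ra = λ _ _ _ _ _ → refl
           ; bj = 2-reg ; bv = λ x x<U → subst (_≤ V) (sym (regs x x<U)) (M₀≤V (3 + x))
           ; ba = bounds }
    where
    open Loaded l
    M₀ = initMem p d τ
    M₀≤V : ∀ a → M₀ a ≤ V
    M₀≤V a = ≤-trans (initMem-bound p d τ 1≤p hd τ<p a) (≤-trans p≤N N≤V)
    saved : ∀ i → i < K → M (1 * N + i) ≡ M₀ (suc i)
    saved i i<K = trans (cong (λ z → M (z + i)) (+-identityʳ N)) (moved i (≤-pred (subst (i <_) (sym 1+n≡K) i<K)))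
    low : ∀ x → K < x → x < N → M x ≡ M₀ x
    low x K<x x<N = rest x (≤-trans (m≤m+n 3 22) K<x) (inj₁ x<N)
    regs : ∀ x → x < U → M (3 + x) ≡ M₀ (3 + x)
    regs x x<U = rest (3 + x) (s≤s (s≤s (s≤s z≤n))) (inj₁ (≤-trans (s≤s (s≤s (s≤s (s≤s (<⇒≤ x<U))))) (≤-trans (m≤m+n 16 48) 64≤N)))
    n<N : n < N
    n<N = ≤-trans (≤-reflexive 1+n≡K) (<⇒≤ K<N)
    high : ∀ i x → 2 ≤ i → M (i * N + x) ≡ 0
    high i x 2≤i = trans (rest a (≤-trans (≤-trans (m≤m+n 3 61) 64≤N) (≤-trans (m≤m+n N N) 2N≤a))
                      (inj₂ (≤-trans (+-monoʳ-< N n<N) 2N≤a)))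
                    (initMem-far p d τ a (≤-trans p<N (≤-trans (m≤m+n N N) 2N≤a)))
      where
      a = i * N + x
      2N≤a : N + N ≤ a
      2N≤a = ≤-trans (≤-reflexive (cong (N +_) (sym (+-identityʳ N)))) (≤-trans (*-monoˡ-≤ N 2≤i) (m≤m+n (i * N) x))
    zeros : ∀ i x → 2 ≤ i → i < I → x < N → M (i * N + x) ≡ 0
    zeros i x 2≤i _ _ = high i x 2≤i
    bounds : ∀ i x → i < I → x < N → Low i x → M (i * N + x) ≤ V
    bounds zero x _ x<N l = subst (_≤ V) (sym (low x l x<N)) (M₀≤V x)
    bounds (suc zero) x _ x<N _ with x ≤? n
    ... | yes x≤n = subst (_≤ V) (sym (saved x (subst (x <_) 1+n≡K (s≤s x≤n)))) (M₀≤V (suc x))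
    ... | no x≰n = subst (_≤ V) (sym (rest a (≤-trans (≤-trans (m≤m+n 3 61) 64≤N) (≤-trans (m≤m+n N 0) (m≤m+n (1 * N) x)))
                     (inj₂ (≤-trans (+-monoʳ-< N (≰⇒> x≰n)) (+-monoˡ-≤ x (m≤m+n N 0)))))) (M₀≤V a)
      where a = 1 * N + x
    bounds (suc (suc i)) x _ _ _ = subst (_≤ V) (sym (high (2 + i) x (s≤s (s≤s z≤n)))) z≤n

  execute : ∀ k m n {d τ c₁ c₂ c₃} → OkC k → 2 ^ m ≡ 32 → suc n ≡ K →
    (∀ j → 1 ≤ j → j < p → d j < p) → τ < p →
    CodeAt P 0 c₁ (relocate m n) → CodeAt P c₁ c₂ (compC c₁ k) → CodeAt P c₂ c₃ (deliver n) →
    Triple (Init p N d τ) k (Delivered p d τ) →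
    Σ Mem λ M → Reach P S W (initConfig p d τ) (length (relocate m n) + (cost c₁ k * p + length (deliver n))) ⟨ c₃ , M ⟩ ×
      modℕ (subsetSum p d M) p ≡ τ
  execute k m n {d} {τ} ok 2^m 1+n≡K hd τ<p q₁ q₂ q₃ t
    with relocate-sound m n 2^m (≤-reflexive 1+n≡K) (initMem-0 p d τ)
           (λ a → ≤-trans (initMem-bound p d τ 1≤p hd τ<p a) (≤-trans p≤N N≤V)) q₁
  ... | M₁ , r₁ , l with initial n 1+n≡K hd τ<p l
  ... | φ , s₁ with valid t ok φ s₁ q₂
  ... | j , vr , ar , M₂ , r₂ , s₂ , out , outs , sum≡
    with deliver-sound n (≤-reflexive 1+n≡K)
           (λ i i≤K → subst (_≤ V) (sym (ra s₂ 14 i (n<1+n 14) (≤-trans (s≤s i≤K) K<N) tt)) (ba s₂ 14 i (n<1+n 14) (≤-trans (s≤s i≤K) K<N) tt))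
           (rN s₂) q₃
  ... | M₃ , r₃ , g , h =
    M₃ , Reach-trans r₁ (Reach-trans r₂ r₃) ,
    trans (cong (λ z → modℕ z p) (trans (subsetSumUpTo≡sumTo p d M₃ (p ∸ 1)) (sumTo-cong (p ∸ 1) same))) sum≡
    where
    cell : ∀ j → 1 ≤ j → j < p → M₃ (p + j) ≡ out j
    cell j 1≤j j<p with p + j ≤? K
    ... | yes a≤K = trans (g (p + j) (≤-trans 2≤p (m≤m+n p j)) (subst (p + j ≤_) (sym 1+n≡K) a≤K))
          (trans (ra s₂ 14 (p + j) (n<1+n 14) (≤-trans (s≤s a≤K) K<N) tt) (proj₁ (outs j 1≤j j<p)))
    ... | no a≰K = trans (h (p + j) (subst (_< p + j) (sym 1+n≡K) (≰⇒> a≰K)))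
          (trans (ra s₂ 0 (p + j) (s≤s z≤n) (≤-trans (+-monoʳ-< p j<p) 2p≤N) (≰⇒> a≰K)) (proj₂ (outs j 1≤j j<p) (≰⇒> a≰K)))
    same : ∀ j → 1 ≤ j → j ≤ p ∸ 1 → chosen d (λ i → M₃ (p + i)) j ≡ chosen d out j
    same j 1≤j j≤ = cong (λ z → if z ≡ᵇ 0 then 0 else d j)
      (cell j 1≤j (≤-trans (s≤s j≤) (≤-reflexive (m+[n∸m]≡n 1≤p))))

-- From a verified command to time, space and word bounds

record Bounds (c : ℕ) (P : Program) (k : Cmd) (m n : ℕ) : Set where
  field
    placed₁ : CodeAt P 0 (length (relocate m n)) (relocate m n)
    placed₂ : CodeAt P (length (relocate m n)) (length (relocate m n) + length (compC (length (relocate m n)) k)) (compC (length (relocate m n)) k)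
    placed₃ : CodeAt P (length (relocate m n) + length (compC (length (relocate m n)) k)) (length P) (deliver n)
    steps   : length (relocate m n) + (cost (length (relocate m n)) k + length (deliver n)) ≤ c
    space   : I * 32 ≤ c
    words   : 193 ≤ c

place : ∀ k m n → let xs = relocate m n ; ys = compC (length xs) k ; zs = deliver n in
  ∀ {c} → length xs + (cost (length xs) k + length zs) ≤ c → I * 32 ≤ c → 193 ≤ c →
  Bounds c (xs ++ ys ++ zs) k m n
place k m n s₁ s₂ s₃ = record
  { placed₁ = CodeAt-prefix [] xs (ys ++ zs)
  ; placed₂ = CodeAt-prefix xs ys zs
  ; placed₃ = subst₂ (λ l e → CodeAt (xs ++ ys ++ zs) l e zs) (length-++ xs) end
      (subst (λ Q → CodeAt Q (length (xs ++ ys)) (length (xs ++ ys) + length zs) zs)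
        (trans (cong ((xs ++ ys) ++_) (++-identityʳ zs)) (++-assoc xs ys zs)) (CodeAt-prefix (xs ++ ys) zs []))
  ; steps = s₁ ; space = s₂ ; words = s₃ }
  where
  xs = relocate m n
  ys = compC (length xs) k
  zs = deliver n
  end : length (xs ++ ys) + length zs ≡ length (xs ++ ys ++ zs)
  end = trans (sym (length-++ (xs ++ ys))) (cong length (++-assoc xs ys zs))

halted-end : ∀ P M → Halted P ⟨ length P , M ⟩
halted-end P M = cong isHalt (instrAt-end P)

-- With b = p + 2 one has 32 ≤ b ^ 5, so N ≤ b ^ 6 and N ^ 32 ≤ b ^ 192; one more factor makes the
-- inequality strict.
V^16<[p+2]^c : ∀ p c N → N ≡ 32 * p → 193 ≤ c → ∀ {n} → n ≤ (N * N) ^ 16 → n < (p + 2) ^ c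
V^16<[p+2]^c p c N N≡ 193≤c {n} n≤ = begin-strict
  n ≤⟨ n≤ ⟩
  (N * N) ^ 16 ≤⟨ ^-monoˡ-≤ 16 (*-mono-≤ N≤ N≤) ⟩
  (b ^ 6 * b ^ 6) ^ 16 ≡⟨ cong (_^ 16) (sym (^-distribˡ-+-* b 6 6)) ⟩
  (b ^ 12) ^ 16 ≡⟨ ^-*-assoc b 12 16 ⟩
  b ^ 192 <⟨ ^-monoʳ-< b 1<b {192} {193} (n<1+n 192) ⟩
  b ^ 193 ≤⟨ ^-monoʳ-≤ b 193≤c ⟩
  b ^ c ∎
  where
  open ≤-Reasoning
  b = p + 2
  1<b : 1 < b
  1<b = m≤n+m 2 p
  instance
    b-nonZero : NonZero b
    b-nonZero = >-nonZero (<⇒≤ 1<b)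
  N≤ : N ≤ b ^ 6
  N≤ = begin
    N ≡⟨ N≡ ⟩
    32 * p ≤⟨ *-mono-≤ (^-monoˡ-≤ 5 {2} {b} (m≤n+m 2 p)) (m≤m+n p 2) ⟩
    b ^ 5 * b ≡⟨ *-comm (b ^ 5) b ⟩
    b ^ 6 ∎

conclude : ∀ {c P k m n} → Bounds c P k m n → OkC k → 2 ^ m ≡ 32 → suc n ≡ K →
  ∀ {p d τ} → 2 ≤ p → (∀ j → 1 ≤ j → j < p → d j < p) → τ < p →
  (∀ N → (2≤p : 2 ≤ p) (N≡ : N ≡ 32 * p) (S W : ℕ) (hS : I * N ≤ S) (hW : ∀ {n} → n ≤ (N * N) ^ 16 → n < W) →
    Blocks.Triple p N 2≤p N≡ P S W hS hW (Init p N d τ) k (Delivered p d τ)) →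
  Halted P (run P (c * p) (initConfig p d τ)) ×
  (∀ t → t < c * p → StepWithin P (c * p) ((p + 2) ^ c) (run P t (initConfig p d τ))) ×
  (modℕ (subsetSum p d (mem (run P (c * p) (initConfig p d τ)))) p ≡ τ)
conclude {c} {P} {k} {m} {n} b ok 2^m 1+n≡K {p} {d} {τ} 2≤p hd τ<p verified =
  subst (Halted P) (sym final) halted , (λ t _ → Reach⇒within (proj₁ (proj₂ result)) halted t) ,
  trans (cong (λ cfg → modℕ (subsetSum p d (mem cfg)) p) final) (proj₂ (proj₂ result))
  where
  open Bounds b
  S-bound : I * (32 * p) ≤ c * p
  S-bound = ≤-trans (≤-reflexive (sym (*-assoc I 32 p))) (*-monoˡ-≤ p space)
  W-bound : ∀ {n} → n ≤ ((32 * p) * (32 * p)) ^ 16 → n < (p + 2) ^ c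
  W-bound = V^16<[p+2]^c p c (32 * p) refl words
  L = length (relocate m n)
  Result : Set
  Result = Σ Mem λ M → Reach P (c * p) ((p + 2) ^ c) (initConfig p d τ) (L + (cost L k * p + length (deliver n))) ⟨ length P , M ⟩ ×
      modℕ (subsetSum p d M) p ≡ τ
  result : Result
  result = Execution.execute p (32 * p) 2≤p refl P (c * p) ((p + 2) ^ c) S-bound W-bound k m n ok 2^m 1+n≡K hd τ<p
    placed₁ placed₂ placed₃ (verified (32 * p) 2≤p refl (c * p) ((p + 2) ^ c) S-bound W-bound)
  1≤p : 1 ≤ p
  1≤p = ≤-trans (n≤1+n 1) 2≤p
  n≤n*p : ∀ n → n ≤ n * p
  n≤n*p n = ≤-trans (≤-reflexive (sym (*-identityʳ n))) (*-monoʳ-≤ n 1≤p)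
  time : L + (cost L k * p + length (deliver n)) ≤ c * p
  time = ≤-trans (+-mono-≤ (n≤n*p L) (+-monoʳ-≤ (cost L k * p) (n≤n*p (length (deliver n)))))
    (≤-trans (≤-reflexive (trans (cong (L * p +_) (sym (*-distribʳ-+ p (cost L k) _))) (sym (*-distribʳ-+ p L _)))) (*-monoˡ-≤ p steps))
  halted : Halted P ⟨ length P , proj₁ result ⟩
  halted = halted-end P (proj₁ result)
  final : run P (c * p) (initConfig p d τ) ≡ ⟨ length P , proj₁ result ⟩
  final = Reach⇒run (proj₁ (proj₂ result)) halted time

-- Finite sums

sumTo-mono : ∀ {f g} k → (∀ j → 1 ≤ j → j ≤ k → f j ≤ g j) → sumTo f k ≤ sumTo g k
sumTo-mono zero h = z≤n
sumTo-mono (suc k) h = +-mono-≤ (h (suc k) (s≤s z≤n) ≤-refl) (sumTo-mono k (λ j 1≤j j≤k → h j 1≤j (m≤n⇒m≤1+n j≤k)))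

sumTo-+ : ∀ f g k → sumTo (λ j → f j + g j) k ≡ sumTo f k + sumTo g k
sumTo-+ f g zero = refl
sumTo-+ f g (suc k) = trans (cong (f (suc k) + g (suc k) +_) (sumTo-+ f g k)) (interchange (f (suc k)) (g (suc k)) _ _)
  where
  interchange : ∀ a b c d → a + b + (c + d) ≡ a + c + (b + d)
  interchange = solve-∀

sumTo-const : ∀ c k → sumTo (λ _ → c) k ≡ k * c
sumTo-const c zero = refl
sumTo-const c (suc k) = cong (c +_) (sumTo-const c k)

sumTo-swap : ∀ (f : ℕ → ℕ → ℕ) m n → sumTo (λ i → sumTo (f i) n) m ≡ sumTo (λ j → sumTo (λ i → f i j) m) n
sumTo-swap f zero n = sym (trans (sumTo-const 0 n) (*-zeroʳ n))
sumTo-swap f (suc m) n = trans (cong (sumTo (f (suc m)) n +_) (sumTo-swap f m n)) (sym (sumTo-+ (f (suc m)) _ n))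

term≤sumTo : ∀ f k j → 1 ≤ j → j ≤ k → f j ≤ sumTo f k
term≤sumTo f zero zero () _
term≤sumTo f (suc k) j 1≤j j≤k with j ≟ suc k
... | yes refl = m≤m+n _ _
... | no j≢k = ≤-trans (term≤sumTo f k j 1≤j (≤-pred (≤∧≢⇒< j≤k j≢k))) (m≤n+m _ (f (suc k)))

-- The effect of one array update on a sum, with the old and new terms on opposite sides to avoid
-- truncated subtraction.
sumTo-change : ∀ {f g} x k → 1 ≤ x → x ≤ k → (∀ j → j ≢ x → g j ≡ f j) → sumTo g k + f x ≡ sumTo f k + g x
sumTo-change {f} {g} x zero 1≤x x≤k h = contradiction (≤-trans 1≤x x≤k) λ ()
sumTo-change {f} {g} x (suc k) 1≤x x≤k h with x ≟ suc k
... | yes refl = trans (cong (λ z → g (suc k) + z + f (suc k)) (sumTo-cong k (λ j _ j≤k → h j (λ e → <-irrefl e (s≤s j≤k)))))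
                   (rotate (g (suc k)) (sumTo f k) (f (suc k)))
  where
  rotate : ∀ a b c → a + b + c ≡ c + b + a
  rotate = solve-∀
... | no x≢k = trans (+-assoc (g (suc k)) _ _)
                 (trans (cong₂ _+_ (h (suc k) (λ e → x≢k (sym e))) (sumTo-change x k 1≤x (≤-pred (≤∧≢⇒< x≤k x≢k)) h))
                   (sym (+-assoc (f (suc k)) _ _)))

sumTo-tail : ∀ f k n → k ≤ n → (∀ j → k < j → j ≤ n → f j ≡ 0) → sumTo f n ≡ sumTo f k
sumTo-tail f k zero z≤n h = refl
sumTo-tail f k (suc n) k≤n h with k ≟ suc n
... | yes refl = refl
... | no k≢ = trans (cong (_+ sumTo f n) (h (suc n) k<n ≤-refl))
                (sumTo-tail f k n (≤-pred k<n) (λ j k<j j≤n → h j k<j (m≤n⇒m≤1+n j≤n)))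
  where
  k<n : k < suc n
  k<n = ≤∧≢⇒< k≤n k≢

sumTo-*ˡ : ∀ c f k → c * sumTo f k ≡ sumTo (λ j → c * f j) k
sumTo-*ˡ c f zero = *-zeroʳ c
sumTo-*ˡ c f (suc k) = trans (*-distribˡ-+ c (f (suc k)) _) (cong (c * f (suc k) +_) (sumTo-*ˡ c f k))

eq : ℕ → ℕ → ℕ
eq a b = if a ≡ᵇ b then 1 else 0

eq-refl : ∀ a → eq a a ≡ 1
eq-refl a rewrite ≡ᵇ-refl a = refl

eq≤1 : ∀ a b → eq a b ≤ 1
eq≤1 a b with a ≡ᵇ b
... | true = ≤-refl
... | false = z≤n

eq-mono : ∀ a b a′ b′ → (a ≡ b → a′ ≡ b′) → eq a b ≤ eq a′ b′
eq-mono a b a′ b′ h with a ≟ b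
... | yes refl rewrite h refl | ≡ᵇ-refl a | ≡ᵇ-refl b′ = ≤-refl
... | no a≢b rewrite ≢⇒≡ᵇ-false a b a≢b = z≤n

isZero : ℕ → ℕ
isZero zero = 1
isZero (suc _) = 0

modℕ-spec : ∀ x p → 1 ≤ p → modℕ x p < p × (x ≡ modℕ x p + divℕ x p * p)
modℕ-spec x (suc n) _ = m%n<n x (suc n) , m≡m%n+[m/n]*n x (suc n)

-- Arithmetic modulo p

module Congruence (p : ℕ) (1≤p : 1 ≤ p) where

  infix 4 _≈_
  -- Multiples of p may be added on either side, which makes the relation visibly symmetric and free
  -- of subtraction.
  data _≈_ (x y : ℕ) : Set where
    by : ∀ a b → x + a * p ≡ y + b * p → x ≈ y

  ≡⇒≈ : ∀ {x y} → x ≡ y → x ≈ y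
  ≡⇒≈ refl = by 0 0 refl

  ≈-sym : ∀ {x y} → x ≈ y → y ≈ x
  ≈-sym (by a b e) = by b a (sym e)

  ≈-trans : ∀ {x y z} → x ≈ y → y ≈ z → x ≈ z
  ≈-trans {x} {y} {z} (by a b e) (by a′ b′ e′) = by (a + a′) (b′ + b)
    (trans (split x a a′ p) (trans (cong (_+ a′ * p) e) (trans (swap y (b * p) (a′ * p)) (trans (cong (_+ b * p) e′) (sym (split z b′ b p))))))
    where
    split : ∀ x a b p → x + (a + b) * p ≡ x + a * p + b * p
    split = solve-∀
    swap : ∀ y u v → y + u + v ≡ y + v + u
    swap = solve-∀

  +-cong-≈ : ∀ {x y x′ y′} → x ≈ y → x′ ≈ y′ → x + x′ ≈ y + y′
  +-cong-≈ {x} {y} {x′} {y′} (by a b e) (by a′ b′ e′) = by (a + a′) (b + b′)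
    (trans (split x x′ a a′ p) (trans (cong₂ _+_ e e′) (sym (split y y′ b b′ p))))
    where
    split : ∀ x x′ a a′ p → x + x′ + (a + a′) * p ≡ (x + a * p) + (x′ + a′ * p)
    split = solve-∀

  *-congˡ-≈ : ∀ c {x y} → x ≈ y → c * x ≈ c * y
  *-congˡ-≈ c {x} {y} (by a b e) = by (c * a) (c * b)
    (trans (split c x a p) (trans (cong (c *_) e) (sym (split c y b p))))
    where
    split : ∀ c x a p → c * x + c * a * p ≡ c * (x + a * p)
    split = solve-∀

  *-cong-≈ : ∀ {x y x′ y′} → x ≈ y → x′ ≈ y′ → x * x′ ≈ y * y′
  *-cong-≈ {x} {y} {x′} {y′} h h′ = ≈-trans (*-congˡ-≈ x h′)
    (≈-trans (≡⇒≈ (*-comm x y′)) (≈-trans (*-congˡ-≈ y′ h) (≡⇒≈ (*-comm y′ y))))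

  +-cancelʳ-≈ : ∀ {x y} z → x + z ≈ y + z → x ≈ y
  +-cancelʳ-≈ {x} {y} z (by a b e) = by a b (+-cancelʳ-≡ z (x + a * p) (y + b * p) (trans (swap x (a * p) z) (trans e (swap y z (b * p)))))
    where
    swap : ∀ y u v → y + u + v ≡ y + v + u
    swap = solve-∀

  multiple≈0 : ∀ a → a * p ≈ 0
  multiple≈0 a = by 0 a (+-identityʳ (a * p))

  p≈0 : p ≈ 0
  p≈0 = ≈-trans (≡⇒≈ (sym (*-identityˡ p))) (multiple≈0 1)

  modℕ-≈ : ∀ x → modℕ x p ≈ x
  modℕ-≈ x = by (divℕ x p) 0 (trans (sym (proj₂ (modℕ-spec x p 1≤p))) (sym (+-identityʳ x)))

  modℕ<p : ∀ x → modℕ x p < p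
  modℕ<p x = proj₁ (modℕ-spec x p 1≤p)

  ∣⇒≈0 : ∀ {z} → p ∣ z → z ≈ 0
  ∣⇒≈0 (divides q refl) = multiple≈0 q

  ≈0⇒∣ : ∀ {z} → z ≈ 0 → p ∣ z
  ≈0⇒∣ {z} (by a b e) = ∣m+n∣m⇒∣n {m = a * p} (divides b (trans (+-comm (a * p) z) e)) (n∣m*n a)

  ≈-difference : ∀ z y → z + y ≈ y → p ∣ z
  ≈-difference z y h = ≈0⇒∣ (+-cancelʳ-≈ y h)

  ≈∧≤⇒≡ : ∀ {x y} → y < p → x ≤ y → y ≈ x → y ≡ x
  ≈∧≤⇒≡ {x} {y} y<p x≤y h with y ∸ x in eqz
  ... | zero = ≤-antisym (m∸n≡0⇒m≤n eqz) x≤y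
  ... | suc z = contradiction (∣⇒≤ (≈-difference (suc z) x (subst (_≈ x) (sym (trans (cong (_+ x) (sym eqz)) (m∸n+n≡m x≤y))) h)))
                  (<⇒≱ (≤-trans (s≤s (≤-trans (≤-reflexive (sym eqz)) (m∸n≤m y x))) y<p))

  ≈⇒≡ : ∀ {x y} → x < p → y < p → x ≈ y → x ≡ y
  ≈⇒≡ {x} {y} x<p y<p h with ≤-total x y
  ... | inj₁ x≤y = sym (≈∧≤⇒≡ y<p x≤y (≈-sym h))
  ... | inj₂ y≤x = ≈∧≤⇒≡ x<p y≤x h

  modℕ-cong : ∀ {x y} → x ≈ y → modℕ x p ≡ modℕ y p
  modℕ-cong {x} {y} h = ≈⇒≡ (modℕ<p x) (modℕ<p y) (≈-trans (modℕ-≈ x) (≈-trans h (≈-sym (modℕ-≈ y))))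

  modℕ-small : ∀ {x y} → y < p → x ≈ y → modℕ x p ≡ y
  modℕ-small {x} y<p h = ≈⇒≡ (modℕ<p x) y<p (≈-trans (modℕ-≈ x) h)

  sumTo-cong-≈ : ∀ {f g} k → (∀ j → 1 ≤ j → j ≤ k → f j ≈ g j) → sumTo f k ≈ sumTo g k
  sumTo-cong-≈ zero h = ≡⇒≈ refl
  sumTo-cong-≈ (suc k) h = +-cong-≈ (h (suc k) (s≤s z≤n) ≤-refl) (sumTo-cong-≈ k (λ j 1≤j j≤k → h j 1≤j (m≤n⇒m≤1+n j≤k)))

  -- Both squares are congruent to -xy, because x(x + y) and y(x + y) vanish modulo p.
  opposite-square : ∀ {x y} → x + y ≈ 0 → x * x ≈ y * y
  opposite-square {x} {y} h = +-cancelʳ-≈ (x * y) (≈-trans (≡⇒≈ (sym (*-distribˡ-+ x x y)))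
    (≈-trans (*-congˡ-≈ x h) (≈-trans (≡⇒≈ (trans (*-zeroʳ x) (sym (*-zeroʳ y)))) (≈-trans (≈-sym (*-congˡ-≈ y h)) (≡⇒≈ (expand x y))))))
    where
    expand : ∀ x y → y * (x + y) ≡ y * y + x * y
    expand = solve-∀

  module _ (prime : Prime p) where

    prime-∤ : ∀ {x} → 1 ≤ x → x < p → ¬ p ∣ x
    prime-∤ {suc x} _ x<p p∣x = <⇒≱ x<p (∣⇒≤ p∣x)

    inverse : ∀ e → 1 ≤ e → e < p → Σ ℕ λ u → u * e ≈ 1
    inverse (suc e) _ e<p with coprime-Bézout (prime⇒coprime prime e<p)
    ... | Bézout.-+ x y eq₁ = y , by 0 x (trans (+-identityʳ _) (sym eq₁))
    -- Here y · e is congruent to -1, so the inverse is -y, written as (p - 1) · y.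
    ... | Bézout.+- x y eq₁ = (p ∸ 1) * y , +-cancelʳ-≈ Y (≈-trans (≡⇒≈ whole) (≈-trans (multiple≈0 Y) (≈-sym (∣⇒≈0 (divides x eq₁)))))
      where
      Y = y * suc e
      whole : (p ∸ 1) * y * suc e + Y ≡ Y * p
      whole = trans (cong (_+ Y) (*-assoc (p ∸ 1) y (suc e)))
        (trans (+-comm _ Y) (trans (cong (_* Y) (m+[n∸m]≡n 1≤p)) (*-comm p Y)))

    -- Take i = y / e. This guarantees that a table filled along the multiples of e has an entry for
    -- every nonzero residue.
    ratio : ∀ e y → 1 ≤ e → e < p → 1 ≤ y → y < p → Σ ℕ λ i → 1 ≤ i × i < p × modℕ (i * e) p ≡ y
    ratio e y 1≤e e<p 1≤y y<p with inverse e 1≤e e<p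
    ... | u , ue≈1 = i , 1≤i , modℕ<p (u * y) , modℕ-small y<p ie≈y
      where
      i = modℕ (u * y) p
      rearrange : ∀ u y e → e * (u * y) ≡ y * (u * e)
      rearrange = solve-∀
      ie≈y : i * e ≈ y
      ie≈y = ≈-trans (≡⇒≈ (*-comm i e)) (≈-trans (*-congˡ-≈ e (modℕ-≈ (u * y)))
        (≈-trans (≡⇒≈ (rearrange u y e)) (≈-trans (*-congˡ-≈ y ue≈1) (≡⇒≈ (*-identityʳ y)))))
      1≤i : 1 ≤ i
      1≤i with i in eqi
      ... | suc _ = s≤s z≤n
      ... | zero = contradiction (subst (1 ≤_) (sym (≈⇒≡ 1≤p y<p (subst (λ z → z * e ≈ y) eqi ie≈y))) 1≤y) λ ()

    -- The prime p divides (r - 1)(r + 1)e² and not e; for r ≥ 2 the bound r ≤ p/2 puts both r - 1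
    -- and r + 1 strictly between 0 and p.
    unit-square : ∀ e r → 1 ≤ e → e < p → 1 ≤ r → 2 * r ≤ p → (r * e) * (r * e) ≈ e * e → r ≡ 1
    unit-square e (suc r) 1≤e e<p _ 2r≤p h = factor (euclidsLemma (r * (2 + r)) (e * e) prime p∣product)
      where
      expand : ∀ r e → r * (2 + r) * (e * e) + e * e ≡ (suc r * e) * (suc r * e)
      expand = solve-∀
      p∣product : p ∣ r * (2 + r) * (e * e)
      p∣product = ≈-difference (r * (2 + r) * (e * e)) (e * e) (subst (_≈ e * e) (sym (expand r e)) h)
      p∤e : ¬ p ∣ e
      p∤e = prime-∤ 1≤e e<p
      small : ∀ r → 2 * suc r ≤ p → p ∣ r ⊎ p ∣ 2 + r → suc r ≡ 1
      small zero _ _ = refl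
      small (suc r) 2r≤p (inj₁ p∣r) = contradiction p∣r (prime-∤ (s≤s z≤n) (≤-trans (m≤m+n (2 + r) _) 2r≤p))
      small (suc r) 2r≤p (inj₂ p∣r) = contradiction p∣r (prime-∤ (s≤s z≤n)
        (≤-trans (≤-trans (≤-reflexive (+-comm 2 (2 + r))) (+-monoʳ-≤ (2 + r) (s≤s (s≤s z≤n)))) 2r≤p))
      factor : p ∣ r * (2 + r) ⊎ p ∣ e * e → suc r ≡ 1
      factor (inj₁ p∣) = small r 2r≤p (euclidsLemma r (2 + r) prime p∣)
      factor (inj₂ p∣) with euclidsLemma e e prime p∣
      ... | inj₁ p∣e = contradiction p∣e p∤e
      ... | inj₂ p∣e = contradiction p∣e p∤e

-- Items and the interval of reachable sums

module Combinatorics (p : ℕ) (1≤p : 1 ≤ p) where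

  open Congruence p 1≤p

  n : ℕ
  n = p ∸ 1

  1+n≡p : suc n ≡ p
  1+n≡p = m+[n∸m]≡n 1≤p

  ≤n⇒<p : ∀ {j} → j ≤ n → j < p
  ≤n⇒<p j≤n = ≤-trans (s≤s j≤n) (≤-reflexive 1+n≡p)

  <p⇒≤n : ∀ {j} → j < p → j ≤ n
  <p⇒≤n j<p = ≤-pred (≤-trans j<p (≤-reflexive (sym 1+n≡p)))

  -- `used j` is the number of the item that consumed element j. Items are numbered from 1, so 0
  -- marks an element still available.
  unused : (ℕ → ℕ) → ℕ
  unused used = sumTo (λ j → isZero (used j)) n

  mult : (ℕ → ℕ) → ℕ → ℕ
  mult r v = sumTo (λ j → eq (r j) v) n

  gain : (r lo hi : ℕ → ℕ) → ℕ → ℕ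
  gain r lo hi k = r (hi k) ∸ r (lo k)

  -- Item k offers a choice between the elements lo k and hi k, where the index 0 stands for
  -- "no element"; the sums reachable by such choices form an interval of length m.
  record Items (r : ℕ → ℕ) (m cnt base : ℕ) (used lo hi : ℕ → ℕ) : Set where
    field
      count  : cnt + unused used ≤ n
      total  : sumTo (gain r lo hi) n ≡ m
      base≈  : base ≈ sumTo (λ k → r (lo k)) n
      base<p : base < p
      order  : ∀ k → 1 ≤ k → k < p → r (lo k) ≤ r (hi k)
      reach  : ∀ k → 1 ≤ k → k < p → r (hi k) ≤ suc (r (lo k) + sumTo (gain r lo hi) (k ∸ 1))
      own-lo : ∀ k → 1 ≤ k → k < p → lo k ≡ 0 ⊎ used (lo k) ≡ k
      own-hi : ∀ k → 1 ≤ k → k < p → hi k ≡ 0 ⊎ used (hi k) ≡ k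
      lo<p   : ∀ k → 1 ≤ k → k < p → lo k < p
      hi<p   : ∀ k → 1 ≤ k → k < p → hi k < p
      lo-end : ∀ k → cnt < k → k < p → lo k ≡ 0
      hi-end : ∀ k → cnt < k → k < p → hi k ≡ 0

  unused-drop : ∀ used x v → 1 ≤ x → x < p → used x ≡ 0 → 1 ≤ v → suc (unused (update used x v)) ≡ unused used
  unused-drop used x (suc v) 1≤x x<p ux _ =
    trans (+-comm 1 _) (trans (cong (unused (update used x (suc v)) +_) (sym (cong isZero ux)))
      (trans (sumTo-change x n 1≤x (<p⇒≤n x<p) (λ j j≢x → cong isZero (update-other used x _ j≢x)))
        (trans (cong (λ z → unused used + isZero z) (update-same used x (suc v))) (+-identityʳ _))))

  unused-ignores-0 : ∀ used v → unused (update used 0 v) ≡ unused used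
  unused-ignores-0 used v = sumTo-cong n (λ j 1≤j _ → cong isZero (update-other used 0 v (λ e → <⇒≱ 1≤j (≤-reflexive e))))

  unused≥1 : ∀ used x → 1 ≤ x → x < p → used x ≡ 0 → 1 ≤ unused used
  unused≥1 used x 1≤x x<p ux = ≤-trans (≤-reflexive (cong isZero (sym ux))) (term≤sumTo (λ j → isZero (used j)) n x 1≤x (<p⇒≤n x<p))

  module _ {r : ℕ → ℕ} {m cnt base : ℕ} {used lo hi : ℕ → ℕ} (r0 : r 0 ≡ 0) (items : Items r m cnt base used lo hi)
           (l h : ℕ) (1≤h : 1 ≤ h) (h<p : h < p) (uh : used h ≡ 0) (l<p : l < p) (ul : l ≡ 0 ⊎ used l ≡ 0) (l≢h : l ≢ h)
           (l≤h : r l ≤ r h) (h≤l : r h ≤ suc (r l + m)) where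

    open Items items

    private
      c′ = suc cnt
      -- For a single element l is 0, and the inner update then writes only to cell 0, which no
      -- count inspects.
      used′ = update (update used l c′) h c′
      lo′ = update lo c′ l
      hi′ = update hi c′ h
      g = gain r lo hi
      g′ = gain r lo′ hi′

    cnt<n : cnt < n
    cnt<n = ≤-trans (≤-reflexive (+-comm 1 cnt)) (≤-trans (+-monoʳ-≤ cnt (unused≥1 used h 1≤h h<p uh)) count)

    private
      c′<p : c′ < p
      c′<p = ≤n⇒<p cnt<n

      lo-same : lo′ c′ ≡ l
      lo-same = update-same lo c′ l
      hi-same : hi′ c′ ≡ h
      hi-same = update-same hi c′ h
      lo-other : ∀ {k} → k ≢ c′ → lo′ k ≡ lo k
      lo-other k≢ = update-other lo c′ l k≢
      hi-other : ∀ {k} → k ≢ c′ → hi′ k ≡ hi k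
      hi-other k≢ = update-other hi c′ h k≢

      g-other : ∀ k → k ≢ c′ → g′ k ≡ g k
      g-other k k≢ = cong₂ (λ x y → r x ∸ r y) (hi-other k≢) (lo-other k≢)
      g-same : g′ c′ ≡ r h ∸ r l
      g-same = cong₂ (λ x y → r x ∸ r y) hi-same lo-same
      g-end : ∀ k → cnt < k → k ≤ n → g k ≡ 0
      g-end k cnt<k k≤n = trans (cong (λ x → r x ∸ r (lo k)) (hi-end k cnt<k (≤n⇒<p k≤n))) (trans (cong (_∸ r (lo k)) r0) (0∸n≡0 (r (lo k))))
      prefix : sumTo g cnt ≡ m
      prefix = trans (sym (sumTo-tail g cnt n (<⇒≤ cnt<n) g-end)) total
      prefix′ : ∀ k → k ≤ cnt → sumTo g′ k ≡ sumTo g k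
      prefix′ k k≤ = sumTo-cong k (λ j _ j≤k → g-other j (λ e → <-irrefl e (s≤s (≤-trans j≤k k≤))))

      used-h : used′ h ≡ c′
      used-h = update-same (update used l c′) h c′
      used-l : used′ l ≡ c′
      used-l = trans (update-other (update used l c′) h c′ l≢h) (update-same used l c′)
      used-old : ∀ x k → 1 ≤ k → x ≡ 0 ⊎ used x ≡ k → x ≡ 0 ⊎ used′ x ≡ k
      used-old x k 1≤k (inj₁ e) = inj₁ e
      used-old x k 1≤k (inj₂ e) with x ≟ 0
      ... | yes x≡0 = inj₁ x≡0
      ... | no x≢0 = inj₂ (trans (update-other (update used l c′) h c′ (busy uh)) (trans (update-other used l c′ x≢l) e))
        where
        busy : ∀ {y} → used y ≡ 0 → x ≢ y
        busy uy refl = contradiction (≤-trans 1≤k (≤-reflexive (trans (sym e) uy))) λ ()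
        apart : l ≡ 0 ⊎ used l ≡ 0 → x ≢ l
        apart (inj₁ l≡0) x≡l = x≢0 (trans x≡l l≡0)
        apart (inj₂ ul0) x≡l = busy ul0 x≡l
        x≢l : x ≢ l
        x≢l = apart ul

    unused-single : l ≡ 0 → suc (unused used′) ≡ unused used
    unused-single refl = trans (unused-drop (update used 0 c′) h c′ 1≤h h<p
        (trans (update-other used 0 c′ (λ e → <⇒≱ 1≤h (≤-reflexive e))) uh) (s≤s z≤n)) (unused-ignores-0 used c′)

    unused-pair : 1 ≤ l → used l ≡ 0 → 2 + unused used′ ≡ unused used
    unused-pair 1≤l ul0 = trans (cong suc (unused-drop (update used l c′) h c′ 1≤h h<p
        (trans (update-other used l c′ (λ e → l≢h (sym e))) uh) (s≤s z≤n))) (unused-drop used l c′ 1≤l l<p ul0 (s≤s z≤n))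

    private
      unused-less : suc (unused used′) ≤ unused used
      unused-less = drops ul
        where
        drops : l ≡ 0 ⊎ used l ≡ 0 → suc (unused used′) ≤ unused used
        drops (inj₁ l≡0) = ≤-reflexive (unused-single l≡0)
        drops (inj₂ ul0) with 1 ≤? l
        ... | yes 1≤l = ≤-trans (n≤1+n _) (≤-reflexive (unused-pair 1≤l ul0))
        ... | no 1≰l = ≤-reflexive (unused-single (n<1⇒n≡0 (≰⇒> 1≰l)))

    -- The new choice translates the old interval of sums by r l or by r h. Since r h ≤ r l + m + 1,
    -- the two translates overlap or are adjacent, so their union is again an interval.
    extend : Items r (m + (r h ∸ r l)) c′ (modℕ (base + r l) p) used′ lo′ hi′
    extend = record
      { count = ≤-trans (≤-reflexive (sym (+-suc cnt _))) (≤-trans (+-monoʳ-≤ cnt unused-less) count)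
      ; total = trans (sym (+-identityʳ _)) (trans (cong (sumTo g′ n +_) (sym (g-end c′ ≤-refl cnt<n)))
                 (trans (sumTo-change c′ n (s≤s z≤n) cnt<n g-other) (cong₂ _+_ total g-same)))
      ; base≈ = ≈-trans (modℕ-≈ (base + r l)) (≈-trans (+-cong-≈ base≈ (≡⇒≈ refl)) (≡⇒≈ bases))
      ; base<p = modℕ<p (base + r l)
      ; order = λ k 1≤k k<p → byCase k (λ k → r (lo′ k) ≤ r (hi′ k))
          (subst₂ (λ x y → r x ≤ r y) (sym lo-same) (sym hi-same) l≤h)
          (λ k≢ → subst₂ (λ x y → r x ≤ r y) (sym (lo-other k≢)) (sym (hi-other k≢)) (order k 1≤k k<p))
      ; reach = reach′
      ; own-lo = λ k 1≤k k<p → byCase k (λ k → lo′ k ≡ 0 ⊎ used′ (lo′ k) ≡ k)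
          (inj₂ (trans (cong used′ lo-same) used-l))
          (λ k≢ → subst (λ x → x ≡ 0 ⊎ used′ x ≡ k) (sym (lo-other k≢)) (used-old (lo k) k 1≤k (own-lo k 1≤k k<p)))
      ; own-hi = λ k 1≤k k<p → byCase k (λ k → hi′ k ≡ 0 ⊎ used′ (hi′ k) ≡ k)
          (inj₂ (trans (cong used′ hi-same) used-h))
          (λ k≢ → subst (λ x → x ≡ 0 ⊎ used′ x ≡ k) (sym (hi-other k≢)) (used-old (hi k) k 1≤k (own-hi k 1≤k k<p)))
      ; lo<p = λ k 1≤k k<p → byCase k (λ k → lo′ k < p) (subst (_< p) (sym lo-same) l<p)
          (λ k≢ → subst (_< p) (sym (lo-other k≢)) (lo<p k 1≤k k<p))
      ; hi<p = λ k 1≤k k<p → byCase k (λ k → hi′ k < p) (subst (_< p) (sym hi-same) h<p)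
          (λ k≢ → subst (_< p) (sym (hi-other k≢)) (hi<p k 1≤k k<p))
      ; lo-end = λ k c<k k<p → trans (lo-other (λ e → <-irrefl (sym e) c<k)) (lo-end k (<⇒≤ c<k) k<p)
      ; hi-end = λ k c<k k<p → trans (hi-other (λ e → <-irrefl (sym e) c<k)) (hi-end k (<⇒≤ c<k) k<p)
      }
      where
      byCase : ∀ k (Q : ℕ → Set) → Q c′ → (k ≢ c′ → Q k) → Q k
      byCase k Q yes′ no′ with k ≟ c′
      ... | yes refl = yes′
      ... | no k≢ = no′ k≢
      bases : sumTo (λ k → r (lo k)) n + r l ≡ sumTo (λ k → r (lo′ k)) n
      bases = trans (cong (sumTo (λ k → r (lo k)) n +_) (cong r (sym lo-same)))
        (trans (sym (sumTo-change c′ n (s≤s z≤n) cnt<n (λ j j≢ → cong r (lo-other j≢))))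
          (trans (cong (sumTo (λ k → r (lo′ k)) n +_) (trans (cong r (lo-end c′ ≤-refl c′<p)) r0)) (+-identityʳ _)))
      reach′ : ∀ k → 1 ≤ k → k < p → r (hi′ k) ≤ suc (r (lo′ k) + sumTo g′ (k ∸ 1))
      reach′ k 1≤k k<p with <-cmp k c′
      ... | tri≈ _ refl _ = subst₂ (λ x y → r x ≤ suc (r y + sumTo g′ cnt)) (sym hi-same) (sym lo-same)
              (subst (λ z → r h ≤ suc (r l + z)) (sym (trans (prefix′ cnt ≤-refl) prefix)) h≤l)
      ... | tri< k<c k≢ _ = subst₂ (λ x y → r x ≤ suc (r y + sumTo g′ (k ∸ 1))) (sym (hi-other k≢)) (sym (lo-other k≢))
              (subst (λ z → r (hi k) ≤ suc (r (lo k) + z)) (sym (prefix′ (k ∸ 1) (≤-trans (m∸n≤m k 1) (≤-pred k<c)))) (reach k 1≤k k<p))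
      ... | tri> _ k≢ c<k = ≤-trans (≤-reflexive (trans (cong r (trans (hi-other k≢) (hi-end k (<⇒≤ c<k) k<p))) r0)) z≤n

  -- There are p - 1 items, each gaining at most p. Crude, but enough for m to fit into a word.
  gain-bound : ∀ {r m cnt base used lo hi} → (∀ j → j < p → r j ≤ p) → Items r m cnt base used lo hi → m ≤ p * p
  gain-bound {r} {lo = lo} {hi} r≤p items = subst (_≤ p * p) total
    (≤-trans (sumTo-mono n (λ k 1≤k k≤n → ≤-trans (m∸n≤m _ (r (lo k))) (r≤p _ (hi<p k 1≤k (≤n⇒<p k≤n)))))
      (≤-trans (≤-reflexive (sumTo-const p n)) (*-monoˡ-≤ p (m∸n≤m p 1))))
    where open Items items

  -- Undoing the items from the last to the first, keeping ρ within what the remaining gains reach.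
  record Selection (r lo hi used : ℕ → ℕ) (C q ρ : ℕ) (sel : ℕ → ℕ) : Set where
    field
      within : ρ ≤ sumTo (gain r lo hi) q
      split  : sumTo (λ j → sel j * r j) n + (ρ + sumTo (λ k → r (lo k)) q) ≡ C
      sel≤1  : ∀ j → j < p → sel j ≤ 1
      fresh  : ∀ j → j < p → 1 ≤ sel j → j ≡ 0 ⊎ q < used j

  pick-sum : ∀ {r sel : ℕ → ℕ} x → r 0 ≡ 0 → x < p → x ≡ 0 ⊎ sel x ≡ 0 →
    sumTo (λ j → update sel x 1 j * r j) n ≡ r x + sumTo (λ j → sel j * r j) n
  pick-sum {r} {sel} x r0 x<p free with x ≟ 0
  ... | yes refl = trans (sumTo-cong n (λ j 1≤j _ → cong (_* r j) (update-other sel 0 1 (λ e → <⇒≱ 1≤j (≤-reflexive e)))))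
                     (cong (_+ sumTo (λ j → sel j * r j) n) (sym r0))
  pick-sum {r} {sel} x r0 x<p (inj₁ x≡0) | no x≢0 = contradiction x≡0 x≢0
  pick-sum {r} {sel} x r0 x<p (inj₂ sx) | no x≢0 =
    trans (sym (+-identityʳ _)) (trans (cong (λ z → sumTo (λ j → update sel x 1 j * r j) n + z * r x) (sym sx))
      (trans (sumTo-change x n (n≢0⇒n>0 x≢0) (<p⇒≤n x<p) (λ j j≢x → cong (_* r j) (update-other sel x 1 j≢x)))
        (trans (cong (λ z → sumTo (λ j → sel j * r j) n + z * r x) (update-same sel x 1))
          (trans (cong (sumTo (λ j → sel j * r j) n +_) (+-identityʳ (r x))) (+-comm _ (r x))))))

  -- Common to both choices: x is the element taken from item q + 1, and the balance equation says
  -- that replacing the default `lo` by x is paid for by the remainder. No element is taken twice,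
  -- because x belongs to this item and earlier picks to later ones.
  pick : ∀ {r lo hi used : ℕ → ℕ} {C q ρ ρ′ sel} x → r 0 ≡ 0 → Selection r lo hi used C (suc q) ρ sel →
    x < p → x ≡ 0 ⊎ used x ≡ suc q → ρ′ ≤ sumTo (gain r lo hi) q → r x + ρ′ ≡ ρ + r (lo (suc q)) →
    Selection r lo hi used C q ρ′ (update sel x 1)
  pick {r} {lo} {hi} {used} {C} {q} {ρ} {ρ′} {sel} x r0 s x<p own ρ′≤ bal = record
    { within = ρ′≤
    ; split = trans (cong (_+ (ρ′ + L)) (pick-sum x r0 x<p free))
        (trans (arrange₁ (r x) Σsel ρ′ L) (trans (cong (λ z → Σsel + (z + L)) bal) (trans (arrange₂ Σsel ρ (r (lo (suc q))) L) split)))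
    ; sel≤1 = λ j j<p → byCase j (λ z → z ≤ 1) ≤-refl (λ _ → sel≤1 j j<p)
    ; fresh = λ j j<p → fresh′ j j<p }
    where
    open Selection s
    L = sumTo (λ k → r (lo k)) q
    Σsel = sumTo (λ j → sel j * r j) n
    arrange₁ : ∀ a b c d → a + b + (c + d) ≡ b + (a + c + d)
    arrange₁ = solve-∀
    arrange₂ : ∀ a b c d → a + (b + c + d) ≡ a + (b + (c + d))
    arrange₂ = solve-∀
    freeFor : x ≡ 0 ⊎ used x ≡ suc q → ∀ v → sel x ≡ v → x ≡ 0 ⊎ sel x ≡ 0
    freeFor (inj₁ x≡0) _ _ = inj₁ x≡0
    freeFor (inj₂ ux) zero sx = inj₂ sx
    freeFor (inj₂ ux) (suc v) sx with fresh x x<p (≤-trans (s≤s z≤n) (≤-reflexive (sym sx)))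
    ... | inj₁ x≡0 = inj₁ x≡0
    ... | inj₂ q<u = contradiction ux (λ e → <-irrefl (sym e) q<u)
    free : x ≡ 0 ⊎ sel x ≡ 0
    free = freeFor own (sel x) refl
    byCase : ∀ j (Q : ℕ → Set) → Q 1 → (j ≢ x → Q (sel j)) → Q (update sel x 1 j)
    byCase j Q a b with j ≟ x
    ... | yes refl = subst Q (sym (update-same sel x 1)) a
    ... | no j≢x = subst Q (sym (update-other sel x 1 j≢x)) (b j≢x)
    fresh′ : ∀ j → j < p → 1 ≤ update sel x 1 j → j ≡ 0 ⊎ q < used j
    fresh′ j j<p with j ≟ x
    ... | no j≢x = λ sj → weaken (fresh j j<p (subst (1 ≤_) (update-other sel x 1 j≢x) sj))
      where
      weaken : j ≡ 0 ⊎ suc q < used j → j ≡ 0 ⊎ q < used j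
      weaken (inj₁ e) = inj₁ e
      weaken (inj₂ l) = inj₂ (<⇒≤ l)
    ... | yes refl = λ _ → owned own
      where
      owned : x ≡ 0 ⊎ used x ≡ suc q → x ≡ 0 ⊎ q < used x
      owned (inj₁ e) = inj₁ e
      owned (inj₂ u) = inj₂ (≤-reflexive (sym u))

  module _ {r m cnt base used lo hi} (r0 : r 0 ≡ 0) (items : Items r m cnt base used lo hi) where
    open Items items

    -- `reach` bounds the gain of an item by one more than all earlier gains together, so a
    -- remainder below this gain is within what the earlier items can supply.
    pick-lo : ∀ {C q ρ sel} → suc q < p → Selection r lo hi used C (suc q) ρ sel → ρ < gain r lo hi (suc q) →
      Selection r lo hi used C q ρ (update sel (lo (suc q)) 1)
    pick-lo {C} {q} {ρ} q<p s ρ<g = pick (lo (suc q)) r0 s (lo<p _ (s≤s z≤n) q<p) (own-lo _ (s≤s z≤n) q<p)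
      (≤-pred (≤-trans ρ<g (≤-trans (∸-monoˡ-≤ (r (lo (suc q))) (reach (suc q) (s≤s z≤n) q<p))
        (≤-trans (≤-reflexive (cong (_∸ r (lo (suc q))) (sym (+-suc (r (lo (suc q))) _)))) (≤-reflexive (m+n∸m≡n (r (lo (suc q))) _))))))
      (+-comm (r (lo (suc q))) ρ)

    pick-hi : ∀ {C q ρ sel} → suc q < p → Selection r lo hi used C (suc q) ρ sel → gain r lo hi (suc q) ≤ ρ →
      Selection r lo hi used C q (ρ ∸ gain r lo hi (suc q)) (update sel (hi (suc q)) 1)
    pick-hi {C} {q} {ρ} q<p s g≤ρ = pick (hi (suc q)) r0 s (hi<p _ (s≤s z≤n) q<p) (own-hi _ (s≤s z≤n) q<p)
      (≤-trans (∸-monoˡ-≤ G (Selection.within s)) (≤-reflexive (m+n∸m≡n G _)))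
      (trans (cong (_+ (ρ ∸ G)) (sym (trans (+-comm G (r (lo (suc q)))) (m+[n∸m]≡n (order (suc q) (s≤s z≤n) q<p)))))
        (trans (arrange G (r (lo (suc q))) (ρ ∸ G)) (cong (_+ r (lo (suc q))) (m+[n∸m]≡n g≤ρ))))
      where
      G = gain r lo hi (suc q)
      arrange : ∀ a b c → a + b + c ≡ a + c + b
      arrange = solve-∀

-- The stacks of pending elements

-- A linked list in an array: y is met when following `next` from a, with 0 as terminator.
data InList (next : ℕ → ℕ) : ℕ → ℕ → Set where
  here  : ∀ {a} → 1 ≤ a → InList next a a
  there : ∀ {a y} → 1 ≤ a → InList next (next a) y → InList next a y

nonempty : ∀ {next a y} → InList next a y → 1 ≤ a
nonempty (here 1≤a) = 1≤a
nonempty (there 1≤a _) = 1≤a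

InList-update : ∀ {next a y} k v → (∀ z → InList next a z → z ≢ k) → InList next a y → InList (update next k v) a y
InList-update k v h (here 1≤a) = here 1≤a
InList-update {next} {a} {y} k v h (there 1≤a i) =
  there 1≤a (subst (λ z → InList (update next k v) z y) (sym (update-other next k v (h a (here 1≤a))))
    (InList-update k v (λ z q → h z (there 1≤a q)) i))

InList-downdate : ∀ {next a y} k v → (∀ z → InList next a z → z ≢ k) → InList (update next k v) a y → InList next a y
InList-downdate k v h (here 1≤a) = here 1≤a
InList-downdate {next} {a} {y} k v h (there 1≤a i) =
  there 1≤a (subst (λ z → InList next z y) eq′
    (InList-downdate k v (λ z q → h z (there 1≤a (subst (λ w → InList next w z) eq′ q))) i))
  where
  eq′ : update next k v a ≡ next a
  eq′ = update-other next k v (h a (here 1≤a))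

divℕ-spec : ∀ x w → 1 ≤ w → divℕ x w * w ≤ x × x < divℕ x w * w + w
divℕ-spec x (suc w) 1≤w = ≤-trans (m≤n+m _ (modℕ x (suc w))) (≤-reflexive (sym (proj₂ spec))) ,
  ≤-trans (≤-reflexive (cong suc (proj₂ spec))) (≤-trans (+-monoˡ-≤ (divℕ x (suc w) * suc w) (proj₁ spec)) (≤-reflexive (+-comm (suc w) _)))
  where spec = modℕ-spec x (suc w) 1≤w

divℕ≥1 : ∀ x w → 1 ≤ w → w ≤ x → 1 ≤ divℕ x w
divℕ≥1 x w 1≤w w≤x with divℕ x w | divℕ-spec x w 1≤w
... | zero | _ , x<w = contradiction x<w (≤⇒≯ w≤x)
... | suc _ | _ = s≤s z≤n

module Stacking (p : ℕ) (1≤p : 1 ≤ p) (r : ℕ → ℕ) (W : ℕ) where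

  bucket : ℕ → ℕ
  bucket j = divℕ (r j) W

  record Stacks (k : ℕ) (used pend next : ℕ → ℕ) : Set where
    field
      pending : ∀ j → 1 ≤ j → j < k → used j ≡ 0 → InList next (pend (bucket j)) j
      member  : ∀ b y → 1 ≤ b → b < p → InList next (pend b) y →
                1 ≤ y × y < k × used y ≡ 0 × bucket y ≡ b × r y ≡ r (pend b)

  InList≤ : ∀ {next a y} → (∀ z → 1 ≤ z → z < p → next z < z) → a < p → InList next a y → y ≤ a
  InList≤ h a<p (here _) = ≤-refl
  InList≤ {next} {a} h a<p (there 1≤a i) = ≤-trans (InList≤ h (<-trans (h a 1≤a a<p) a<p) i) (<⇒≤ (h a 1≤a a<p))

  <suc-cases : ∀ {j k} → j < suc k → j ≢ k → j < k
  <suc-cases j<k j≢k = ≤∧≢⇒< (≤-pred j<k) j≢k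

  mark-Stacks : ∀ {k used used′ pend next} → Stacks k used pend next → 1 ≤ used′ k →
    (∀ j → 1 ≤ j → j ≢ k → used′ j ≡ used j) → Stacks (suc k) used′ pend next
  mark-Stacks {k} {used} {used′} s uk h = record
    { pending = λ j 1≤j j<k uj → let j≢k = busy j uj in
        pending j 1≤j (<suc-cases j<k j≢k) (trans (sym (h j 1≤j j≢k)) uj)
    ; member = λ b y 1≤b b<p i → let 1≤y , y<k , uy , by , ry = member b y 1≤b b<p i in
        1≤y , m<n⇒m<1+n y<k , trans (h y 1≤y (λ e → <-irrefl e y<k)) uy , by , ry }
    where
    open Stacks s
    busy : ∀ j → used′ j ≡ 0 → j ≢ k
    busy j uj refl = contradiction (≤-trans uk (≤-reflexive uj)) λ ()

  push-Stacks : ∀ {k used pend next} → Stacks k used pend next → 1 ≤ k → used k ≡ 0 →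
    (∀ j → 1 ≤ j → j < k → used j ≡ 0 → 1 ≤ bucket j × bucket j < p) → 1 ≤ bucket k → bucket k < p →
    pend (bucket k) ≡ 0 ⊎ r (pend (bucket k)) ≡ r k →
    Stacks (suc k) used (update pend (bucket k) k) (update next k (pend (bucket k)))
  push-Stacks {k} {used} {pend} {next} s 1≤k uk range 1≤b b<p top = record { pending = pending′ ; member = member′ }
    where
    open Stacks s
    b = bucket k
    next′ = update next k (pend b)
    pend′ = update pend b k
    avoid : ∀ b′ → 1 ≤ b′ → b′ < p → ∀ z → InList next (pend b′) z → z ≢ k
    avoid b′ 1≤b′ b′<p z i e = <-irrefl e (proj₁ (proj₂ (member b′ z 1≤b′ b′<p i)))
    onTop : ∀ {y} → InList next (pend b) y → InList next′ k y
    onTop i = there 1≤k (subst (λ z → InList next′ z _) (sym (update-same next k (pend b))) (InList-update k (pend b) (avoid b 1≤b b<p) i))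
    pending′ : ∀ j → 1 ≤ j → j < suc k → used j ≡ 0 → InList next′ (pend′ (bucket j)) j
    pending′ j 1≤j j<k uj with j ≟ k
    ... | yes refl = subst (λ z → InList next′ z k) (sym (update-same pend b k)) (here 1≤k)
    ... | no j≢k with bucket j ≟ b | pending j 1≤j (<suc-cases j<k j≢k) uj | range j 1≤j (<suc-cases j<k j≢k) uj
    ... | yes e | i | _ = subst (λ z → InList next′ z j) (sym (trans (cong pend′ e) (update-same pend b k)))
                      (onTop (subst (λ z → InList next (pend z) j) e i))
    ... | no ne | i | 1≤bj , bj<p = subst (λ z → InList next′ z j) (sym (update-other pend b k ne)) (InList-update k (pend b) (avoid _ 1≤bj bj<p) i)
    member′ : ∀ b′ y → 1 ≤ b′ → b′ < p → InList next′ (pend′ b′) y →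
      1 ≤ y × y < suc k × used y ≡ 0 × bucket y ≡ b′ × r y ≡ r (pend′ b′)
    member′ b′ y 1≤b′ b′<p i with b′ ≟ b
    ... | no ne with member b′ y 1≤b′ b′<p (InList-downdate k (pend b) (avoid b′ 1≤b′ b′<p) (subst (λ z → InList next′ z y) (update-other pend b k ne) i))
    ... | 1≤y , y<k , uy , by , ry = 1≤y , m<n⇒m<1+n y<k , uy , by , trans ry (cong r (sym (update-other pend b k ne)))
    member′ b′ y 1≤b′ b′<p i | yes refl = fromTop (subst (λ z → InList next′ z y) (update-same pend b k) i)
      where
      fromTop : InList next′ k y → 1 ≤ y × y < suc k × used y ≡ 0 × bucket y ≡ b × r y ≡ r (pend′ b)
      fromTop (here _) = 1≤k , ≤-refl , uk , refl , cong r (sym (update-same pend b k))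
      fromTop (there _ i′) = below top (member b y 1≤b b<p old)
        where
        old : InList next (pend b) y
        old = InList-downdate k (pend b) (avoid b 1≤b b<p) (subst (λ z → InList next′ z y) (update-same next k (pend b)) i′)
        below : pend b ≡ 0 ⊎ r (pend b) ≡ r k → 1 ≤ y × y < k × used y ≡ 0 × bucket y ≡ b × r y ≡ r (pend b) →
          1 ≤ y × y < suc k × used y ≡ 0 × bucket y ≡ b × r y ≡ r (pend′ b)
        below (inj₁ e) _ = contradiction (≤-trans (nonempty old) (≤-reflexive e)) λ ()
        below (inj₂ e) (1≤y , y<k , uy , by , ry) = 1≤y , m<n⇒m<1+n y<k , uy , by , trans ry (trans e (cong r (sym (update-same pend b k))))

  pop-Stacks : ∀ {k used used′ pend next} → Stacks k used pend next → (∀ z → 1 ≤ z → z < p → next z < z) → k < p →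
    1 ≤ bucket k → bucket k < p → 1 ≤ pend (bucket k) → 1 ≤ used′ k → 1 ≤ used′ (pend (bucket k)) →
    (∀ j → 1 ≤ j → j ≢ k → j ≢ pend (bucket k) → used′ j ≡ used j) →
    Stacks (suc k) used′ (update pend (bucket k) (next (pend (bucket k)))) next
  pop-Stacks {k} {used} {used′} {pend} {next} s next< k<p 1≤b b<p 1≤a uk ua h = record { pending = pending′ ; member = member′ }
    where
    open Stacks s
    b = bucket k
    a = pend b
    pend′ = update pend b (next a)
    top = member b a 1≤b b<p (here 1≤a)
    a<k = proj₁ (proj₂ top)
    bucket-a : bucket a ≡ b
    bucket-a = proj₁ (proj₂ (proj₂ (proj₂ top)))
    free : ∀ {x} → 1 ≤ used′ x → ∀ {j} → used′ j ≡ 0 → j ≢ x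
    free ux uj refl = contradiction (≤-trans ux (≤-reflexive uj)) λ ()
    pending′ : ∀ j → 1 ≤ j → j < suc k → used′ j ≡ 0 → InList next (pend′ (bucket j)) j
    pending′ j 1≤j j<k uj with bucket j ≟ b | pending j 1≤j (<suc-cases j<k (free uk uj)) (trans (sym (h j 1≤j (free uk uj) (free ua uj))) uj)
    ... | no ne | i = subst (λ z → InList next z j) (sym (update-other pend b (next a) ne)) i
    ... | yes e | i = subst (λ z → InList next z j) (sym (trans (cong pend′ e) (update-same pend b (next a))))
                        (tail (subst (λ z → InList next (pend z) j) e i) (free ua uj))
      where
      tail : ∀ {y} → InList next a y → y ≢ a → InList next (next a) y
      tail (here _) y≢a = contradiction refl y≢a
      tail (there _ i) _ = i
    member′ : ∀ b′ y → 1 ≤ b′ → b′ < p → InList next (pend′ b′) y →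
      1 ≤ y × y < suc k × used′ y ≡ 0 × bucket y ≡ b′ × r y ≡ r (pend′ b′)
    member′ b′ y 1≤b′ b′<p i with b′ ≟ b
    ... | no ne with member b′ y 1≤b′ b′<p (subst (λ z → InList next z y) (update-other pend b (next a) ne) i)
    ... | 1≤y , y<k , uy , by , ry =
      1≤y , m<n⇒m<1+n y<k , trans (h y 1≤y (λ e → <-irrefl e y<k) (λ e → ne (trans (sym by) (trans (cong bucket e) bucket-a)))) uy ,
      by , trans ry (cong r (sym (update-other pend b (next a) ne)))
    member′ b′ y 1≤b′ b′<p i | yes refl = rest (subst (λ z → InList next z y) (update-same pend b (next a)) i)
      where
      rest : InList next (next a) y → 1 ≤ y × y < suc k × used′ y ≡ 0 × bucket y ≡ b × r y ≡ r (pend′ b)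
      rest i′ with member b y 1≤b b<p (there 1≤a i′) | member b (next a) 1≤b b<p (there 1≤a (here (nonempty i′)))
      ... | 1≤y , y<k , uy , by , ry | _ , _ , _ , _ , rn =
        1≤y , m<n⇒m<1+n y<k , trans (h y 1≤y (λ e → <-irrefl e y<k) y≢a) uy , by ,
        trans ry (trans (sym rn) (cong r (sym (update-same pend b (next a)))))
        where
        a<p = <-trans a<k k<p
        -- Links strictly decrease, so the popped top cannot occur again further down its own stack.
        y≢a : y ≢ a
        y≢a e = <-irrefl e (≤-<-trans (InList≤ next< (<-trans (next< a 1≤a a<p) a<p) i′) (next< a 1≤a a<p))

-- One pass over the elements

module Passing
  (p : ℕ) (1≤p : 1 ≤ p) (r : ℕ → ℕ) (r0 : r 0 ≡ 0)
  (r-half : ∀ j → 1 ≤ j → j < p → 2 * r j ≤ p)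
  (c low mₛ : ℕ) (J : ℕ → ℕ → Set)
  (J-single : ∀ {m u g} → low ≤ g → J m (suc u) → J (m + g) u)
  (J-pair : ∀ {m u g x} → 4 * m < c * (p ∸ 1) → 2 + m ≤ x → 2 * x ≤ p → 1 ≤ g → J m (2 + u) → J (m + g) u)
  where

  open Combinatorics p 1≤p
  open Stacking p 1≤p r (suc mₛ)

  -- The bucket width stays 1 + `mₛ`, fixed by the length at the start of the pass, while m grows.
  -- Once m passes the threshold the stacks are abandoned, whence the alternative in `stacks`. The
  -- bound `lower` is inherited; `seen` is the better one that this pass establishes. `next<` covers
  -- all cells, so links left by earlier passes do no harm.
  record PassInv (k m cnt base : ℕ) (used lo hi pend next : ℕ → ℕ) : Set where
    field
      items     : Items r m cnt base used lo hi
      potential : J m (unused used)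
      grown     : mₛ ≤ m
      seen      : ∀ j → 1 ≤ j → j < k → used j ≡ 0 → 2 + mₛ ≤ r j
      lower     : ∀ j → 1 ≤ j → j < p → used j ≡ 0 → low ≤ r j
      next<     : ∀ z → 1 ≤ z → z < p → next z < z
      stacks    : c * n ≤ 4 * m ⊎ Stacks k used pend next

  r<p : ∀ j → 1 ≤ j → j < p → r j < p
  r<p j 1≤j j<p with r j in e
  ... | zero = 1≤p
  ... | suc x = ≤-trans (s≤s (≤-trans (m≤n+m (suc x) x) (≤-reflexive (cong (x +_) (sym (+-identityʳ (suc x)))))))
                  (subst (λ z → 2 * z ≤ p) e (r-half j 1≤j j<p))

  bucket-range : ∀ j → 1 ≤ j → j < p → 2 + mₛ ≤ r j → 1 ≤ bucket j × bucket j < p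
  bucket-range j 1≤j j<p big =
    divℕ≥1 (r j) (suc mₛ) (s≤s z≤n) (≤-trans (n≤1+n _) big) , ≤-<-trans (divℕ≤ (r j) (suc mₛ)) (r<p j 1≤j j<p)

  module _ {k m cnt base : ℕ} {used lo hi pend next : ℕ → ℕ} (1≤k : 1 ≤ k) (k<p : k < p)
           (state : PassInv k m cnt base used lo hi pend next) where
    open PassInv state

    private
      seen-suc : (used k ≡ 0 → 2 + mₛ ≤ r k) → ∀ j → 1 ≤ j → j < suc k → used j ≡ 0 → 2 + mₛ ≤ r j
      seen-suc h j 1≤j j<k uj with j ≟ k
      ... | yes refl = h uj
      ... | no j≢k = seen j 1≤j (<suc-cases j<k j≢k) uj

    skip-used : 1 ≤ used k → PassInv (suc k) m cnt base used lo hi pend next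
    skip-used uk = record
      { items = items ; potential = potential ; grown = grown
      ; seen = seen-suc (λ e → contradiction (≤-trans uk (≤-reflexive e)) λ ())
      ; lower = lower ; next< = next<
      ; stacks = map₂ (λ s → mark-Stacks s uk (λ _ _ _ → refl)) stacks }

    skip-late : 2 + m ≤ r k → c * n ≤ 4 * m → PassInv (suc k) m cnt base used lo hi pend next
    skip-late big late = record
      { items = items ; potential = potential ; grown = grown
      ; seen = seen-suc (λ _ → ≤-trans (s≤s (s≤s grown)) big)
      ; lower = lower ; next< = next< ; stacks = inj₁ late }

    push : used k ≡ 0 → 2 + m ≤ r k → pend (bucket k) ≡ 0 ⊎ (1 ≤ pend (bucket k) × r (pend (bucket k)) ≡ r k) →
      4 * m < c * n →
      PassInv (suc k) m cnt base used lo hi (update pend (bucket k) k) (update next k (pend (bucket k)))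
    push uk big top early = record
      { items = items ; potential = potential ; grown = grown
      ; seen = seen-suc (λ _ → big′)
      ; lower = lower
      ; next< = next<′ stacks
      ; stacks = inj₂ (pushed stacks) }
      where
      big′ : 2 + mₛ ≤ r k
      big′ = ≤-trans (s≤s (s≤s grown)) big
      range = bucket-range k 1≤k k<p big′
      top′ : ∀ {A : Set} → pend (bucket k) ≡ 0 ⊎ (A × r (pend (bucket k)) ≡ r k) → pend (bucket k) ≡ 0 ⊎ r (pend (bucket k)) ≡ r k
      top′ (inj₁ e) = inj₁ e
      top′ (inj₂ (_ , e)) = inj₂ e
      pushed : c * n ≤ 4 * m ⊎ Stacks k used pend next → Stacks (suc k) used (update pend (bucket k) k) (update next k (pend (bucket k)))
      pushed (inj₁ late) = contradiction late (<⇒≱ early)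
      pushed (inj₂ s) = push-Stacks s 1≤k uk (λ j 1≤j j<k uj → bucket-range j 1≤j (<-trans j<k k<p) (seen j 1≤j j<k uj))
        (proj₁ range) (proj₂ range) (top′ top)
      top<k : c * n ≤ 4 * m ⊎ Stacks k used pend next → pend (bucket k) ≡ 0 ⊎ (1 ≤ pend (bucket k) × r (pend (bucket k)) ≡ r k) → pend (bucket k) < k
      top<k _ (inj₁ e) = ≤-trans (s≤s (≤-reflexive e)) 1≤k
      top<k (inj₁ late) _ = contradiction late (<⇒≱ early)
      top<k (inj₂ s) (inj₂ (1≤a , _)) = proj₁ (proj₂ (Stacks.member s _ _ (proj₁ range) (proj₂ range) (here 1≤a)))
      next<′ : c * n ≤ 4 * m ⊎ Stacks k used pend next → ∀ z → 1 ≤ z → z < p → update next k (pend (bucket k)) z < z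
      next<′ st z 1≤z z<p with z ≟ k
      ... | yes refl = subst (_< k) (sym (update-same next k _)) (top<k st top)
      ... | no z≢k = subst (_< z) (sym (update-other next k _ z≢k)) (next< z 1≤z z<p)

    module _ (l h : ℕ) where
      private
        c′ = suc cnt
        used′ = update (update used l c′) h c′

      used′-h : used′ h ≡ c′
      used′-h = update-same (update used l c′) h c′

      used′-l : l ≢ h → used′ l ≡ c′
      used′-l l≢h = trans (update-other (update used l c′) h c′ l≢h) (update-same used l c′)

      used′-other : ∀ {j} → j ≢ l → j ≢ h → used′ j ≡ used j
      used′-other j≢l j≢h = trans (update-other (update used l c′) h c′ j≢h) (update-other used l c′ j≢l)

      still-unused : l ≢ h → ∀ {j} → used′ j ≡ 0 → used j ≡ 0 × j ≢ l × j ≢ h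
      still-unused l≢h {j} uj = trans (sym (used′-other j≢l j≢h)) uj , j≢l , j≢h
        where
        j≢l : j ≢ l
        j≢l refl = contradiction (trans (sym (used′-l l≢h)) uj) λ ()
        j≢h : j ≢ h
        j≢h refl = contradiction (trans (sym used′-h) uj) λ ()

    late-mono : ∀ {A B : Set} g → (A → B) → c * n ≤ 4 * m ⊎ A → c * n ≤ 4 * (m + g) ⊎ B
    late-mono g f (inj₁ late) = inj₁ (≤-trans late (*-monoʳ-≤ 4 (m≤m+n m g)))
    late-mono g f (inj₂ a) = inj₂ (f a)

    take : used k ≡ 0 → r k < 2 + m →
      PassInv (suc k) (m + (r k ∸ r 0)) (suc cnt) (modℕ (base + r 0) p)
        (update (update used 0 (suc cnt)) k (suc cnt)) (update lo (suc cnt) 0) (update hi (suc cnt) k) pend next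
    take uk small = record
      { items = extend r0 items 0 k 1≤k k<p uk 1≤p (inj₁ refl) 0≢k r0≤ h≤l
      ; potential = J-single (subst (low ≤_) (sym (cong (r k ∸_) r0)) (lower k 1≤k k<p uk))
          (subst (J m) (sym (unused-single r0 items 0 k 1≤k k<p uk 1≤p (inj₁ refl) 0≢k r0≤ h≤l refl)) potential)
      ; grown = ≤-trans grown (m≤m+n m _)
      ; seen = λ j 1≤j j<k uj → let uj′ , _ , j≢k = still-unused 0 k 0≢k uj in seen j 1≤j (<suc-cases j<k j≢k) uj′
      ; lower = λ j 1≤j j<p uj → lower j 1≤j j<p (proj₁ (still-unused 0 k 0≢k uj))
      ; next< = next<
      ; stacks = late-mono _ (λ s → mark-Stacks s (subst (1 ≤_) (sym (used′-h 0 k)) (s≤s z≤n))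
          (λ j 1≤j j≢k → used′-other 0 k (λ e → <⇒≱ 1≤j (≤-reflexive e)) j≢k)) stacks }
      where
      0≢k : 0 ≢ k
      0≢k e = <⇒≱ 1≤k (≤-reflexive (sym e))
      r0≤ : r 0 ≤ r k
      r0≤ = subst (_≤ r k) (sym r0) z≤n
      h≤l : r k ≤ suc (r 0 + m)
      h≤l = subst (λ z → r k ≤ suc (z + m)) (sym r0) (≤-pred small)

    pair : ∀ l h → used k ≡ 0 → 2 + m ≤ r k → 4 * m < c * n → 1 ≤ pend (bucket k) → r l < r h →
      (l ≡ pend (bucket k) × h ≡ k) ⊎ (l ≡ k × h ≡ pend (bucket k)) →
      PassInv (suc k) (m + (r h ∸ r l)) (suc cnt) (modℕ (base + r l) p)
        (update (update used l (suc cnt)) h (suc cnt)) (update lo (suc cnt) l) (update hi (suc cnt) h)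
        (update pend (bucket k) (next (pend (bucket k)))) next
    pair l h uk big early 1≤a l<h which = fromStacks stacks
      where
      a = pend (bucket k)
      big′ : 2 + mₛ ≤ r k
      big′ = ≤-trans (s≤s (s≤s grown)) big
      range = bucket-range k 1≤k k<p big′
      l≢h : l ≢ h
      l≢h e = <-irrefl (cong r e) l<h
      fromStacks : c * n ≤ 4 * m ⊎ Stacks k used pend next → _
      fromStacks (inj₁ late) = contradiction late (<⇒≱ early)
      fromStacks (inj₂ s) = record
        { items = extend r0 items l h 1≤h h<p uh l<p (inj₂ ul) l≢h (<⇒≤ l<h) h≤l
        ; potential = J-pair early big (r-half k 1≤k k<p) (m<n⇒0<n∸m l<h)
            (subst (J m) (sym (unused-pair r0 items l h 1≤h h<p uh l<p (inj₂ ul) l≢h (<⇒≤ l<h) h≤l 1≤l ul)) potential)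
        ; grown = ≤-trans grown (m≤m+n m _)
        ; seen = λ j 1≤j j<k uj → let uj′ , j≢l , j≢h = still-unused l h l≢h uj in seen j 1≤j (<suc-cases j<k (not-k j≢l j≢h)) uj′
        ; lower = λ j 1≤j j<p uj → lower j 1≤j j<p (proj₁ (still-unused l h l≢h uj))
        ; next< = next<
        ; stacks = inj₂ (pop-Stacks s next< k<p (proj₁ range) (proj₂ range) 1≤a
            (busy k (λ { (inj₁ (_ , e)) → inj₂ (sym e) ; (inj₂ (e , _)) → inj₁ (sym e) }))
            (busy a (λ { (inj₁ (e , _)) → inj₁ (sym e) ; (inj₂ (_ , e)) → inj₂ (sym e) }))
            (λ j _ j≢k j≢a → used′-other l h (others which j≢k j≢a .proj₁) (others which j≢k j≢a .proj₂))) }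
        where
        top = Stacks.member s _ a (proj₁ range) (proj₂ range) (here 1≤a)
        a<k = proj₁ (proj₂ top)
        ua = proj₁ (proj₂ (proj₂ top))
        ba : bucket a ≡ bucket k
        ba = proj₁ (proj₂ (proj₂ (proj₂ top)))
        both : ∀ {Q : ℕ → Set} → Q a → Q k → Q l × Q h
        both {Q} qa qk = choose which
          where
          choose : (l ≡ a × h ≡ k) ⊎ (l ≡ k × h ≡ a) → Q l × Q h
          choose (inj₁ (e , e′)) = subst Q (sym e) qa , subst Q (sym e′) qk
          choose (inj₂ (e , e′)) = subst Q (sym e) qk , subst Q (sym e′) qa
        1≤l = proj₁ (both {1 ≤_} 1≤a 1≤k)
        1≤h = proj₂ (both {1 ≤_} 1≤a 1≤k)
        l<p = proj₁ (both {_< p} (<-trans a<k k<p) k<p)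
        h<p = proj₂ (both {_< p} (<-trans a<k k<p) k<p)
        ul = proj₁ (both {λ x → used x ≡ 0} ua uk)
        uh = proj₂ (both {λ x → used x ≡ 0} ua uk)
        bl = proj₁ (both {λ x → bucket x ≡ bucket k} ba refl)
        bh = proj₂ (both {λ x → bucket x ≡ bucket k} ba refl)
        -- Two elements of one bucket of width 1 + mₛ differ by at most mₛ.
        h≤l : r h ≤ suc (r l + m)
        h≤l = ≤-trans (<⇒≤ (proj₂ (divℕ-spec (r h) (suc mₛ) (s≤s z≤n))))
          (≤-trans (≤-reflexive (cong (λ z → z * suc mₛ + suc mₛ) (trans bh (sym bl))))
            (≤-trans (+-mono-≤ (proj₁ (divℕ-spec (r l) (suc mₛ) (s≤s z≤n))) (s≤s grown)) (≤-reflexive (+-suc (r l) m))))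
        not-k : ∀ {j} → j ≢ l → j ≢ h → j ≢ k
        not-k j≢l j≢h refl = excluded which
          where
          excluded : (l ≡ a × h ≡ k) ⊎ (l ≡ k × h ≡ a) → ⊥
          excluded (inj₁ (_ , e)) = j≢h (sym e)
          excluded (inj₂ (e , _)) = j≢l (sym e)
        busy : ∀ x → ((l ≡ a × h ≡ k) ⊎ (l ≡ k × h ≡ a) → x ≡ l ⊎ x ≡ h) → 1 ≤ update (update used l (suc cnt)) h (suc cnt) x
        busy x f with f which
        ... | inj₁ refl = subst (1 ≤_) (sym (used′-l l h l≢h)) (s≤s z≤n)
        ... | inj₂ refl = subst (1 ≤_) (sym (used′-h l h)) (s≤s z≤n)
        others : ∀ {j} → (l ≡ a × h ≡ k) ⊎ (l ≡ k × h ≡ a) → j ≢ k → j ≢ a → j ≢ l × j ≢ h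
        others (inj₁ (refl , refl)) j≢k j≢a = j≢a , j≢k
        others (inj₂ (refl , refl)) j≢k j≢a = j≢k , j≢a

  bucket-count : ∀ {m cnt base used lo hi pend next} B M → PassInv p m cnt base used lo hi pend next →
    (∀ j → 1 ≤ j → j < p → used j ≡ 0 → bucket j ≤ B) → (∀ v → mult r v ≤ M) →
    c * n ≤ 4 * m ⊎ unused used ≤ B * M
  bucket-count {used = used} {pend = pend} {next} B M state bounded mult≤ = map₂ count stacks
    where
    open PassInv state
    count : Stacks p used pend next → unused used ≤ B * M
    count s = ≤-trans (sumTo-mono n covered)
      (≤-trans (≤-reflexive (sumTo-swap (λ j b → eq (r j) (r (pend b))) n B))
        (≤-trans (sumTo-mono B (λ b _ _ → mult≤ (r (pend b)))) (≤-reflexive (sumTo-const M B))))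
      where
      covered : ∀ j → 1 ≤ j → j ≤ n → isZero (used j) ≤ sumTo (λ b → eq (r j) (r (pend b))) B
      covered j 1≤j j≤n with used j in uj
      ... | suc _ = z≤n
      ... | zero = ≤-trans (≤-reflexive (sym (trans (cong (λ z → eq (r j) z) (sym same)) (eq-refl (r j)))))
                     (term≤sumTo (λ b → eq (r j) (r (pend b))) B (bucket j) (proj₁ range) (bounded j 1≤j (≤n⇒<p j≤n) uj))
        where
        range = bucket-range j 1≤j (≤n⇒<p j≤n) (seen j 1≤j (≤n⇒<p j≤n) uj)
        same : r j ≡ r (pend (bucket j))
        same = proj₂ (proj₂ (proj₂ (proj₂ (Stacks.member s _ j (proj₁ range) (proj₂ range) (Stacks.pending s j 1≤j (≤n⇒<p j≤n) uj)))))

-- How the interval grows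

-- n is the number of elements, u the number of unused ones, m the length of the interval and
-- m₀ its length after the first pass.  "spread" says that each used element has contributed at
-- least 1/2 on average; the other two say that the unused elements, whose lower bounds are
-- known, suffice to reach length n.
module Potential (n : ℕ) where

  module _ (m₀ : ℕ) where

    Spread Supply₂ Supply₄ : ℕ → ℕ → Set
    Spread m u = n + m₀ ≤ 2 * m + u
    Supply₂ m u = n ≤ m + 2 * u
    Supply₄ m u = 4 * n ≤ 4 * m + (8 + n) * u

    spread-single : ∀ {m u g} → 1 ≤ g → Spread m (suc u) → Spread (m + g) u
    spread-single {m} {u} {g} 1≤g h = ≤-trans h (≤-trans (≤-reflexive (arrange m u))
      (≤-trans (+-monoˡ-≤ u (+-monoʳ-≤ (2 * m) (≤-trans 1≤g (m≤m+n g (1 * g))))) (≤-reflexive (cong (_+ u) (sym (*-distribˡ-+ 2 m g))))))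
      where
      arrange : ∀ m u → 2 * m + suc u ≡ 2 * m + 1 + u
      arrange = solve-∀

    spread-pair : ∀ {m u g} → 1 ≤ g → Spread m (2 + u) → Spread (m + g) u
    spread-pair {m} {u} {g} 1≤g h = ≤-trans h (≤-trans (≤-reflexive (arrange m u))
      (≤-trans (+-monoˡ-≤ u (+-monoʳ-≤ (2 * m) (*-monoʳ-≤ 2 1≤g))) (≤-reflexive (cong (_+ u) (sym (*-distribˡ-+ 2 m g))))))
      where
      arrange : ∀ m u → 2 * m + (2 + u) ≡ 2 * m + 2 + u
      arrange = solve-∀

    supply₂-single : ∀ {m u g} → 2 ≤ g → Supply₂ m (suc u) → Supply₂ (m + g) u
    supply₂-single {m} {u} {g} 2≤g h = ≤-trans h (≤-trans (≤-reflexive (arrange m u)) (+-monoˡ-≤ (2 * u) (+-monoʳ-≤ m 2≤g)))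
      where
      arrange : ∀ m u → m + 2 * suc u ≡ m + 2 + 2 * u
      arrange = solve-∀

    -- A pair may gain only 1 for two elements, so the supply does not sustain itself. It is derived
    -- afresh from the spread: while 4m < n, enough elements remain that n ≤ 1 + 2u even after the
    -- pair.
    supply₂-pair : ∀ {m u g} → 1 ≤ m₀ → 4 * m < 1 * n → 1 ≤ g → Spread m (2 + u) → Supply₂ (m + g) u
    supply₂-pair {m} {u} {g} 1≤m₀ early 1≤g h = ≤-trans n≤ (+-monoˡ-≤ (2 * u) (≤-trans 1≤g (m≤n+m g m)))
      where
      left′ : ∀ n m₀ m → 2 * (n + m₀) + suc (4 * m) ≡ (n + 2 * m₀ + 1) + (n + 4 * m)
      left′ = solve-∀
      right′ : ∀ n m u → 2 * (2 * m + (2 + u)) + 1 * n ≡ (4 + 2 * u) + (n + 4 * m)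
      right′ = solve-∀
      cancelled : n + 2 * m₀ + 1 ≤ 4 + 2 * u
      cancelled = +-cancelʳ-≤ (n + 4 * m) _ _ (subst₂ _≤_ (left′ n m₀ m) (right′ n m u) (+-mono-≤ (*-monoʳ-≤ 2 h) early))
      n≤ : n ≤ 1 + 2 * u
      n≤ = +-cancelʳ-≤ 3 n (1 + 2 * u) (≤-trans (≤-trans (+-monoʳ-≤ n (+-monoˡ-≤ 1 (*-monoʳ-≤ 2 1≤m₀))) (≤-reflexive (sym (+-assoc n (2 * m₀) 1))))
             (≤-trans cancelled (≤-reflexive (shift u))))
        where
        shift : ∀ u → 4 + 2 * u ≡ 1 + 2 * u + 3
        shift = solve-∀

    supply₄-single : ∀ {m u g} → 8 + n ≤ 4 * g → Supply₄ m (suc u) → Supply₄ (m + g) u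
    supply₄-single {m} {u} {g} big h = ≤-trans h (≤-trans (≤-reflexive (arrange m u n))
      (≤-trans (+-monoˡ-≤ ((8 + n) * u) (+-monoʳ-≤ (4 * m) big)) (≤-reflexive (cong (_+ (8 + n) * u) (sym (*-distribˡ-+ 4 m g))))))
      where
      arrange : ∀ m u n → 4 * m + (8 + n) * suc u ≡ 4 * m + (8 + n) + (8 + n) * u
      arrange = solve-∀

    -- As long as m + 2 ≤ n/2, the spread leaves u ≥ 3. Three elements, each worth at least n/4, and
    -- the quarter already reached make up n.
    supply₄-pair : ∀ {m u g} → 1 ≤ m₀ → 2 * (2 + m) ≤ n → n ≤ 4 * m → Spread m (2 + u) → Supply₄ (m + g) u
    supply₄-pair {m} {u} {g} 1≤m₀ half quarter h =
      ≤-trans (+-mono-≤ {n} {4 * (m + g)} (≤-trans quarter (*-monoʳ-≤ 4 (m≤m+n m g)))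
          (≤-trans (≤-trans (≤-reflexive (*-comm 3 n)) (*-monoˡ-≤ 3 (m≤n+m n 8))) (*-monoʳ-≤ (8 + n) 3≤u)))
        ≤-refl
      where
      left′ : ∀ m m₀ → 2 * (2 + m) + m₀ ≡ (2 + m₀) + (2 + 2 * m)
      left′ = solve-∀
      right′ : ∀ m u → 2 * m + (2 + u) ≡ u + (2 + 2 * m)
      right′ = solve-∀
      3≤u : 3 ≤ u
      3≤u = ≤-trans (+-monoʳ-≤ 2 1≤m₀) (+-cancelʳ-≤ (2 + 2 * m) _ _
        (subst₂ _≤_ (left′ m m₀) (right′ m u) (≤-trans (+-monoˡ-≤ m₀ half) h)))

    supply₂⇒₄ : ∀ {m u} → Supply₂ m u → Supply₄ m u
    supply₂⇒₄ {m} {u} h = ≤-trans (*-monoʳ-≤ 4 h) (≤-trans (≤-reflexive (arrange m u)) (+-monoʳ-≤ (4 * m) (*-monoˡ-≤ u (m≤m+n 8 n))))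
      where
      arrange : ∀ m u → 4 * (m + 2 * u) ≡ 4 * m + 8 * u
      arrange = solve-∀

    quarter-reached : ∀ {m u} B → Spread m u → u ≤ B * m₀ → 2 * (B * suc m₀) ≤ suc n → n ≤ 4 * m
    quarter-reached {m} {zero} B h _ _ = ≤-trans (m≤m+n n m₀) (≤-trans h (≤-trans (≤-reflexive (+-identityʳ _)) (*-monoˡ-≤ m (m≤m+n 2 2))))
    quarter-reached {m} {u@(suc _)} (suc B) h u≤ room = ≤-trans (≤-trans (m≤m+n n (2 * m₀)) (m≤m+n _ 1))
      (+-cancelʳ-≤ (n + 2 * u) _ _ (subst₂ _≤_ (left′ n m₀ u) (right′ n m u) (+-mono-≤ (*-monoʳ-≤ 2 h) few)))
      where
      left′ : ∀ n m₀ u → 2 * (n + m₀) + (2 * u + 1) ≡ (n + 2 * m₀ + 1) + (n + 2 * u)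
      left′ = solve-∀
      right′ : ∀ n m u → 2 * (2 * m + u) + n ≡ 4 * m + (n + 2 * u)
      right′ = solve-∀
      split : ∀ B m₀ → 2 * (suc B * suc m₀) ≡ 2 * (suc B * m₀) + 2 * suc B
      split = solve-∀
      few : 2 * u + 1 ≤ n
      few = +-cancelʳ-≤ 1 _ _ (≤-trans (≤-reflexive (+-assoc (2 * u) 1 1))
        (≤-trans (+-mono-≤ (*-monoʳ-≤ 2 u≤) (*-monoʳ-≤ 2 (s≤s (z≤n {B}))))
          (≤-trans (≤-reflexive (sym (split B m₀))) (≤-trans room (≤-reflexive (+-comm 1 n))))))

    -- With one bucket at most m₀ elements are left over, and they cancel against the extra m₀ that
    -- the spread carries for this purpose.
    half-reached : ∀ {m u} → Spread m u → 2 * n ≤ 4 * m ⊎ u ≤ 1 * m₀ → n ≤ 2 * m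
    half-reached {m} h (inj₁ late) = *-cancelˡ-≤ 2 (≤-trans late (≤-reflexive (*-assoc 2 2 m)))
    half-reached {m} {u} h (inj₂ few) = +-cancelʳ-≤ m₀ _ _ (≤-trans h (+-monoʳ-≤ (2 * m) (≤-trans few (≤-reflexive (+-identityʳ m₀)))))

    all-reached : ∀ {m u} → u ≡ 0 → Supply₄ m u → n ≤ m
    all-reached {m} refl h = *-cancelˡ-≤ 4 (≤-trans h (≤-reflexive (trans (cong (4 * m +_) (*-zeroʳ (8 + n))) (+-identityʳ _))))

-- The algorithm

-- Variables: 0 = m, 1 = number of items, 2 = Σ r (lo k), 3 = bucket width, 4 = target, 5 = scale e,
-- 6 = largest multiplicity, 10 = ρ; 7, 8, 9, 11 are scratch.
-- Arrays: 2 = d, 3 = multiplicities of squares, 4 = division by e, 5 = r, 6 = sign flags,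
-- 7 = used, 8 = lo, 9 = hi, 10 = stack tops, 12 = stack links, 13 = selection, 14 = output.

copyBody setupBody countBody tableBody scaleBody : Body
copyBody = when lit K ≺ jj then (2 [ jj ]≔ rd 0 jj) else (2 [ jj ]≔ rd 1 (jj ⊖ lit 1))
setupBody =
  (when lit K ≺ pp then (4 ≔ rd 0 pp) else (4 ≔ rd 1 (pp ⊖ lit 1))) ⨾
  -- The default scale, the first residue, makes e nonzero modulo p from the start of the counting
  -- loop.
  0 ≔ lit 0 ⨾ 1 ≔ lit 0 ⨾ 2 ≔ lit 0 ⨾ 6 ≔ lit 0 ⨾ 5 ≔ rd 2 (lit 1)
countBody =
  7 ≔ (rd 2 jj ⊗ rd 2 jj) ⊛ pp ⨾
  3 [ var 7 ]≔ lit 1 ⊕ rd 3 (var 7) ⨾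
  (when var 6 ≺ rd 3 (var 7) then (6 ≔ rd 3 (var 7) ⨾ 5 ≔ rd 2 jj) else skip)
tableBody = 7 ≔ (var 7 ⊕ var 5) ⊛ pp ⨾ 4 [ var 7 ]≔ jj
-- Flipping an element of large residue x to p − x and moving the target accordingly.
scaleBody =
  7 ≔ rd 4 (rd 2 jj) ⨾
  (when pp ≺ var 7 ⊕ var 7
   then (5 [ jj ]≔ pp ⊖ var 7 ⨾ 6 [ jj ]≔ lit 1 ⨾ 4 ≔ (var 4 ⊕ rd 5 jj) ⊛ pp)
   else (5 [ jj ]≔ var 7))

itemBody pushBody popBody : Body
itemBody =
  1 ≔ lit 1 ⊕ var 1 ⨾ 8 [ var 1 ]≔ var 7 ⨾ 9 [ var 1 ]≔ var 11 ⨾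
  0 ≔ var 0 ⊕ (rd 5 (var 11) ⊖ rd 5 (var 7)) ⨾ 2 ≔ (var 2 ⊕ rd 5 (var 7)) ⊛ pp ⨾
  7 [ var 7 ]≔ var 1 ⨾ 7 [ var 11 ]≔ var 1
pushBody = 12 [ jj ]≔ var 8 ⨾ 10 [ var 9 ]≔ jj
popBody = 10 [ var 9 ]≔ rd 12 (var 8)

resolveBody : Body
resolveBody =
  when lit 0 ≺ var 8
  then (when rd 5 (var 8) ≺ rd 5 jj
        then (7 ≔ var 8 ⨾ 11 ≔ jj ⨾ itemBody ⨾ popBody)
        else (when rd 5 jj ≺ rd 5 (var 8)
              then (7 ≔ jj ⨾ 11 ≔ var 8 ⨾ itemBody ⨾ popBody)
              else pushBody))
  else pushBody

passBody : ℕ → Body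
passBody c =
  when rd 7 jj ≺ lit 1
  then (when rd 5 jj ≺ lit 2 ⊕ var 0
        then (7 ≔ lit 0 ⨾ 11 ≔ jj ⨾ itemBody)
        else (when lit 4 ⊗ var 0 ≺ lit c ⊗ (pp ⊖ lit 1)
              then (9 ≔ rd 5 jj ⊘ var 3 ⨾ 8 ≔ rd 10 (var 9) ⨾ resolveBody)
              else skip))
  else skip

pass : ℕ → Cmd
pass c = blk (3 ≔ lit 1 ⊕ var 0) ▸ loop (10 [ jj ]≔ lit 0) ▸ loop (passBody c)

selectBody outputBody : Body
selectBody =
  9 ≔ pp ⊖ jj ⨾ 7 ≔ rd 8 (var 9) ⨾ 11 ≔ rd 9 (var 9) ⨾
  (when var 10 ≺ rd 5 (var 11) ⊖ rd 5 (var 7)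
   then (13 [ var 7 ]≔ lit 1)
   else (13 [ var 11 ]≔ lit 1 ⨾ 10 ≔ var 10 ⊖ (rd 5 (var 11) ⊖ rd 5 (var 7))))
outputBody =
  -- For a flipped element choosing and leaving out change roles, so the output bit is the exclusive
  -- or of selection and flag.
  7 ≔ (rd 13 jj ⊕ rd 6 jj) ⊛ lit 2 ⨾ 14 [ pp ⊕ jj ]≔ var 7 ⨾
  (when lit K ≺ pp ⊕ jj then (0 [ pp ⊕ jj ]≔ var 7) else skip)

normalise algorithm : Cmd
normalise =
  loop copyBody ▸ blk setupBody ▸ loop countBody ▸
  blk (7 ≔ lit 0) ▸ loop tableBody ▸ blk (4 ≔ rd 4 (var 4)) ▸ loop scaleBody
algorithm =
  -- The parameter c allows pairing while m < c(p - 1)/4. The first `pass 0` absorbs the ones, the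
  -- second leaves only elements above p/4 so that each later single gain is large, and the last
  -- absorbs everything that remains.
  normalise ▸ pass 0 ▸ pass 1 ▸ pass 0 ▸ pass 2 ▸ pass 0 ▸
  blk (10 ≔ (var 4 ⊕ (pp ⊖ var 2)) ⊛ pp) ▸ loop selectBody ▸ loop outputBody

update-∀ : ∀ {f : ℕ → ℕ} (Q : ℕ → ℕ → Set) k v → (∀ j → 1 ≤ j → j < k → Q j (f j)) → Q k v →
  ∀ j → 1 ≤ j → j < suc k → Q j (update f k v j)
update-∀ {f} Q k v h hk j 1≤j j<k with j ≟ k
... | yes refl = subst (Q j) (sym (update-same f k v)) hk
... | no j≢k = subst (Q j) (sym (update-other f k v j≢k)) (h j 1≤j (≤∧≢⇒< (≤-pred j<k) j≢k))

-- The instance after scaling by the most frequent element and choosing signs: 1 has the largest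
-- multiplicity and every value is at most p/2.
record Instance (p : ℕ) (1≤p : 1 ≤ p) (d : ℕ → ℕ) (τ : ℕ) (r f : ℕ → ℕ) (t : ℕ) : Set where
  open Congruence p 1≤p
  open Combinatorics p 1≤p
  field
    r0     : r 0 ≡ 0
    r-pos  : ∀ j → 1 ≤ j → j < p → 1 ≤ r j
    r-half : ∀ j → 1 ≤ j → j < p → 2 * r j ≤ p
    f≤1    : ∀ j → 1 ≤ j → j < p → f j ≤ 1
    t<p    : t < p
    mult≤  : ∀ v → mult r v ≤ mult r 1
    link   : ∀ (sel : ℕ → ℕ) → (∀ j → 1 ≤ j → j < p → sel j ≤ 1) → sumTo (λ j → sel j * r j) n ≈ t →
             modℕ (sumTo (chosen d (λ j → modℕ (sel j + f j) 2)) n) p ≡ τ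

-- Scaling and sign changes modulo p

module Scaling (p : ℕ) (prime : Prime p) (1≤p : 1 ≤ p) where
  open Congruence p 1≤p
  open Combinatorics p 1≤p

  sq : (ℕ → ℕ) → ℕ → ℕ
  sq D j = modℕ (D j * D j) p

  Signed : ℕ → ℕ → ℕ → ℕ → Set
  Signed e d r f = 1 ≤ r × 2 * r ≤ p × ((f ≡ 0 × r * e ≈ d) ⊎ (f ≡ 1 × d + r * e ≈ 0))

  module _ {e : ℕ} (1≤e : 1 ≤ e) (e<p : e < p) where

    signed-square : ∀ {d r f} → Signed e d r f → d * d ≈ (r * e) * (r * e)
    signed-square (_ , _ , inj₁ (_ , h)) = *-cong-≈ (≈-sym h) (≈-sym h)
    signed-square {d} {r} (_ , _ , inj₂ (_ , h)) = opposite-square {d} {r * e} h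

    -- Elements with r = v all have the square (ve)², which is at most as frequent as e²; and by
    -- `unit-square` the elements with square e² are among those with r = 1.
    mult-max : ∀ {D r f : ℕ → ℕ} → (∀ j → 1 ≤ j → j < p → Signed e (D j) (r j) (f j)) →
      (∀ y → y < p → mult (sq D) y ≤ mult (sq D) (modℕ (e * e) p)) → ∀ v → mult r v ≤ mult r 1
    mult-max {D} {r} signed most v = ≤-trans
      (sumTo-mono n (λ j 1≤j j≤n → eq-mono (r j) v (sq D j) w (λ { refl → modℕ-cong (signed-square (signed j 1≤j (≤n⇒<p j≤n))) })))
      (≤-trans (most w (modℕ<p _))
        (sumTo-mono n (λ j 1≤j j≤n → eq-mono (sq D j) (modℕ (e * e) p) (r j) 1 (λ same → unit j (signed j 1≤j (≤n⇒<p j≤n)) same))))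
      where
      w = modℕ ((v * e) * (v * e)) p
      unit : ∀ j {f} → Signed e (D j) (r j) f → sq D j ≡ modℕ (e * e) p → r j ≡ 1
      unit j s@(1≤r , 2r≤p , _) same = unit-square prime e (r j) 1≤e e<p 1≤r 2r≤p
        (≈-trans (≈-sym (signed-square s)) (≈-trans (≈-sym (modℕ-≈ _)) (≈-trans (≡⇒≈ same) (modℕ-≈ _))))

    -- Multiplied by e, the scaled sum equals the original chosen sum plus e · Σ f r, term by term:
    -- a flipped element that is selected contributes er on both sides, and one not selected
    -- contributes d + er, which is 0. The target was shifted by the same amount.
    unsign : ∀ {D r f : ℕ → ℕ} {t τ} → (∀ j → 1 ≤ j → j < p → Signed e (D j) (r j) (f j)) → τ < p →
      e * t ≈ τ + e * sumTo (λ j → f j * r j) n →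
      ∀ (sel : ℕ → ℕ) → (∀ j → 1 ≤ j → j < p → sel j ≤ 1) → sumTo (λ j → sel j * r j) n ≈ t →
      modℕ (sumTo (chosen D (λ j → modℕ (sel j + f j) 2)) n) p ≡ τ
    unsign {D} {r} {f} {t} {τ} signed τ<p target sel sel≤1 sum≈ = modℕ-small τ<p (+-cancelʳ-≈ E (≈-trans (≈-trans (≡⇒≈ regroup)
        (sumTo-cong-≈ n (λ j 1≤j j≤n → pointwise (sel j) (sel≤1 j 1≤j (≤n⇒<p j≤n)) (signed j 1≤j (≤n⇒<p j≤n)))))
        (≈-trans (≡⇒≈ (sym (sumTo-*ˡ e (λ j → sel j * r j) n))) (≈-trans (*-congˡ-≈ e sum≈) target))))
      where
      E = e * sumTo (λ j → f j * r j) n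
      value : ℕ → ℕ → ℕ
      value v d = if v ≡ᵇ 0 then 0 else d
      regroup : sumTo (chosen D (λ j → modℕ (sel j + f j) 2)) n + E ≡ sumTo (λ j → value (modℕ (sel j + f j) 2) (D j) + e * (f j * r j)) n
      regroup = trans (cong (sumTo (chosen D (λ j → modℕ (sel j + f j) 2)) n +_) (sumTo-*ˡ e (λ j → f j * r j) n))
        (sym (sumTo-+ (chosen D (λ j → modℕ (sel j + f j) 2)) (λ j → e * (f j * r j)) n))
      pointwise : ∀ s {d r f} → s ≤ 1 → Signed e d r f → value (modℕ (s + f) 2) d + e * (f * r) ≈ e * (s * r)
      pointwise zero {r = r} _ (_ , _ , inj₁ (refl , h)) = ≡⇒≈ refl
      pointwise (suc zero) {d} {r} _ (_ , _ , inj₁ (refl , h)) = ≈-trans (≡⇒≈ (trans (cong (d +_) (*-zeroʳ e)) (+-identityʳ d)))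
        (≈-trans (≈-sym h) (≡⇒≈ (trans (*-comm r e) (cong (e *_) (sym (+-identityʳ r))))))
      pointwise zero {d} {r} _ (_ , _ , inj₂ (refl , h)) =
        ≈-trans (≡⇒≈ (cong (d +_) (trans (cong (e *_) (+-identityʳ r)) (*-comm e r)))) (≈-trans h (≡⇒≈ (sym (*-zeroʳ e))))
      pointwise (suc zero) _ (_ , _ , inj₂ (refl , h)) = ≡⇒≈ refl
      pointwise (suc (suc _)) (s≤s ())

-- Verification of the normalisation

module Verification
  (p N : ℕ) (2≤p : 2 ≤ p) (N≡32p : N ≡ 32 * p) (P : Program) (S W : ℕ)
  (S-bound : I * N ≤ S) (W-bound : ∀ {n} → n ≤ (N * N) ^ 16 → n < W)
  (prime : Prime p) (d : ℕ → ℕ) (τ : ℕ)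
  (hd : ∀ j → 1 ≤ j → j < p → 1 ≤ d j × d j < p) (τ<p : τ < p) where

  open Semantics p N
  open Soundness p N 2≤p N≡32p P S W S-bound W-bound using (N≤V; p≤N; 1≤N)
  open Blocks p N 2≤p N≡32p P S W S-bound W-bound
  open Execution p N 2≤p N≡32p P S W S-bound W-bound using (1≤p; p<N; 2p≤N)
  open Congruence p 1≤p
  open Combinatorics p 1≤p
  open Scaling p prime 1≤p

  Fresh : (ℕ → ℕ) → Set
  Fresh f = ∀ x → x < N → f x ≡ 0

  Blank : Arrs → Set
  Blank ar = Fresh (ar 7) × Fresh (ar 8) × Fresh (ar 9) × Fresh (ar 12) × Fresh (ar 13)

  ≤p⇒≤V : ∀ {x} → x ≤ p → x ≤ V
  ≤p⇒≤V x≤p = ≤-trans x≤p (≤-trans p≤N N≤V)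

  <p⇒<N : ∀ {x} → x < p → x < N
  <p⇒<N x<p = <-trans x<p p<N

  im : ℕ → ℕ
  im = initMem p d τ

  im≤V : ∀ a → im a ≤ V
  im≤V a = ≤p⇒≤V (initMem-bound p d τ 1≤p (λ j 1≤j j<p → proj₂ (hd j 1≤j j<p)) τ<p a)

  record Copying (k : ℕ) (vr : Vars) (ar : Arrs) : Set where
    field
      saved : ∀ i → i < K → ar 1 i ≡ im (suc i)
      kept  : ∀ x → K < x → x < N → ar 0 x ≡ im x
      D     : ∀ j → 1 ≤ j → j < k → ar 2 j ≡ d j
      z3    : Fresh (ar 3)
      z4    : Fresh (ar 4)
      z5    : Fresh (ar 5)
      z6    : Fresh (ar 6)
      blank : Blank ar

  k∸1<K : ∀ {k} → 1 ≤ k → k ≤ K → k ∸ 1 < K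
  k∸1<K {suc k} _ k≤K = k≤K

  suc-∸1 : ∀ {k} → 1 ≤ k → suc (k ∸ 1) ≡ k
  suc-∸1 {suc k} _ = refl

  copied : Triple (Init p N d τ) (loop copyBody) (Copying p)
  copied = conseq-rule begin′ (λ c → c) (loop-rule Copying copyBody body)
    where
    begin′ : ∀ {vr ar} → Init p N d τ vr ar → Copying 1 vr ar
    begin′ {vr} {ar} (s , l , z) = record { saved = s ; kept = l ; D = λ { j 1≤j j<1 → contradiction (≤-pred j<1) (<⇒≱ 1≤j) }
            ; z3 = fresh 3 (s≤s (s≤s z≤n)) (m≤m+n 4 11) ; z4 = fresh 4 (s≤s (s≤s z≤n)) (m≤m+n 5 10)
            ; z5 = fresh 5 (s≤s (s≤s z≤n)) (m≤m+n 6 9) ; z6 = fresh 6 (s≤s (s≤s z≤n)) (m≤m+n 7 8)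
            ; blank = fresh 7 (s≤s (s≤s z≤n)) (m≤m+n 8 7) , fresh 8 (s≤s (s≤s z≤n)) (m≤m+n 9 6)
                    , fresh 9 (s≤s (s≤s z≤n)) (m≤m+n 10 5) , fresh 12 (s≤s (s≤s z≤n)) (m≤m+n 13 2)
                    , fresh 13 (s≤s (s≤s z≤n)) (m≤m+n 14 1) }
      where
      fresh : ∀ i → 2 ≤ i → i < I → ∀ x → x < N → ar i x ≡ 0
      fresh i 2≤i i<I x x<N = z i x 2≤i i<I x<N
    body : ∀ k vr ar → 1 ≤ k → k < p → Copying k vr ar → wp copyBody (Copying (suc k)) k vr ar
    body k vr ar 1≤k k<p c = (tt , tt) , high , low
      where
      open Copying c
      rebuild : ∀ v → v ≡ d k → Copying (suc k) vr (setArr ar 2 k v)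
      rebuild v v≡ = record { saved = saved ; kept = kept ; D = update-∀ (λ j x → x ≡ d j) k v D v≡
                            ; z3 = z3 ; z4 = z4 ; z5 = z5 ; z6 = z6 ; blank = blank }
      high : K < k → _
      high K<k = (tt , <p⇒<N k<p , tt) , (tt , <p⇒<N k<p , K<k) , subst (_≤ V) (sym eq₁) (im≤V k) ,
        rebuild _ (trans eq₁ (initMem-d p d τ k 1≤k k<p))
        where eq₁ = kept k K<k (<p⇒<N k<p)
      low : k ≤ K → _
      low k≤K = (tt , <p⇒<N k<p , tt) , ((tt , tt) , ≤-<-trans (m∸n≤m k 1) (<p⇒<N k<p) , tt) , subst (_≤ V) (sym eq₁) (im≤V k) ,
        rebuild _ (trans eq₁ (initMem-d p d τ k 1≤k k<p))
        where eq₁ = trans (saved (k ∸ 1) (k∸1<K 1≤k k≤K)) (cong im (suc-∸1 1≤k))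

  record Start (m cnt base : ℕ) : Set where
    field
      m≡0 : m ≡ 0
      c≡0 : cnt ≡ 0
      b≡0 : base ≡ 0

  record Counting (k : ℕ) (vr : Vars) (ar : Arrs) : Set where
    field
      D     : ∀ j → 1 ≤ j → j < p → ar 2 j ≡ d j
      z4    : Fresh (ar 4)
      z5    : Fresh (ar 5)
      z6    : Fresh (ar 6)
      blank : Blank ar
      start : Start (vr 0) (vr 1) (vr 2)
      t≡τ   : vr 4 ≡ τ
      1≤e   : 1 ≤ vr 5
      e<p   : vr 5 < p
      tally : ∀ y → y < p → ar 3 y ≡ sumTo (λ j → eq (sq (ar 2) j) y) (k ∸ 1)
      top   : ∀ y → y < p → ar 3 y ≤ vr 6
      best  : vr 6 ≤ ar 3 (modℕ (vr 5 * vr 5) p)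

  setUp : Triple (Copying p) (blk setupBody) (Counting 1)
  setUp = blk-rule setupBody body
    where
    body : ∀ j vr ar → Copying p vr ar → wp setupBody (Counting 1) j vr ar
    body j vr ar c = (tt , tt) ,
      (λ K<p → let e₁ = trans (kept p K<p p<N) (initMem-τ p d τ 1≤p) in
        (tt , p<N , K<p) , subst (_≤ V) (sym e₁) (≤p⇒≤V (<⇒≤ τ<p)) , rest _ e₁) ,
      (λ p≤K → let e₁ = trans (saved (p ∸ 1) (k∸1<K 1≤p p≤K)) (trans (cong im (suc-∸1 1≤p)) (initMem-τ p d τ 1≤p)) in
        ((tt , tt) , ≤-<-trans (m∸n≤m p 1) p<N , tt) , subst (_≤ V) (sym e₁) (≤p⇒≤V (<⇒≤ τ<p)) , rest _ e₁)
      where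
      open Copying c
      d1 : ar 2 1 ≡ d 1
      d1 = D 1 ≤-refl 2≤p
      rest : ∀ v → v ≡ τ → wp (0 ≔ lit 0 ⨾ 1 ≔ lit 0 ⨾ 2 ≔ lit 0 ⨾ 6 ≔ lit 0 ⨾ 5 ≔ rd 2 (lit 1)) (Counting 1) j (update vr 4 v) ar
      rest v v≡ = tt , z≤n , tt , z≤n , tt , z≤n , tt , z≤n , (tt , <p⇒<N 2≤p , tt) ,
        subst (_≤ V) (sym d1) (≤p⇒≤V (<⇒≤ (proj₂ (hd 1 ≤-refl 2≤p)))) ,
        record { D = D ; z4 = z4 ; z5 = z5 ; z6 = z6 ; blank = blank
               ; start = record { m≡0 = refl ; c≡0 = refl ; b≡0 = refl }
               ; t≡τ = v≡ ; 1≤e = subst (1 ≤_) (sym d1) (proj₁ (hd 1 ≤-refl 2≤p)) ; e<p = subst (_< p) (sym d1) (proj₂ (hd 1 ≤-refl 2≤p))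
               ; tally = λ y y<p → z3 y (<p⇒<N y<p) ; top = λ y y<p → ≤-reflexive (z3 y (<p⇒<N y<p)) ; best = z≤n }

  counted : Triple (Counting 1) (loop countBody) (Counting p)
  counted = loop-rule Counting countBody body
    where
    body : ∀ k vr ar → 1 ≤ k → k < p → Counting k vr ar → wp countBody (Counting (suc k)) k vr ar
    body (suc k′) vr ar 1≤k k<p c =
      (((tt , <p⇒<N k<p , tt) , (tt , <p⇒<N k<p , tt)) , tt) , ≤p⇒≤V (<⇒≤ s<p) ,
      (tt , <p⇒<N s<p , tt) , (tt , (tt , <p⇒<N s<p , tt)) , ≤p⇒≤V new≤p ,
      (tt , (tt , <p⇒<N s<p , tt)) , better , worse
      where
      open Counting c
      k = suc k′
      s = sq (ar 2) k
      s<p : s < p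
      s<p = modℕ<p _
      new = suc (ar 3 s)
      cnt′ = update (ar 3) s new
      same : cnt′ s ≡ new
      same = update-same (ar 3) s new
      new≤p : new ≤ p
      new≤p = ≤-trans (s≤s (≤-trans (≤-reflexive (tally s s<p)) (≤-trans (sumTo-mono k′ (λ j _ _ → eq≤1 (sq (ar 2) j) s))
                (≤-reflexive (trans (sumTo-const 1 k′) (*-identityʳ k′)))))) (<⇒≤ k<p)
      tally′ : ∀ y → y < p → cnt′ y ≡ eq s y + sumTo (λ j → eq (sq (ar 2) j) y) k′
      tally′ y y<p with y ≟ s
      ... | yes refl = trans same (trans (cong suc (tally s s<p)) (cong (_+ sumTo (λ j → eq (sq (ar 2) j) y) k′) (sym (eq-refl s))))
      ... | no y≢s = trans (update-other (ar 3) s new y≢s) (trans (tally y y<p)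
              (cong (_+ sumTo (λ j → eq (sq (ar 2) j) y) k′) (sym (cong (λ b → if b then 1 else 0) (≢⇒≡ᵇ-false s y (λ e → y≢s (sym e)))))))
      top′ : ∀ {b} → cnt′ s ≤ b → vr 6 ≤ b → ∀ y → y < p → cnt′ y ≤ b
      top′ new≤ old≤ y y<p with y ≟ s
      ... | yes refl = new≤
      ... | no y≢s = ≤-trans (≤-reflexive (update-other (ar 3) s new y≢s)) (≤-trans (top y y<p) old≤)
      grow : ∀ y → ar 3 y ≤ cnt′ y
      grow y with y ≟ s
      ... | yes refl = ≤-trans (n≤1+n _) (≤-reflexive (sym same))
      ... | no y≢s = ≤-reflexive (sym (update-other (ar 3) s new y≢s))
      better : vr 6 < cnt′ s → _
      better gt = (tt , <p⇒<N s<p , tt) , subst (_≤ V) (sym same) (≤p⇒≤V new≤p) , (tt , <p⇒<N k<p , tt) ,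
        subst (_≤ V) (sym (D k 1≤k k<p)) (≤p⇒≤V (<⇒≤ (proj₂ (hd k 1≤k k<p)))) ,
        record { D = D ; z4 = z4 ; z5 = z5 ; z6 = z6 ; blank = blank
               ; start = start ; t≡τ = t≡τ
               ; 1≤e = subst (1 ≤_) (sym (D k 1≤k k<p)) (proj₁ (hd k 1≤k k<p)) ; e<p = subst (_< p) (sym (D k 1≤k k<p)) (proj₂ (hd k 1≤k k<p))
               ; tally = tally′ ; top = top′ ≤-refl (<⇒≤ gt) ; best = ≤-refl }
      worse : cnt′ s ≤ vr 6 → Counting (suc k) _ _
      worse le = record { D = D ; z4 = z4 ; z5 = z5 ; z6 = z6 ; blank = blank
               ; start = start ; t≡τ = t≡τ ; 1≤e = 1≤e ; e<p = e<p
               ; tally = tally′ ; top = top′ le ≤-refl ; best = ≤-trans best (grow _) }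

  record Tabling (k : ℕ) (vr : Vars) (ar : Arrs) : Set where
    field
      D     : ∀ j → 1 ≤ j → j < p → ar 2 j ≡ d j
      z5    : Fresh (ar 5)
      z6    : Fresh (ar 6)
      blank : Blank ar
      start : Start (vr 0) (vr 1) (vr 2)
      t≡τ   : vr 4 ≡ τ
      1≤e   : 1 ≤ vr 5
      e<p   : vr 5 < p
      most  : ∀ y → y < p → mult (sq (ar 2)) y ≤ mult (sq (ar 2)) (modℕ (vr 5 * vr 5) p)
      x<p   : vr 7 < p
      x≈    : vr 7 ≈ (k ∸ 1) * vr 5
      sound : ∀ y → y < p → ar 4 y ≡ 0 ⊎ ar 4 y * vr 5 ≈ y
      small : ∀ y → y < p → ar 4 y < p
      cover : ∀ i → 1 ≤ i → i < k → 1 ≤ ar 4 (modℕ (i * vr 5) p)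

  tableStart : Triple (Counting p) (blk (7 ≔ lit 0)) (Tabling 1)
  tableStart = blk-rule (7 ≔ lit 0) body
    where
    body : ∀ j vr ar → Counting p vr ar → wp (7 ≔ lit 0) (Tabling 1) j vr ar
    body j vr ar c = tt , z≤n , record
      { D = D ; z5 = z5 ; z6 = z6 ; blank = blank
      ; start = start
      ; t≡τ = t≡τ ; 1≤e = 1≤e ; e<p = e<p
      ; most = λ y y<p → subst₂ _≤_ (tally y y<p) (tally _ (modℕ<p _)) (≤-trans (top y y<p) best)
      ; x<p = 1≤p ; x≈ = ≡⇒≈ refl
      ; sound = λ y y<p → inj₁ (z4 y (<p⇒<N y<p))
      ; small = λ y y<p → subst (_< p) (sym (z4 y (<p⇒<N y<p))) 1≤p
      ; cover = λ { i 1≤i i<1 → contradiction (≤-pred i<1) (<⇒≱ 1≤i) } }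
      where open Counting c

  tabled : Triple (Tabling 1) (loop tableBody) (Tabling p)
  tabled = loop-rule Tabling tableBody body
    where
    body : ∀ k vr ar → 1 ≤ k → k < p → Tabling k vr ar → wp tableBody (Tabling (suc k)) k vr ar
    body (suc k′) vr ar 1≤k k<p c =
      ((tt , tt) , tt) , ≤p⇒≤V (<⇒≤ x′<p) , (tt , <p⇒<N x′<p , tt) , tt , ≤p⇒≤V (<⇒≤ k<p) ,
      record { D = D ; z5 = z5 ; z6 = z6 ; blank = blank
             ; start = start
             ; t≡τ = t≡τ ; 1≤e = 1≤e ; e<p = e<p ; most = most ; x<p = x′<p ; x≈ = x′≈
             ; sound = λ y y<p → at y (λ y v → v ≡ 0 ⊎ v * e ≈ y) (inj₂ (≈-sym x′≈)) (λ _ → sound y y<p)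
             ; small = λ y y<p → at y (λ y v → v < p) k<p (λ _ → small y y<p)
             ; cover = cover′ }
      where
      open Tabling c
      k = suc k′
      e = vr 5
      x′ = modℕ (vr 7 + e) p
      x′<p : x′ < p
      x′<p = modℕ<p (vr 7 + e)
      x′≈ : x′ ≈ k * e
      x′≈ = ≈-trans (modℕ-≈ (vr 7 + e)) (≈-trans (+-cong-≈ x≈ (≡⇒≈ {e} refl)) (≡⇒≈ (+-comm (k′ * e) e)))
      at : ∀ y (Q : ℕ → ℕ → Set) → Q x′ k → (y ≢ x′ → Q y (ar 4 y)) → Q y (update (ar 4) x′ k y)
      at y Q a b with y ≟ x′
      ... | yes refl = subst (Q y) (sym (update-same (ar 4) y k)) a
      ... | no y≢ = subst (Q y) (sym (update-other (ar 4) x′ k y≢)) (b y≢)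
      cover′ : ∀ i → 1 ≤ i → i < suc k → 1 ≤ update (ar 4) x′ k (modℕ (i * e) p)
      cover′ i 1≤i i<k = at (modℕ (i * e) p) (λ _ v → 1 ≤ v) 1≤k (λ ne → cover i 1≤i (≤∧≢⇒< (≤-pred i<k) (i≢k ne)))
        where
        i≢k : modℕ (i * e) p ≢ x′ → i ≢ k
        i≢k ne refl = ne (≈⇒≡ (modℕ<p (k * e)) x′<p (≈-trans (modℕ-≈ (k * e)) (≈-sym x′≈)))

  record Signing (k : ℕ) (vr : Vars) (ar : Arrs) : Set where
    field
      D      : ∀ j → 1 ≤ j → j < p → ar 2 j ≡ d j
      blank  : Blank ar
      start  : Start (vr 0) (vr 1) (vr 2)
      1≤e    : 1 ≤ vr 5
      e<p    : vr 5 < p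
      most   : ∀ y → y < p → mult (sq (ar 2)) y ≤ mult (sq (ar 2)) (modℕ (vr 5 * vr 5) p)
      divide : ∀ y → y < p → ar 4 y * vr 5 ≈ y
      small  : ∀ y → y < p → ar 4 y < p
      signed : ∀ j → 1 ≤ j → j < k → Signed (vr 5) (ar 2 j) (ar 5 j) (ar 6 j)
      z6     : ∀ x → k ≤ x → x < N → ar 6 x ≡ 0
      r0     : ar 5 0 ≡ 0
      t<p    : vr 4 < p
      target : vr 5 * vr 4 ≈ τ + vr 5 * sumTo (λ j → ar 6 j * ar 5 j) (k ∸ 1)

  signStart : Triple (Tabling p) (blk (4 ≔ rd 4 (var 4))) (Signing 1)
  signStart = blk-rule (4 ≔ rd 4 (var 4)) body
    where
    body : ∀ j vr ar → Tabling p vr ar → wp (4 ≔ rd 4 (var 4)) (Signing 1) j vr ar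
    body j vr ar c = (tt , <p⇒<N t<p′ , tt) , ≤p⇒≤V (<⇒≤ (small (vr 4) t<p′)) , record
      { D = D ; blank = blank ; start = start
      ; 1≤e = 1≤e ; e<p = e<p ; most = most ; divide = divide ; small = small
      ; signed = λ { i 1≤i i<1 → contradiction (≤-pred i<1) (<⇒≱ 1≤i) }
      ; z6 = λ x _ → z6 x ; r0 = z5 0 1≤N ; t<p = small (vr 4) t<p′
      ; target = ≈-trans (≡⇒≈ (*-comm (vr 5) (ar 4 (vr 4)))) (≈-trans (divide (vr 4) t<p′)
          (≡⇒≈ (trans t≡τ (sym (trans (cong (τ +_) (*-zeroʳ (vr 5))) (+-identityʳ τ)))))) }
      where
      open Tabling c
      t<p′ : vr 4 < p
      t<p′ = subst (_< p) (sym t≡τ) τ<p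
      divide : ∀ y → y < p → ar 4 y * vr 5 ≈ y
      divide y y<p with sound y y<p
      ... | inj₂ h = h
      ... | inj₁ zero′ with y ≟ 0
      ... | yes refl = ≡⇒≈ (cong (_* vr 5) zero′)
      ... | no y≢0 with ratio prime (vr 5) y 1≤e e<p (n≢0⇒n>0 y≢0) y<p
      -- A nonzero y is the multiple i · e of the scale, and the loop has filled the entry of that
      -- multiple, so it cannot still be 0.
      ... | i , 1≤i , i<p , hit = contradiction (≤-trans (subst (λ z → 1 ≤ ar 4 z) hit (cover i 1≤i i<p)) (≤-reflexive zero′)) λ ()

  signed-all : Triple (Signing 1) (loop scaleBody) (Signing p)
  signed-all = loop-rule Signing scaleBody body
    where
    body : ∀ k vr ar → 1 ≤ k → k < p → Signing k vr ar → wp scaleBody (Signing (suc k)) k vr ar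
    body (suc k′) vr ar 1≤k k<p c =
      ((tt , <p⇒<N k<p , tt) , <p⇒<N y<p , tt) , ≤p⇒≤V (<⇒≤ x<p) , (tt , tt , tt) , flip , keep
      where
      open Signing c
      k = suc k′
      e = vr 5
      y = ar 2 k
      y≡ : y ≡ d k
      y≡ = D k 1≤k k<p
      y<p : y < p
      y<p = subst (_< p) (sym y≡) (proj₂ (hd k 1≤k k<p))
      x = ar 4 y
      x<p : x < p
      x<p = small y y<p
      xe≈y : x * e ≈ y
      xe≈y = divide y y<p
      1≤x : 1 ≤ x
      1≤x with x in x≡
      ... | suc _ = s≤s z≤n
      ... | zero = contradiction (≤-trans (subst (1 ≤_) (sym y≡) (proj₁ (hd k 1≤k k<p)))
                     (≤-reflexive (sym (≈⇒≡ 1≤p y<p (subst (λ z → z * e ≈ y) x≡ xe≈y))))) λ ()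
      old : (ℕ → ℕ) → (ℕ → ℕ) → Set
      old r f = ∀ j → j ≤ k′ → r j ≡ ar 5 j × f j ≡ ar 6 j
      sum-old : ∀ {r f} → old r f → sumTo (λ j → f j * r j) k′ ≡ sumTo (λ j → ar 6 j * ar 5 j) k′
      sum-old o = sumTo-cong k′ (λ j _ j≤ → cong₂ _*_ (proj₂ (o j j≤)) (proj₁ (o j j≤)))
      ≢k : ∀ {j} → j ≤ k′ → j ≢ k
      ≢k j≤ refl = <-irrefl refl j≤
      signed′ : ∀ {r f} → old r f → Signed e y (r k) (f k) → ∀ j → 1 ≤ j → j < suc k → Signed e (ar 2 j) (r j) (f j)
      signed′ {r} {f} o new j 1≤j j<k with j ≟ k
      ... | yes refl = new
      ... | no j≢k = subst₂ (Signed e (ar 2 j)) (sym (proj₁ (o j j≤))) (sym (proj₂ (o j j≤))) (signed j 1≤j (≤∧≢⇒< (≤-pred j<k) j≢k))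
        where
        j≤ : j ≤ k′
        j≤ = ≤-pred (≤∧≢⇒< (≤-pred j<k) j≢k)
      z6′ : ∀ w → suc k ≤ w → w < N → ar 6 w ≡ 0
      z6′ w k<w = z6 w (<⇒≤ k<w)
      flip : p < x + x → _
      flip p<2x = (tt , <p⇒<N k<p , tt) , (tt , tt) , ≤p⇒≤V (m∸n≤m p x) ,
        (tt , <p⇒<N k<p , tt) , tt , ≤p⇒≤V 1≤p ,
        ((tt , tt , <p⇒<N k<p , tt) , tt) , ≤p⇒≤V (<⇒≤ (modℕ<p _)) ,
        record { D = D ; blank = blank ; start = start ; 1≤e = 1≤e ; e<p = e<p ; most = most
               ; divide = divide ; small = small
               ; signed = signed′ {r′} {f′} old′ (subst₂ (Signed e y) (sym rk) (sym fk) (m<n⇒0<n∸m x<p , half , inj₂ (refl , opposite)))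
               ; z6 = λ w k<w w<N → trans (update-other (ar 6) k 1 (λ { refl → <-irrefl refl k<w })) (z6′ w k<w w<N)
               ; r0 = r0 ; t<p = modℕ<p _ ; target = target′ }
        where
        rₖ = p ∸ x
        r′ = update (ar 5) k rₖ
        f′ = update (ar 6) k 1
        rk : r′ k ≡ rₖ
        rk = update-same (ar 5) k rₖ
        fk : f′ k ≡ 1
        fk = update-same (ar 6) k 1
        old′ : old r′ f′
        old′ j j≤ = update-other (ar 5) k rₖ (≢k j≤) , update-other (ar 6) k 1 (≢k j≤)
        half : 2 * rₖ ≤ p
        half = +-cancelʳ-≤ (x + x) _ _ (≤-trans (≤-reflexive (trans (arrange rₖ x) (cong₂ _+_ (m∸n+n≡m (<⇒≤ x<p)) (m∸n+n≡m (<⇒≤ x<p)))))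
          (+-monoʳ-≤ p (<⇒≤ p<2x)))
          where
          arrange : ∀ a b → 2 * a + (b + b) ≡ (a + b) + (a + b)
          arrange = solve-∀
        opposite : y + rₖ * e ≈ 0
        opposite = ≈-trans (+-cong-≈ (≈-sym xe≈y) (≡⇒≈ {rₖ * e} refl))
          (≈-trans (≡⇒≈ (trans (sym (*-distribʳ-+ e x rₖ)) (trans (cong (_* e) (m+[n∸m]≡n (<⇒≤ x<p))) (*-comm p e)))) (multiple≈0 e))
        target′ : e * modℕ (vr 4 + r′ k) p ≈ τ + e * (f′ k * r′ k + sumTo (λ j → f′ j * r′ j) k′)
        target′ = ≈-trans (*-congˡ-≈ e (modℕ-≈ (vr 4 + r′ k))) (≈-trans (≡⇒≈ (*-distribˡ-+ e (vr 4) (r′ k)))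
          (≈-trans (+-cong-≈ target (≡⇒≈ {e * r′ k} refl)) (≡⇒≈ (trans (arrange τ e (sumTo (λ j → ar 6 j * ar 5 j) k′) (r′ k))
            (cong₂ (λ a b → τ + e * (a * r′ k + b)) (sym fk) (sym (sum-old {r′} {f′} old′)))))))
          where
          arrange : ∀ τ e s r → τ + e * s + e * r ≡ τ + e * (1 * r + s)
          arrange = solve-∀
      keep : x + x ≤ p → _
      keep 2x≤p = (tt , <p⇒<N k<p , tt) , tt , ≤p⇒≤V (<⇒≤ x<p) ,
        record { D = D ; blank = blank ; start = start ; 1≤e = 1≤e ; e<p = e<p ; most = most
               ; divide = divide ; small = small
               ; signed = signed′ {r′} {ar 6} old′ (subst₂ (Signed e y) (sym rk) (sym fk)
                   (1≤x , ≤-trans (≤-reflexive (cong (x +_) (+-identityʳ x))) 2x≤p , inj₁ (refl , xe≈y)))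
               ; z6 = z6′ ; r0 = r0 ; t<p = t<p
               ; target = ≈-trans target (≡⇒≈ (cong (λ s → τ + e * s)
                   (sym (trans (cong (λ z → z * r′ k + sumTo (λ j → ar 6 j * r′ j) k′) fk) (sum-old {r′} {ar 6} old′))))) }
        where
        r′ = update (ar 5) k x
        rk : r′ k ≡ x
        rk = update-same (ar 5) k x
        fk : ar 6 k ≡ 0
        fk = z6 k ≤-refl (<p⇒<N k<p)
        old′ : old r′ (ar 6)
        old′ j j≤ = update-other (ar 5) k x (≢k j≤) , refl

  record Ready (vr : Vars) (ar : Arrs) : Set where
    field
      inst  : Instance p 1≤p d τ (ar 5) (ar 6) (vr 4)
      blank : Blank ar
      start : Start (vr 0) (vr 1) (vr 2)

  Signing⇒Ready : ∀ {vr ar} → Signing p vr ar → Ready vr ar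
  Signing⇒Ready {vr} {ar} c = record
    { inst = record
        { r0 = r0
        ; r-pos = λ j 1≤j j<p → proj₁ (signed j 1≤j j<p)
        ; r-half = λ j 1≤j j<p → proj₁ (proj₂ (signed j 1≤j j<p))
        ; f≤1 = λ j 1≤j j<p → flag (proj₂ (proj₂ (signed j 1≤j j<p)))
        ; t<p = t<p
        ; mult≤ = mult-max 1≤e e<p signed most
        ; link = λ sel sel≤1 sum≈ → trans (cong (λ z → modℕ z p) (sumTo-cong n (λ j 1≤j j≤n →
            cong (λ z → if modℕ (sel j + ar 6 j) 2 ≡ᵇ 0 then 0 else z) (sym (D j 1≤j (≤n⇒<p j≤n))))))
            (unsign 1≤e e<p signed τ<p target sel sel≤1 sum≈) }
    ; blank = blank ; start = start }
    where
    open Signing c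
    flag : ∀ {f} {A B : Set} → (f ≡ 0 × A) ⊎ (f ≡ 1 × B) → f ≤ 1
    flag (inj₁ (refl , _)) = z≤n
    flag (inj₂ (refl , _)) = ≤-refl

  normalised : Triple (Init p N d τ) normalise Ready
  normalised = conseq-rule (λ φ → φ) Signing⇒Ready
    (seq-rule (loop copyBody) _ copied (seq-rule (blk setupBody) _ setUp (seq-rule (loop countBody) _ counted
      (seq-rule (blk (7 ≔ lit 0)) _ tableStart (seq-rule (loop tableBody) _ tabled
        (seq-rule (blk (4 ≔ rd 4 (var 4))) _ signStart signed-all))))))

  -- Verification of the growth passes

  p*p<V : suc (p * p) ≤ V
  p*p<V = *-mono-< p<N p<N

  Inst : Vars → Arrs → Set
  Inst vr ar = Instance p 1≤p d τ (ar 5) (ar 6) (vr 4)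

  -- What holds between passes. R carries facts about the values alone, which no pass changes; J
  -- carries the growth accounting.
  record Stage (R : (ℕ → ℕ) → Set) (J : ℕ → ℕ → Set) (low mₛ : ℕ) (vr : Vars) (ar : Arrs) : Set where
    field
      inst      : Inst vr ar
      fresh     : Fresh (ar 13)
      extra     : R (ar 5)
      items     : Items (ar 5) (vr 0) (vr 1) (vr 2) (ar 7) (ar 8) (ar 9)
      m≡mₛ      : vr 0 ≡ mₛ
      potential : J (vr 0) (unused (ar 7))
      lower     : ∀ j → 1 ≤ j → j < p → ar 7 j ≡ 0 → low ≤ ar 5 j
      next<     : ∀ z → 1 ≤ z → z < p → ar 12 z < z

  r≤p : ∀ vr ar → Inst vr ar → ∀ j → j < p → ar 5 j ≤ p
  r≤p vr ar inst zero _ = subst (_≤ p) (sym (Instance.r0 inst)) z≤n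
  r≤p vr ar inst j@(suc _) j<p = ≤-trans (m≤m+n (ar 5 j) _) (Instance.r-half inst j (s≤s z≤n) j<p)

  wp-item : ∀ (Φ : Asrt) k vr ar → vr 7 < p → vr 11 < p → suc (vr 1) < p →
    vr 0 + (ar 5 (vr 11) ∸ ar 5 (vr 7)) ≤ V →
    Φ (update (update (update vr 1 (suc (vr 1))) 0 (vr 0 + (ar 5 (vr 11) ∸ ar 5 (vr 7)))) 2 (modℕ (vr 2 + ar 5 (vr 7)) p))
      (setArr (setArr (setArr (setArr ar 8 (suc (vr 1)) (vr 7)) 9 (suc (vr 1)) (vr 11)) 7 (vr 7) (suc (vr 1))) 7 (vr 11) (suc (vr 1))) →
    wp itemBody Φ k vr ar
  wp-item Φ k vr ar l<p h<p c<p m≤V φ =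
    (tt , tt) , ≤p⇒≤V (<⇒≤ c<p) ,
    (tt , <p⇒<N c<p , tt) , tt , ≤p⇒≤V (<⇒≤ l<p) ,
    (tt , <p⇒<N c<p , tt) , tt , ≤p⇒≤V (<⇒≤ h<p) ,
    (tt , (tt , <p⇒<N h<p , tt) , (tt , <p⇒<N l<p , tt)) , m≤V ,
    ((tt , (tt , <p⇒<N l<p , tt)) , tt) , ≤p⇒≤V (<⇒≤ (modℕ<p _)) ,
    (tt , <p⇒<N l<p , tt) , tt , ≤p⇒≤V (<⇒≤ c<p) ,
    (tt , <p⇒<N h<p , tt) , tt , ≤p⇒≤V (<⇒≤ c<p) , φ

  module PassVerification
    (c low mₛ : ℕ) (R : (ℕ → ℕ) → Set) (J : ℕ → ℕ → Set)
    (J-single : ∀ {m u g} → low ≤ g → J m (suc u) → J (m + g) u)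
    (J-pair : ∀ {m u g x} → 4 * m < c * (p ∸ 1) → 2 + m ≤ x → 2 * x ≤ p → 1 ≤ g → J m (2 + u) → J (m + g) u)
    where

    module At (vr : Vars) (ar : Arrs) (inst : Inst vr ar) =
      Passing p 1≤p (ar 5) (Instance.r0 inst) (Instance.r-half inst) c low mₛ J J-single J-pair

    record Running (k : ℕ) (vr : Vars) (ar : Arrs) : Set where
      field
        inst  : Inst vr ar
        fresh : Fresh (ar 13)
        extra : R (ar 5)
        W≡    : vr 3 ≡ suc mₛ
        state : At.PassInv vr ar inst k (vr 0) (vr 1) (vr 2) (ar 7) (ar 8) (ar 9) (ar 10) (ar 12)

    record Clearing (k : ℕ) (vr : Vars) (ar : Arrs) : Set where
      field
        stage   : Stage R J low mₛ vr ar
        W≡      : vr 3 ≡ suc mₛ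
        cleared : ∀ b → 1 ≤ b → b < k → ar 10 b ≡ 0

    clearing : Triple (Stage R J low mₛ) (blk (3 ≔ lit 1 ⊕ var 0)) (Clearing 1)
    clearing = blk-rule _ start
      where
      start : ∀ j vr ar → Stage R J low mₛ vr ar → wp (3 ≔ lit 1 ⊕ var 0) (Clearing 1) j vr ar
      start j vr ar s = (tt , tt) , ≤-trans (s≤s (gain-bound (r≤p vr ar inst) items)) p*p<V , record
        { stage = record { inst = inst ; fresh = fresh ; extra = extra ; items = items ; m≡mₛ = m≡mₛ
                         ; potential = potential ; lower = lower ; next< = next< }
        ; W≡ = cong suc m≡mₛ ; cleared = λ { b 1≤b b<1 → contradiction (≤-pred b<1) (<⇒≱ 1≤b) } }
        where open Stage s

    cleared-all : Triple (Clearing 1) (loop (10 [ jj ]≔ lit 0)) (Clearing p)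
    cleared-all = loop-rule Clearing _ clear
      where
      clear : ∀ k vr ar → 1 ≤ k → k < p → Clearing k vr ar → wp (10 [ jj ]≔ lit 0) (Clearing (suc k)) k vr ar
      clear k vr ar 1≤k k<p s = (tt , <p⇒<N k<p , tt) , tt , z≤n , record
        { stage = record { inst = inst ; fresh = fresh ; extra = extra ; items = items ; m≡mₛ = m≡mₛ
                         ; potential = potential ; lower = lower ; next< = next< }
        ; W≡ = W≡ ; cleared = update-∀ (λ _ v → v ≡ 0) k 0 cleared refl }
        where
        open Clearing s
        open Stage stage

    begin-pass : ∀ {vr ar} → Clearing p vr ar → Running 1 vr ar
    begin-pass {vr} {ar} s = record { inst = inst ; fresh = fresh ; extra = extra ; W≡ = W≡ ; state = record
      { items = items ; potential = potential ; grown = ≤-reflexive (sym m≡mₛ)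
      ; seen = λ { j 1≤j j<1 → contradiction (≤-pred j<1) (<⇒≱ 1≤j) }
      ; lower = lower ; next< = next<
      ; stacks = inj₂ (record { pending = λ { j 1≤j j<1 → contradiction (≤-pred j<1) (<⇒≱ 1≤j) }
                              ; member = λ b y 1≤b b<p i → contradiction (≤-trans (nonempty i) (≤-reflexive (cleared b 1≤b b<p))) λ () }) } }
      where
      open Clearing s
      open Stage stage

    body : ∀ k vr ar → 1 ≤ k → k < p → Running k vr ar → wp (passBody c) (Running (suc k)) k vr ar
    body k vr ar 1≤k k<p run =
      ((tt , k<N , tt) , tt) ,
      (λ uk → ((tt , k<N , tt) , tt , tt) , taking (n<1⇒n≡0 uk) ,
        λ big → ((tt , tt) , tt , tt , tt) , pairing (n<1⇒n≡0 uk) big ,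
          λ late → record { inst = inst ; fresh = fresh ; extra = extra ; W≡ = W≡ ; state = skip-late 1≤k k<p state big late }) ,
      λ uk → record { inst = inst ; fresh = fresh ; extra = extra ; W≡ = W≡ ; state = skip-used 1≤k k<p state uk }
      where
      open Running run
      open At vr ar inst
      open PassInv state
      open Stacking p 1≤p (ar 5) (suc mₛ)
      k<N : k < N
      k<N = <p⇒<N k<p
      new-bounds : ∀ {m cnt base used lo hi} → Items (ar 5) m (suc cnt) base used lo hi → m ≤ V × suc cnt < p
      new-bounds it = ≤-trans (gain-bound (r≤p vr ar inst) it) (<⇒≤ p*p<V) , ≤n⇒<p (≤-trans (m≤m+n _ _) (Items.count it))
      taking : ar 7 k ≡ 0 → ar 5 k < 2 + vr 0 → wp (7 ≔ lit 0 ⨾ 11 ≔ jj ⨾ itemBody) (Running (suc k)) k vr ar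
      taking uk small = tt , z≤n , tt , ≤p⇒≤V (<⇒≤ k<p) ,
        wp-item (Running (suc k)) k (update (update vr 7 0) 11 k) ar 1≤p k<p (proj₂ bounds) (proj₁ bounds)
          (record { inst = inst ; fresh = fresh ; extra = extra ; W≡ = W≡ ; state = state′ })
        where
        state′ = take 1≤k k<p state uk small
        bounds = new-bounds (PassInv.items state′)
      pairing : ar 7 k ≡ 0 → 2 + vr 0 ≤ ar 5 k → 4 * vr 0 < c * (p ∸ 1) →
        wp (9 ≔ rd 5 jj ⊘ var 3 ⨾ 8 ≔ rd 10 (var 9) ⨾ resolveBody) (Running (suc k)) k vr ar
      pairing uk big early = ((tt , k<N , tt) , tt) , ≤-trans (divℕ≤ (ar 5 k) (vr 3)) (≤p⇒≤V (r≤p vr ar inst k k<p)) ,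
        inner _ (cong (divℕ (ar 5 k)) W≡)
        where
        range = bucket-range k 1≤k k<p (≤-trans (s≤s (s≤s grown)) big)
        a = ar 10 (bucket k)
        top : 1 ≤ a → 1 ≤ a × a < k
        top 1≤a = at stacks
          where
          at : c * n ≤ 4 * vr 0 ⊎ Stacks k (ar 7) (ar 10) (ar 12) → 1 ≤ a × a < k
          at (inj₁ late) = contradiction late (<⇒≱ early)
          at (inj₂ s) = 1≤a , proj₁ (proj₂ (Stacks.member s _ a (proj₁ range) (proj₂ range) (here 1≤a)))
        a<p : a < p
        a<p with 1 ≤? a
        ... | yes 1≤a = <-trans (proj₂ (top 1≤a)) k<p
        ... | no 1≰a = <-≤-trans (≰⇒> 1≰a) 1≤p
        inner : ∀ b → b ≡ bucket k → wp (8 ≔ rd 10 (var 9) ⨾ resolveBody) (Running (suc k)) k (update vr 9 b) ar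
        inner b refl = (tt , <p⇒<N (proj₂ range) , tt) , ≤p⇒≤V (<⇒≤ a<p) ,
          (tt , tt) ,
          (λ 1≤a → ((tt , <p⇒<N a<p , tt) , (tt , k<N , tt)) ,
            (λ a<ₖ → tt , ≤p⇒≤V (<⇒≤ a<p) , tt , ≤p⇒≤V (<⇒≤ k<p) , pairs a k 1≤a a<ₖ (inj₁ (refl , refl)) a<p k<p) ,
            λ k≤a → ((tt , k<N , tt) , (tt , <p⇒<N a<p , tt)) ,
              (λ k<ₐ → tt , ≤p⇒≤V (<⇒≤ k<p) , tt , ≤p⇒≤V (<⇒≤ a<p) , pairs k a 1≤a k<ₐ (inj₂ (refl , refl)) k<p a<p) ,
              λ a≤k → pushing (inj₂ (1≤a , ≤-antisym a≤k k≤a))) ,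
          λ a≤0 → pushing (inj₁ (n≤0⇒n≡0 a≤0))
          where
          vr₁ = update (update vr 9 (bucket k)) 8 a
          pushing : a ≡ 0 ⊎ (1 ≤ a × ar 5 a ≡ ar 5 k) → wp pushBody (Running (suc k)) k vr₁ ar
          pushing t = (tt , k<N , tt) , tt , ≤p⇒≤V (<⇒≤ a<p) , (tt , <p⇒<N (proj₂ range) , tt) , tt , ≤p⇒≤V (<⇒≤ k<p) ,
            record { inst = inst ; fresh = fresh ; extra = extra ; W≡ = W≡ ; state = push 1≤k k<p state uk big t early }
          pairs : ∀ l h → 1 ≤ a → ar 5 l < ar 5 h → (l ≡ a × h ≡ k) ⊎ (l ≡ k × h ≡ a) → l < p → h < p →
            wp (itemBody ⨾ popBody) (Running (suc k)) k (update (update vr₁ 7 l) 11 h) ar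
          pairs l h 1≤a l<h which l<p h<p =
            wp-item (wp popBody (Running (suc k)) k) k (update (update vr₁ 7 l) 11 h) ar l<p h<p (proj₂ bounds) (proj₁ bounds)
              ((tt , <p⇒<N (proj₂ range) , tt) , (tt , <p⇒<N a<p , tt) , ≤p⇒≤V (<⇒≤ (<-trans (next< a 1≤a a<p) a<p)) ,
               record { inst = inst ; fresh = fresh ; extra = extra ; W≡ = W≡ ; state = state′ })
            where
            state′ = pair 1≤k k<p state l h uk big early 1≤a l<h which
            bounds = new-bounds (PassInv.items state′)

    passed : Triple (Stage R J low mₛ) (pass c) (Running p)
    passed = seq-rule (blk (3 ≔ lit 1 ⊕ var 0)) _ clearing
      (seq-rule (loop (10 [ jj ]≔ lit 0)) (loop (passBody c)) cleared-all
        (conseq-rule begin-pass (λ s → s) (loop-rule Running (passBody c) body)))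

  n≥1 : 1 ≤ n
  n≥1 = <p⇒≤n 2≤p

  R₀ : (ℕ → ℕ) → Set
  R₀ _ = ⊤

  J₀ : ℕ → ℕ → Set
  J₀ m u = n ≤ m + u

  unused≤n : ∀ used → unused used ≤ n
  unused≤n used = ≤-trans (sumTo-mono n (λ j _ _ → isZero≤1 (used j))) (≤-reflexive (trans (sumTo-const 1 n) (*-identityʳ n)))
    where
    isZero≤1 : ∀ v → isZero v ≤ 1
    isZero≤1 zero = ≤-refl
    isZero≤1 (suc _) = z≤n

  begin-growth : ∀ {vr ar} → Ready vr ar → Stage R₀ J₀ 1 0 vr ar
  begin-growth {vr} {ar} s = record
    { inst = inst ; fresh = z13 ; extra = tt
    ; items = record
        { count = subst (λ z → z + unused (ar 7) ≤ n) (sym c≡0) (unused≤n (ar 7))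
        ; total = trans (trans (sumTo-cong n gain≡0) zeros) (sym m≡0)
        ; base≈ = ≡⇒≈ (trans b≡0 (sym (trans (sumTo-cong n (λ k _ k≤n → trans (cong (ar 5) (lo≡0 k (≤n⇒<p k≤n))) r0)) zeros)))
        ; base<p = subst (_< p) (sym b≡0) 1≤p
        ; order = λ k _ k<p → ≤-reflexive (cong (ar 5) (trans (lo≡0 k k<p) (sym (hi≡0 k k<p))))
        ; reach = λ k _ k<p → ≤-trans (≤-reflexive (trans (cong (ar 5) (hi≡0 k k<p)) r0)) z≤n
        ; own-lo = λ k _ k<p → inj₁ (lo≡0 k k<p)
        ; own-hi = λ k _ k<p → inj₁ (hi≡0 k k<p)
        ; lo<p = λ k _ k<p → subst (_< p) (sym (lo≡0 k k<p)) 1≤p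
        ; hi<p = λ k _ k<p → subst (_< p) (sym (hi≡0 k k<p)) 1≤p
        ; lo-end = λ k _ k<p → lo≡0 k k<p
        ; hi-end = λ k _ k<p → hi≡0 k k<p }
    ; m≡mₛ = m≡0
    ; potential = ≤-trans (≤-reflexive (sym (trans (sumTo-cong n (λ j _ j≤n → cong isZero (z7 j (<p⇒<N (≤n⇒<p j≤n)))))
        (trans (sumTo-const 1 n) (*-identityʳ n))))) (m≤n+m _ (vr 0))
    ; lower = λ j 1≤j j<p _ → r-pos j 1≤j j<p
    ; next< = λ z 1≤z z<p → subst (_< z) (sym (z12 z (<p⇒<N z<p))) 1≤z }
    where
    open Ready s
    open Instance inst
    open Start start
    z7 = proj₁ blank
    z8 = proj₁ (proj₂ blank)
    z9 = proj₁ (proj₂ (proj₂ blank))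
    z12 = proj₁ (proj₂ (proj₂ (proj₂ blank)))
    z13 = proj₂ (proj₂ (proj₂ (proj₂ blank)))
    lo≡0 : ∀ k → k < p → ar 8 k ≡ 0
    lo≡0 k k<p = z8 k (<p⇒<N k<p)
    hi≡0 : ∀ k → k < p → ar 9 k ≡ 0
    hi≡0 k k<p = z9 k (<p⇒<N k<p)
    zeros : sumTo (λ _ → 0) n ≡ 0
    zeros = trans (sumTo-const 0 n) (*-zeroʳ n)
    gain≡0 : ∀ k → 1 ≤ k → k ≤ n → gain (ar 5) (ar 8) (ar 9) k ≡ 0
    gain≡0 k _ k≤n = trans (cong₂ (λ x y → ar 5 x ∸ ar 5 y) (hi≡0 k (≤n⇒<p k≤n)) (lo≡0 k (≤n⇒<p k≤n))) (n∸n≡0 (ar 5 0))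

  single₀ : ∀ {m u g} → 1 ≤ g → J₀ m (suc u) → J₀ (m + g) u
  single₀ {m} {u} {g} 1≤g h = ≤-trans h (≤-trans (≤-reflexive (+-suc m u))
    (≤-trans (+-monoˡ-≤ u (+-monoˡ-≤ m 1≤g)) (≤-reflexive (cong (_+ u) (+-comm g m)))))

  module P₀ = PassVerification 0 1 0 R₀ J₀ (λ {m} {u} {g} → single₀ {m} {u} {g}) (λ ())

  module _ (m₀ : ℕ) where

    open Potential n

    R₁ : (ℕ → ℕ) → Set
    R₁ r = 1 ≤ m₀ × (∀ v → mult r v ≤ m₀)

    J₁ J₂ J₃ : ℕ → ℕ → Set
    J₁ m u = 1 ≤ m₀ × Spread m₀ m u × Supply₂ m₀ m u
    J₂ m u = n ≤ 4 * m × J₁ m u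
    J₃ m u = 1 ≤ m₀ × n ≤ 4 * m × Spread m₀ m u × Supply₄ m₀ m u

    single₁ : ∀ {m u g} → 2 ≤ g → J₁ m (suc u) → J₁ (m + g) u
    single₁ {m} {u} {g} 2≤g (1≤m₀ , s , t) =
      1≤m₀ , spread-single m₀ {m} {u} {g} (<⇒≤ 2≤g) s , supply₂-single m₀ {m} {u} {g} 2≤g t

    pair₁ : ∀ {m u g} → 4 * m < 1 * n → 1 ≤ g → J₁ m (2 + u) → J₁ (m + g) u
    pair₁ {m} {u} {g} early 1≤g (1≤m₀ , s , t) =
      1≤m₀ , spread-pair m₀ {m} {u} {g} 1≤g s , supply₂-pair m₀ {m} {u} {g} 1≤m₀ early 1≤g s

    module P₁ = PassVerification 1 2 m₀ R₁ J₁
      (λ {m} {u} {g} → single₁ {m} {u} {g}) (λ {m} {u} {g} early _ _ → pair₁ {m} {u} {g} early)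

    single₂ : ∀ {m u g} → 2 ≤ g → J₂ m (suc u) → J₂ (m + g) u
    single₂ {m} {u} {g} 2≤g (q , j) = ≤-trans q (*-monoʳ-≤ 4 (m≤m+n m g)) , single₁ {m} {u} {g} 2≤g j

    module P₂ (m₂ : ℕ) = PassVerification 0 2 m₂ R₁ J₂ (λ {m} {u} {g} → single₂ {m} {u} {g}) (λ ())

    -- A prime is not twice a number x ≥ 2. The unit gained turns the bound by p into the bound by n
    -- that `supply₄-pair` requires.
    odd-half : ∀ x → 2 ≤ x → 2 * x ≤ p → 2 * x ≤ n
    odd-half x 2≤x 2x≤p with 2 * x ≟ p
    ... | no ne = <p⇒≤n (≤∧≢⇒< 2x≤p ne)
    ... | yes e = contradiction (subst Prime (sym e) prime) (composite x 2≤x)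
      where
      composite : ∀ x → 2 ≤ x → ¬ Prime (2 * x)
      composite x 2≤x pr with euclidsLemma 2 x pr (divides 1 (sym (*-identityˡ (2 * x))))
      ... | inj₁ q = <⇒≱ (*-monoʳ-≤ 2 2≤x) (≤-trans (∣⇒≤ q) (m≤m+n 2 1))
      ... | inj₂ q = <⇒≱ (m<m+n x (≤-trans (≤-trans (n≤1+n 1) 2≤x) (m≤m+n x 0))) (∣⇒≤ {{>-nonZero (<⇒≤ 2≤x)}} q)

    module P₃ (m₂ m₃ : ℕ) (q₂ : n ≤ 4 * m₂) where

      single₃ : ∀ {m u g} → 2 + m₂ ≤ g → J₃ m (suc u) → J₃ (m + g) u
      single₃ {m} {u} {g} big (1≤m₀ , q , s , t) =
        1≤m₀ , ≤-trans q (*-monoʳ-≤ 4 (m≤m+n m g)) , spread-single m₀ {m} {u} {g} (≤-trans (s≤s z≤n) big) s ,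
        supply₄-single m₀ {m} {u} {g} (≤-trans (≤-trans (+-monoʳ-≤ 8 q₂) (≤-reflexive (sym (*-distribˡ-+ 4 2 m₂)))) (*-monoʳ-≤ 4 big)) t

      pair₃ : ∀ {m u g x} → 2 + m ≤ x → 2 * x ≤ p → 1 ≤ g → J₃ m (2 + u) → J₃ (m + g) u
      pair₃ {m} {u} {g} {x} big half 1≤g (1≤m₀ , q , s , t) =
        1≤m₀ , ≤-trans q (*-monoʳ-≤ 4 (m≤m+n m g)) , spread-pair m₀ {m} {u} {g} 1≤g s ,
        supply₄-pair m₀ {m} {u} {g} 1≤m₀ (≤-trans (*-monoʳ-≤ 2 big) (odd-half x (≤-trans (s≤s (s≤s z≤n)) big) half)) q s

      module Pairing = PassVerification 2 (2 + m₂) m₃ R₁ J₃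
        (λ {m} {u} {g} → single₃ {m} {u} {g}) (λ {m} {u} {g} {x} _ → pair₃ {m} {u} {g} {x})

      module Taking = PassVerification 0 (2 + m₂) m₃ R₁ J₃ (λ {m} {u} {g} → single₃ {m} {u} {g}) (λ ())

    after₀ : ∀ {vr ar} → P₀.Running p vr ar → vr 0 ≡ m₀ → Stage R₁ J₁ 2 m₀ vr ar
    after₀ {vr} {ar} s m≡ = record
      { inst = inst ; fresh = fresh ; extra = 1≤m₀ , λ v → ≤-trans (mult≤ v) mult1≤
      ; items = items ; m≡mₛ = m≡
      ; potential = 1≤m₀ ,
          ≤-trans (+-monoˡ-≤ m₀ potential) (≤-trans (≤-reflexive (trans (cong (λ z → z + U′ + m₀) m≡) (arrange₁ m₀ U′))) (≤-reflexive (cong (λ z → 2 * z + U′) (sym m≡)))) ,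
          ≤-trans potential (+-monoʳ-≤ (vr 0) (m≤m+n U′ _))
      ; lower = λ j 1≤j j<p uj → seen j 1≤j j<p uj ; next< = next< }
      where
      open P₀.Running s
      open P₀.At vr ar inst
      open PassInv state
      open Instance inst
      U′ = unused (ar 7)
      arrange₁ : ∀ m u → m + u + m ≡ 2 * m + u
      arrange₁ = solve-∀
      exclusive : ∀ j → 1 ≤ j → j ≤ n → eq (ar 5 j) 1 + isZero (ar 7 j) ≤ 1
      exclusive j 1≤j j≤n with ar 7 j in uj
      ... | suc _ = ≤-trans (≤-reflexive (+-identityʳ _)) (eq≤1 (ar 5 j) 1)
      ... | zero = ≤-reflexive (cong (_+ 1) (cong (λ b → if b then 1 else 0) (≢⇒≡ᵇ-false (ar 5 j) 1 (λ e → <⇒≱ (seen j 1≤j (≤n⇒<p j≤n) uj) (≤-reflexive e)))))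
      mult1≤ : mult (ar 5) 1 ≤ m₀
      mult1≤ = +-cancelʳ-≤ U′ _ _ (≤-trans (≤-reflexive (sym (sumTo-+ (λ j → eq (ar 5 j) 1) (λ j → isZero (ar 7 j)) n)))
        (≤-trans (sumTo-mono n exclusive) (≤-trans (≤-reflexive (trans (sumTo-const 1 n) (*-identityʳ n)))
          (≤-trans potential (≤-reflexive (cong (_+ U′) m≡))))))
      1≤m₀ : 1 ≤ m₀
      1≤m₀ = ≤-trans (≤-trans (≤-reflexive (sym (eq-refl (ar 5 1)))) (term≤sumTo (λ j → eq (ar 5 j) (ar 5 1)) n 1 ≤-refl n≥1))
        (≤-trans (mult≤ (ar 5 1)) mult1≤)

    -- Values up to p/2 fall into buckets of width m₀ + 1 numbered at most B = p/(2(m₀ + 1)),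
    -- rounded down, each keeping at most m₀ elements; `quarter-reached` applies.
    after₁ : ∀ {vr ar} → P₁.Running p vr ar → Σ ℕ λ m₂ → Stage R₁ J₂ 2 m₂ vr ar × n ≤ 4 * m₂
    after₁ {vr} {ar} s = vr 0 , record
      { inst = inst ; fresh = fresh ; extra = extra ; items = items ; m≡mₛ = refl
      ; potential = quarter , potential ; lower = lower ; next< = next< } , quarter
      where
      open P₁.Running s
      open P₁.At vr ar inst
      open PassInv state
      open Instance inst
      w = suc m₀
      B = divℕ p (2 * w)
      spec = divℕ-spec p (2 * w) (s≤s z≤n)
      regroup : ∀ b w → b * (2 * w) ≡ 2 * (b * w)
      regroup = solve-∀
      bounded : ∀ j → 1 ≤ j → j < p → ar 7 j ≡ 0 → divℕ (ar 5 j) w ≤ B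
      bounded j 1≤j j<p _ = ≤-pred (*-cancelʳ-< (2 * w) _ _ (≤-<-trans
        (≤-trans (≤-reflexive (regroup (divℕ (ar 5 j) w) w)) (≤-trans (*-monoʳ-≤ 2 (proj₁ (divℕ-spec (ar 5 j) w (s≤s z≤n)))) (r-half j 1≤j j<p)))
        (≤-trans (proj₂ spec) (≤-reflexive (+-comm (B * (2 * w)) (2 * w))))))
      conclude′ : 1 * n ≤ 4 * vr 0 ⊎ unused (ar 7) ≤ B * m₀ → n ≤ 4 * vr 0
      conclude′ (inj₁ late) = ≤-trans (≤-reflexive (sym (*-identityˡ n))) late
      conclude′ (inj₂ few) = quarter-reached m₀ {vr 0} {unused (ar 7)} B (proj₁ (proj₂ potential)) few
        (≤-trans (≤-reflexive (sym (regroup B w))) (≤-trans (proj₁ spec) (≤-reflexive (sym 1+n≡p))))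
      quarter : n ≤ 4 * vr 0
      quarter = conclude′ (bucket-count B m₀ state bounded (proj₂ extra))

    -- The purpose of this pass is the raised lower bound: what it did not take exceeds m₂ + 1,
    -- which the quarter bound makes a fixed fraction of p.
    after₂ : ∀ {vr ar} m₂ → n ≤ 4 * m₂ → P₂.Running m₂ p vr ar → Σ ℕ λ m₃ → Stage R₁ J₃ (2 + m₂) m₃ vr ar × n ≤ 4 * m₃
    after₂ {vr} {ar} m₂ q₂ s = vr 0 , record
      { inst = inst ; fresh = fresh ; extra = extra ; items = items ; m≡mₛ = refl
      ; potential = let q , 1≤m₀ , s , t = potential in 1≤m₀ , q , s , supply₂⇒₄ m₀ {vr 0} {unused (ar 7)} t
      ; lower = λ j 1≤j j<p uj → seen j 1≤j j<p uj ; next< = next< } , proj₁ potential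
      where
      open P₂.Running m₂ s
      open P₂.At m₂ vr ar inst
      open PassInv state

    -- The width m₃ + 1 now exceeds p/4, so values up to p/2 lie below twice the width and bucket 1
    -- is the only one in use.
    after₃ : ∀ {vr ar} m₂ m₃ (q₂ : n ≤ 4 * m₂) → n ≤ 4 * m₃ → P₃.Pairing.Running m₂ m₃ q₂ p vr ar →
      Σ ℕ λ m₄ → Stage R₁ J₃ (2 + m₂) m₄ vr ar × n ≤ 2 * m₄
    after₃ {vr} {ar} m₂ m₃ q₂ q₃ s = vr 0 , record
      { inst = inst ; fresh = fresh ; extra = extra ; items = items ; m≡mₛ = refl
      ; potential = potential ; lower = lower ; next< = next< } ,
      half-reached m₀ {vr 0} {unused (ar 7)} (proj₁ (proj₂ (proj₂ potential))) (bucket-count 1 m₀ state bounded (proj₂ extra))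
      where
      open P₃.Pairing.Running m₂ m₃ q₂ s
      open P₃.Pairing.At m₂ m₃ q₂ vr ar inst
      open PassInv state
      open Instance inst
      w = suc m₃
      arrange : ∀ m → 2 + 4 * m + 2 ≡ 2 * (2 * suc m)
      arrange = solve-∀
      p<4w : p < 2 * (2 * w)
      p<4w = ≤-trans (s≤s (≤-trans (≤-reflexive (sym 1+n≡p)) (s≤s q₃))) (≤-trans (m≤m+n (2 + 4 * m₃) 2) (≤-reflexive (arrange m₃)))
      bounded : ∀ j → 1 ≤ j → j < p → ar 7 j ≡ 0 → divℕ (ar 5 j) w ≤ 1
      bounded j 1≤j j<p _ = ≤-pred (*-cancelʳ-< w _ 2 (≤-<-trans (proj₁ (divℕ-spec (ar 5 j) w (s≤s z≤n)))
        (*-cancelˡ-< 2 _ _ (≤-<-trans (r-half j 1≤j j<p) p<4w))))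

    after₄ : ∀ {vr ar} m₂ m₄ (q₂ : n ≤ 4 * m₂) → n ≤ 2 * m₄ → P₃.Taking.Running m₂ m₄ q₂ p vr ar → n ≤ vr 0
    after₄ {vr} {ar} m₂ m₄ q₂ q₄ s = all-reached m₀ {vr 0} {unused (ar 7)} none (proj₂ (proj₂ (proj₂ potential)))
      where
      open P₃.Taking.Running m₂ m₄ q₂ s
      open P₃.Taking.At m₂ m₄ q₂ vr ar inst
      open PassInv state
      open Instance inst
      all-used : ∀ j → 1 ≤ j → j ≤ n → isZero (ar 7 j) ≡ 0
      all-used j 1≤j j≤n with ar 7 j in uj
      ... | suc _ = refl
      ... | zero = contradiction (≤-trans (*-monoʳ-≤ 2 (seen j 1≤j (≤n⇒<p j≤n) uj)) (≤-trans (r-half j 1≤j (≤n⇒<p j≤n)) (≤-reflexive (sym 1+n≡p))))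
                     (<⇒≱ (≤-trans (s≤s (s≤s q₄)) (≤-trans (+-monoˡ-≤ (2 * m₄) (m≤m+n 2 2)) (≤-reflexive (sym (*-distribˡ-+ 2 2 m₄))))))
      none : unused (ar 7) ≡ 0
      none = trans (sumTo-cong n all-used) (trans (sumTo-const 0 n) (*-zeroʳ n))

  -- Reading off the subset and writing the output

  record Grown (vr : Vars) (ar : Arrs) : Set where
    field
      inst  : Inst vr ar
      fresh : Fresh (ar 13)
      items : Items (ar 5) (vr 0) (vr 1) (vr 2) (ar 7) (ar 8) (ar 9)
      full  : n ≤ vr 0

  -- C is the natural number that the final selection sums to exactly: the initial remainder, namely
  -- target minus `base` modulo p, plus all the `lo` values. The remainder is below p and so within
  -- an interval of length at least p - 1.
  record Selecting (k : ℕ) (vr : Vars) (ar : Arrs) : Set where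
    field
      inst      : Inst vr ar
      items     : Items (ar 5) (vr 0) (vr 1) (vr 2) (ar 7) (ar 8) (ar 9)
      C         : ℕ
      C≈t       : C ≈ vr 4
      ρ<p       : vr 10 < p
      selection : Selection (ar 5) (ar 8) (ar 9) (ar 7) C (p ∸ k) (vr 10) (ar 13)

  beginSelect : Triple Grown (blk (10 ≔ (var 4 ⊕ (pp ⊖ var 2)) ⊛ pp)) (Selecting 1)
  beginSelect = blk-rule _ body
    where
    body : ∀ j vr ar → Grown vr ar → wp (10 ≔ (var 4 ⊕ (pp ⊖ var 2)) ⊛ pp) (Selecting 1) j vr ar
    body j vr ar g = ((tt , tt , tt) , tt) , ≤p⇒≤V (<⇒≤ ρ<p) , record
      { inst = inst ; items = items ; C = ρ + L ; ρ<p = ρ<p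
      ; C≈t = ≈-trans (+-cong-≈ (modℕ-≈ (vr 4 + (p ∸ vr 2))) (≈-sym base≈))
          (≈-trans (≡⇒≈ (trans (+-assoc (vr 4) _ _) (cong (vr 4 +_) (m∸n+n≡m (<⇒≤ base<p)))))
            (≈-trans (+-cong-≈ (≡⇒≈ {vr 4} refl) p≈0) (≡⇒≈ (+-identityʳ (vr 4)))))
      ; selection = record
          { within = ≤-trans (<p⇒≤n ρ<p) (≤-trans full (≤-reflexive (sym total)))
          ; split = cong (_+ (ρ + L)) (trans (sumTo-cong n (λ i _ i≤n → cong (_* ar 5 i) (fresh i (<p⇒<N (≤n⇒<p i≤n))))) (trans (sumTo-const 0 n) (*-zeroʳ n)))
          ; sel≤1 = λ i i<p → ≤-trans (≤-reflexive (fresh i (<p⇒<N i<p))) z≤n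
          ; fresh = λ i i<p 1≤s → contradiction (≤-trans 1≤s (≤-reflexive (fresh i (<p⇒<N i<p)))) λ () } }
      where
      open Grown g
      open Items items
      ρ = modℕ (vr 4 + (p ∸ vr 2)) p
      L = sumTo (λ k → ar 5 (ar 8 k)) n
      ρ<p : ρ < p
      ρ<p = modℕ<p (vr 4 + (p ∸ vr 2))

  selected : Triple (Selecting 1) (loop selectBody) (Selecting p)
  selected = loop-rule Selecting selectBody body
    where
    body : ∀ k vr ar → 1 ≤ k → k < p → Selecting k vr ar → wp selectBody (Selecting (suc k)) k vr ar
    -- Round k undoes item p - k. Items beyond the count are empty and merely write to selection
    -- cell 0, which no sum includes.
    body k vr ar 1≤k k<p s = (tt , tt) , ≤p⇒≤V (m∸n≤m p k) , inner (p ∸ k) p∸k≡ q<p selection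
      where
      open Selecting s
      open Items items
      q = p ∸ suc k
      p∸k≡ : p ∸ k ≡ suc q
      p∸k≡ = +-∸-assoc 1 k<p
      q<p : suc q < p
      q<p = subst (_< p) p∸k≡ (∸-monoʳ-< 1≤k (<⇒≤ k<p))
      inner : ∀ b → b ≡ suc q → suc q < p → Selection (ar 5) (ar 8) (ar 9) (ar 7) C b (vr 10) (ar 13) →
        wp (7 ≔ rd 8 (var 9) ⨾ 11 ≔ rd 9 (var 9) ⨾
            (when var 10 ≺ rd 5 (var 11) ⊖ rd 5 (var 7)
             then (13 [ var 7 ]≔ lit 1)
             else (13 [ var 11 ]≔ lit 1 ⨾ 10 ≔ var 10 ⊖ (rd 5 (var 11) ⊖ rd 5 (var 7))))) (Selecting (suc k)) k (update vr 9 b) ar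
      inner b refl b<p sel =
        (tt , <p⇒<N b<p , tt) , ≤p⇒≤V (<⇒≤ l<p) , (tt , <p⇒<N b<p , tt) , ≤p⇒≤V (<⇒≤ h<p) ,
        (tt , (tt , <p⇒<N h<p , tt) , (tt , <p⇒<N l<p , tt)) ,
        (λ ρ<g → (tt , <p⇒<N l<p , tt) , tt , ≤p⇒≤V 1≤p ,
          record { inst = inst ; items = items ; C = C ; C≈t = C≈t ; ρ<p = ρ<p ; selection = pick-lo (Instance.r0 inst) items b<p sel ρ<g }) ,
        λ g≤ρ → (tt , <p⇒<N h<p , tt) , tt , ≤p⇒≤V 1≤p ,
          (tt , (tt , <p⇒<N h<p , tt) , (tt , <p⇒<N l<p , tt)) , ≤p⇒≤V (<⇒≤ (≤-<-trans (m∸n≤m (vr 10) (ar 5 (ar 9 (suc q)) ∸ ar 5 (ar 8 (suc q)))) ρ<p)) ,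
          record { inst = inst ; items = items ; C = C ; C≈t = C≈t ; ρ<p = ≤-<-trans (m∸n≤m (vr 10) (ar 5 (ar 9 (suc q)) ∸ ar 5 (ar 8 (suc q)))) ρ<p
                 ; selection = pick-hi (Instance.r0 inst) items b<p sel g≤ρ }
        where
        l<p = lo<p (suc q) (s≤s z≤n) b<p
        h<p = hi<p (suc q) (s≤s z≤n) b<p

  out : Arrs → ℕ → ℕ
  out ar j = modℕ (ar 13 j + ar 6 j) 2

  record Writing (k : ℕ) (vr : Vars) (ar : Arrs) : Set where
    field
      correct : modℕ (sumTo (chosen d (out ar)) n) p ≡ τ
      written′ : ∀ j → 1 ≤ j → j < k → ar 14 (p + j) ≡ out ar j × (K < p + j → ar 0 (p + j) ≡ out ar j)

  beginWrite : ∀ {vr ar} → Selecting p vr ar → Writing 1 vr ar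
  beginWrite {vr} {ar} s = record
    { correct = link (ar 13) (λ j _ j<p → sel≤1 j j<p) (≈-trans (≡⇒≈ (trans (sym (trans (cong (Σsel +_) rest≡0) (+-identityʳ Σsel))) split)) C≈t)
    ; written′ = λ { j 1≤j j<1 → contradiction (≤-pred j<1) (<⇒≱ 1≤j) } }
    where
    open Selecting s
    open Selection selection
    open Instance inst
    Σsel = sumTo (λ j → ar 13 j * ar 5 j) n
    p∸p≡0 : p ∸ p ≡ 0
    p∸p≡0 = n∸n≡0 p
    rest≡0 : vr 10 + sumTo (λ k → ar 5 (ar 8 k)) (p ∸ p) ≡ 0
    rest≡0 = cong₂ _+_ (n≤0⇒n≡0 (subst (λ z → vr 10 ≤ sumTo (gain (ar 5) (ar 8) (ar 9)) z) p∸p≡0 within))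
      (cong (sumTo (λ k → ar 5 (ar 8 k))) p∸p≡0)

  written-all : Triple (Writing 1) (loop outputBody) (Writing p)
  written-all = loop-rule Writing outputBody body
    where
    body : ∀ k vr ar → 1 ≤ k → k < p → Writing k vr ar → wp outputBody (Writing (suc k)) k vr ar
    body k vr ar 1≤k k<p s =
      (((tt , k<N , tt) , (tt , k<N , tt)) , tt) , v≤V , ((tt , tt) , a<N , tt) , tt , v≤V ,
      (tt , tt , tt) ,
      (λ K<a → ((tt , tt) , a<N , K<a) , tt , v≤V , record { correct = correct
        ; written′ = both (update (ar 0) (p + k) v) (λ _ → update-same (ar 0) (p + k) v) (λ j ne → update-other (ar 0) (p + k) v (λ e → ne (+-cancelˡ-≡ p j k e))) }) ,
      λ a≤K → record { correct = correct ; written′ = both (ar 0) (λ K<a → contradiction a≤K (<⇒≱ K<a)) (λ _ _ → refl) }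
      where
      open Writing s
      k<N = <p⇒<N k<p
      a<N : p + k < N
      a<N = ≤-trans (+-monoʳ-< p k<p) 2p≤N
      v = out ar k
      v≤V : v ≤ V
      v≤V = ≤p⇒≤V (≤-trans (<⇒≤ (proj₁ (modℕ-spec (ar 13 k + ar 6 k) 2 (s≤s z≤n)))) 2≤p)
      both : ∀ (low : ℕ → ℕ) → (K < p + k → low (p + k) ≡ v) → (∀ j → j ≢ k → low (p + j) ≡ ar 0 (p + j)) →
        ∀ j → 1 ≤ j → j < suc k → update (ar 14) (p + k) v (p + j) ≡ out ar j × (K < p + j → low (p + j) ≡ out ar j)
      both low here′ away j 1≤j j<k with j ≟ k
      ... | yes refl = update-same (ar 14) (p + k) v , here′
      ... | no j≢k with written′ j 1≤j (≤∧≢⇒< (≤-pred j<k) j≢k)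
      ... | e₁ , e₂ = trans (update-other (ar 14) (p + k) v (λ e → j≢k (+-cancelˡ-≡ p j k e))) e₁ , λ K<a → trans (away j j≢k) (e₂ K<a)

  finished : Triple Grown (blk (10 ≔ (var 4 ⊕ (pp ⊖ var 2)) ⊛ pp) ▸ loop selectBody ▸ loop outputBody) (Delivered p d τ)
  finished = seq-rule _ _ beginSelect (seq-rule _ _ selected
    (conseq-rule beginWrite (λ {vr} {ar} s → out ar , (λ j 1≤j j<p → Writing.written′ s j 1≤j j<p) , Writing.correct s) written-all))

  growth : ∀ m₀ → Triple (Stage (R₁ m₀) (J₁ m₀) 2 m₀) (pass 1 ▸ pass 0 ▸ pass 2 ▸ pass 0 ▸
    blk (10 ≔ (var 4 ⊕ (pp ⊖ var 2)) ⊛ pp) ▸ loop selectBody ▸ loop outputBody) (Delivered p d τ)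
  growth m₀ = seq-rule (pass 1) _ (conseq-rule (λ s → s) (after₁ m₀) (P₁.passed m₀)) (exists-rule λ m₂ →
    seq-rule (pass 0) _ (second m₂) (exists-rule λ { (q₂ , m₃) →
      seq-rule (pass 2) _ (third m₂ m₃ q₂) (exists-rule λ m₄ →
        seq-rule (pass 0) _ (fourth m₂ m₄ q₂) finished) }))
    where
    given : ∀ {A : Set} {Φ Ψ : Asrt} {k} → (A → Triple Φ k Ψ) → Triple (λ vr ar → Φ vr ar × A) k Ψ
    valid (given t) ok (φ , a) s code = valid (t a) ok φ s code
    second : ∀ m₂ → Triple (λ vr ar → Stage (R₁ m₀) (J₂ m₀) 2 m₂ vr ar × n ≤ 4 * m₂) (pass 0)
      (λ vr ar → Σ (n ≤ 4 * m₂ × ℕ) λ { (_ , m₃) → Stage (R₁ m₀) (J₃ m₀) (2 + m₂) m₃ vr ar × n ≤ 4 * m₃ })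
    second m₂ = given λ q₂ → conseq-rule (λ s → s)
      (λ s → let m₃ , st , q₃ = after₂ m₀ m₂ q₂ s in (q₂ , m₃) , st , q₃) (P₂.passed m₀ m₂)
    third : ∀ m₂ m₃ → n ≤ 4 * m₂ → Triple (λ vr ar → Stage (R₁ m₀) (J₃ m₀) (2 + m₂) m₃ vr ar × n ≤ 4 * m₃) (pass 2)
      (λ vr ar → Σ ℕ λ m₄ → Stage (R₁ m₀) (J₃ m₀) (2 + m₂) m₄ vr ar × n ≤ 2 * m₄)
    third m₂ m₃ q₂ = given λ q₃ → conseq-rule (λ s → s) (after₃ m₀ m₂ m₃ q₂ q₃) (P₃.Pairing.passed m₀ m₂ m₃ q₂)
    fourth : ∀ m₂ m₄ → n ≤ 4 * m₂ → Triple (λ vr ar → Stage (R₁ m₀) (J₃ m₀) (2 + m₂) m₄ vr ar × n ≤ 2 * m₄) (pass 0) Grown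
    fourth m₂ m₄ q₂ = given λ q₄ → conseq-rule (λ s → s) (grown q₄) (P₃.Taking.passed m₀ m₂ m₄ q₂)
      where
      grown : n ≤ 2 * m₄ → ∀ {vr ar} → P₃.Taking.Running m₀ m₂ m₄ q₂ p vr ar → Grown vr ar
      grown q₄ {vr} {ar} s = record { inst = inst ; fresh = fresh ; items = items ; full = after₄ m₀ m₂ m₄ q₂ q₄ s }
        where
        open P₃.Taking.Running m₀ m₂ m₄ q₂ s
        open P₃.Taking.At m₀ m₂ m₄ q₂ vr ar inst
        open PassInv state

  correct : Triple (Init p N d τ) algorithm (Delivered p d τ)
  correct = seq-rule normalise _ normalised (seq-rule (pass 0) _
    (conseq-rule begin-growth (λ {vr} s → vr 0 , after₀ (vr 0) s refl) P₀.passed) (exists-rule growth))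

-- The program and its constant

abstract

  solver : Program
  solver = program algorithm

  -- One constant serves as time factor, space factor and word exponent, so it adds up the three
  -- demands: the total cost, I arrays of 32p cells each, and the exponent 193 that exceeds every
  -- word.
  solver-steps solver-constant : ℕ
  solver-steps = length prologue + (cost (length prologue) algorithm + length epilogue)
  solver-constant = solver-steps + (I * 32 + 193)

  solver-bounds : Bounds solver-constant solver algorithm 5 (K ∸ 1)
  solver-bounds = place algorithm 5 (K ∸ 1) (m≤m+n solver-steps (I * 32 + 193))
    (≤-trans (m≤m+n (I * 32) 193) (m≤n+m (I * 32 + 193) solver-steps))
    (≤-trans (m≤n+m 193 (I * 32)) (m≤n+m (I * 32 + 193) solver-steps))

theorem4 : Σ Program λ P → Σ ℕ λ c →
    (p : ℕ) → Prime p → (d : ℕ → ℕ) → (τ : ℕ) →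
    (∀ j → 1 ≤ j → j < p → (1 ≤ d j × d j < p)) → τ < p →
    Halted P (run P (c * p) (initConfig p d τ)) ×
    (∀ t → t < c * p → StepWithin P (c * p) ((p + 2) ^ c) (run P t (initConfig p d τ))) ×
    (modℕ (subsetSum p d (mem (run P (c * p) (initConfig p d τ)))) p ≡ τ)
theorem4 = solver , solver-constant , λ p prime d τ hd τ<p →
  conclude solver-bounds _ refl refl (nonTrivial⇒n>1 p {{prime⇒nonTrivial prime}}) (λ j 1≤j j<p → proj₂ (hd j 1≤j j<p)) τ<p
    (λ N 2≤p N≡ S W hS hW → Verification.correct p N 2≤p N≡ solver S W hS hW prime d τ hd τ<p)
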